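{- Let $G$ be a simple cubic claw-free matching covered graph that is not minimal matching covered. Then: (i) $b^{*}(G)\geq 1$ and $|RE(G)|=\sum_{i=1}^{b^{*}(G)} n_i$, where $n_1,\dots,n_{b^{*}(G)}$ are the numbers of vertices of the bricks of $G$ that are different from $K_4$ and $\overline{C_6}$; (ii) $|RE(G)|\geq 12$, and this bound is sharp: there exist simple cubic claw-free matching covered graphs that are not minimal matching covered and have exactly 12 removable edges.
   Context: A graph is matching covered if it is connected, has at least two vertices, and every edge lies in a perfect matching. An edge $e$ of a matching covered graph $G$ is removable if $G-e$ is matching covered; $RE(G)$ is the set of removable edges; $G$ is minimal matching covered if $RE(G)=\emptyset$. Claw-free: no induced $K_{1,3}$. $\overline{C_6}$ is the complement of the 6-cycle (triangular prism). For $X\subset V(G)$ nonempty proper, $\partial(X)$ is the set of edges with exactly one end in $X$; it is nontrivial if $|X|\ge2$ and $|V(G)\setminus X|\ge 2$. $G\{X\}$ denotes the graph obtained from $G$ by shrinking $V(G)\setminus X$ to a single vertex (keeping multiple edges); $G\{X\}$ and $G\{V(G)\setminus X\}$ are the two $\partial(X)$-contractions. A cut $C$ of a matching covered graph is tight if every perfect matching meets $C$ in exactly one edge. A matching covered graph with no nontrivial tight cut is a brace if bipartite and a brick otherwise. Repeatedly taking both contractions along nontrivial tight cuts (both contractions are matching covered) until none remain yields a list of bricks and braces (the tight cut decomposition); this list is independent of the choices made, up to multiple edges. $b^*(G)$ is the number of bricks in this list that are different from $K_4$ and $\overline{C_6}$. -}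

module Defs where

open import Data.Nat using (ℕ; zero; suc; _+_; _≤_)
open import Data.Fin using (Fin; toℕ) renaming (_≟_ to _≟ᶠ_)
open import Data.Fin.Properties using ()
open import Data.Bool using (Bool; true; false; _∧_; _∨_; not; _xor_; if_then_else_)
open import Data.List using (List; []; _∷_; length; lookup; map; filterᵇ; removeAt)
open import Data.List.Membership.Propositional using (_∈_)
open import Data.List.Relation.Binary.Permutation.Propositional using (_↭_)
open import Data.Product using (Σ; ∃; _×_; _,_; proj₁; proj₂)
open import Data.Sum using (_⊎_)
open import Data.Empty using (⊥)
open import Relation.Nullary using (¬_)
open import Relation.Nullary.Decidable using (⌊_⌋)
open import Relation.Binary.PropositionalEquality using (_≡_; _≢_)
open import Function.Bundles using (_↔_; _⇔_; Inverse)
open import Data.Nat.DivMod using (_%_)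

-- Finite (multi)graphs: vertex set Fin n, edges a list of ordered pairs
-- (orientation irrelevant). Edge i is  lookup (edges G) i.
-- Parallel edges are allowed (needed for tight cut contractions).

record Graph : Set where
  constructor mkGraph
  field
    n     : ℕ
    edges : List (Fin n × Fin n)

open Graph public

Edge : Graph → Set
Edge G = Fin (length (edges G))

ends : (G : Graph) → Edge G → Fin (n G) × Fin (n G)
ends G i = lookup (edges G) i

count : ∀ {m} → (Fin m → Bool) → ℕ
count {zero}  p = 0
count {suc m} p = (if p Fin.zero then 1 else 0) + count (λ i → p (Fin.suc i))

incidentᵇ : ∀ {k} → Fin k × Fin k → Fin k → Bool
incidentᵇ (a , b) v = ⌊ a ≟ᶠ v ⌋ ∨ ⌊ b ≟ᶠ v ⌋

Adj : (G : Graph) → Fin (n G) → Fin (n G) → Set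
Adj G u v = ((u , v) ∈ edges G) ⊎ ((v , u) ∈ edges G)

degree : (G : Graph) → Fin (n G) → ℕ
degree G v = count (λ (i : Edge G) → incidentᵇ (ends G i) v)

Simple : Graph → Set
Simple G = (∀ (i : Edge G) → proj₁ (ends G i) ≢ proj₂ (ends G i))
         × (∀ (i j : Edge G) → i ≢ j →
              ends G i ≢ ends G j
            × ends G i ≢ (proj₂ (ends G j) , proj₁ (ends G j)))

Cubic : Graph → Set
Cubic G = ∀ v → degree G v ≡ 3

ClawFree : Graph → Set
ClawFree G = ∀ (v a b c : Fin (n G)) →
  Adj G v a → Adj G v b → Adj G v c →
  a ≢ b → a ≢ c → b ≢ c →
  ¬ Adj G a b → ¬ Adj G a c → ¬ Adj G b c → ⊥

PerfectMatching : (G : Graph) → (Edge G → Bool) → Set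
PerfectMatching G M =
  ∀ v → count (λ (i : Edge G) → M i ∧ incidentᵇ (ends G i) v) ≡ 1

data Reach (G : Graph) : Fin (n G) → Fin (n G) → Set where
  here : ∀ {u} → Reach G u u
  step : ∀ {u v w} → Adj G u v → Reach G v w → Reach G u w

Connected : Graph → Set
Connected G = ∀ u v → Reach G u v

MatchingCovered : Graph → Set
MatchingCovered G =
  Connected G × 2 ≤ n G ×
  (∀ (e : Edge G) → Σ (Edge G → Bool) λ M → PerfectMatching G M × M e ≡ true)

deleteEdge : (G : Graph) → Edge G → Graph
deleteEdge G e = mkGraph (n G) (removeAt (edges G) e)

Removable : (G : Graph) → Edge G → Set
Removable G e = MatchingCovered (deleteEdge G e)

MinimalMatchingCovered : Graph → Set
MinimalMatchingCovered G = MatchingCovered G × (∀ e → ¬ Removable G e)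

REcount : Graph → ℕ → Set
REcount G k = Σ (Edge G → Bool) λ S →
  count S ≡ k × (∀ e → (S e ≡ true) ⇔ Removable G e)

inCutᵇ : (G : Graph) → (Fin (n G) → Bool) → Edge G → Bool
inCutᵇ G X e = X (proj₁ (ends G e)) xor X (proj₂ (ends G e))

NontrivialCut : (G : Graph) → (Fin (n G) → Bool) → Set
NontrivialCut G X = 2 ≤ count X × 2 ≤ count (λ v → not (X v))

Tight : (G : Graph) → (Fin (n G) → Bool) → Set
Tight G X = ∀ M → PerfectMatching G M →
  count (λ e → M e ∧ inCutᵇ G X e) ≡ 1

NontrivialTightCut : (G : Graph) → (Fin (n G) → Bool) → Set
NontrivialTightCut G X = NontrivialCut G X × Tight G X

-- H ≅ G{X}: H is (up to renaming of vertices and reordering of edges) the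
-- graph obtained from G by shrinking V(G) ∖ X to a single vertex c,
-- keeping multiple edges and discarding edges with both ends in V(G) ∖ X
-- (which would become loops).
Contraction : (G : Graph) → (Fin (n G) → Bool) → Graph → Set
Contraction G X H =
  Σ (Fin (n G) → Fin (n H)) λ φ → Σ (Fin (n H)) λ c →
    (∀ u v → X u ≡ true → X v ≡ true → φ u ≡ φ v → u ≡ v)
  × (∀ v → X v ≡ false → φ v ≡ c)
  × (∀ v → X v ≡ true → φ v ≢ c)
  × (∀ w → ∃ λ v → φ v ≡ w)
  × (edges H ↭ map (λ e → (φ (proj₁ e) , φ (proj₂ e)))
                   (filterᵇ (λ e → X (proj₁ e) ∨ X (proj₂ e)) (edges G)))

NoNontrivialTightCut : Graph → Set
NoNontrivialTightCut G = ∀ X → ¬ NontrivialTightCut G X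

data TCD : Graph → List Graph → Set where
  leaf  : ∀ {G} → MatchingCovered G → NoNontrivialTightCut G → TCD G (G ∷ [])
  split : ∀ {G H₁ H₂ L₁ L₂} (X : Fin (n G) → Bool) →
          MatchingCovered G → NontrivialTightCut G X →
          Contraction G X H₁ → Contraction G (λ v → not (X v)) H₂ →
          TCD H₁ L₁ → TCD H₂ L₂ → TCD G (L₁ Data.List.++ L₂)

Bipartite : Graph → Set
Bipartite G = Σ (Fin (n G) → Bool) λ col →
  ∀ (e : Edge G) → col (proj₁ (ends G e)) ≢ col (proj₂ (ends G e))

-- K4 and the complement of C6, compared up to multiple edges
-- (i.e. via the underlying simple graph).

K4Adj : Fin 4 → Fin 4 → Set
K4Adj u v = u ≢ v

C6Adj : Fin 6 → Fin 6 → Set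
C6Adj u v = (toℕ v ≡ (toℕ u + 1) % 6) ⊎ (toℕ u ≡ (toℕ v + 1) % 6)

C6barAdj : Fin 6 → Fin 6 → Set
C6barAdj u v = u ≢ v × ¬ C6Adj u v

UnderlyingIso : (G : Graph) → (k : ℕ) → (Fin k → Fin k → Set) → Set
UnderlyingIso G k A = Σ (Fin (n G) ↔ Fin k) λ f →
  ∀ u v → (u ≢ v × Adj G u v) ⇔ A (Inverse.to f u) (Inverse.to f v)

IsK4 : Graph → Set
IsK4 G = UnderlyingIso G 4 K4Adj

IsC6bar : Graph → Set
IsC6bar G = UnderlyingIso G 6 C6barAdj

-- SpecialBricks L ns : ns lists (in order) the numbers of vertices of the
-- members of the decomposition list L that are bricks (non-bipartite)
-- different from K4 and C6bar.  length ns = b*(G).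
data SpecialBricks : List Graph → List ℕ → Set where
  []   : SpecialBricks [] []
  keep : ∀ {H L ns} → ¬ Bipartite H → ¬ IsK4 H → ¬ IsC6bar H →
         SpecialBricks L ns → SpecialBricks (H ∷ L) (n H ∷ ns)
  skip : ∀ {H L ns} → (Bipartite H ⊎ IsK4 H ⊎ IsC6bar H) →
         SpecialBricks L ns → SpecialBricks (H ∷ L) ns

{-# OPTIONS --safe #-}
-- Shrinking the triangles of a graph in the theorem, and regarding diamonds as links of a path, leaves
-- a cubic graph whose edges are called spinal below.  A perfect matching is determined, up to two
-- choices in each diamond, by the spinal edges it misses, and these form an arbitrary element of the
-- cycle space; so perfect matchings can be added over 𝔽₂.  This forces every nontrivial tight cut to
-- consist of one spinal edge and two edges at a common vertex a whose other ends coincide or are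
-- adjacent.  Consequently contractions along tight cuts stay in the class of cubic multigraphs in which
-- every vertex lies in a triangle or a digon, and the number of removable edges without a parallel edge
-- (the weight) is additive: the two edges at a are parallel in one contraction and behave in the other
-- one as in the original graph.
--
-- In a graph of the class without nontrivial tight cuts a digon makes the graph bipartite and a diamond
-- makes it K₄.  Otherwise every vertex lies in exactly one triangle, and spinal edges contained in the
-- same perfect matchings are equal, because otherwise a cycle-space argument yields a nontrivial tight
-- cut.  If a triangle edge e is contained in every perfect matching through some other edge, linear
-- algebra identifies the three spinal edges of two triangles, and the graph is the prism.  Otherwise all
-- triangle edges are removable: there are n of them, and n ≥ 12, since a triangle together with the
-- triangles at the other ends of its three spinal edges has twelve vertices.
module Submission where

open import Defs
open import Data.Bool using (Bool; true; false; _∧_; _∨_; not; _xor_; if_then_else_)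
open import Data.Bool.Properties using (∨-zeroʳ; ∧-zeroʳ; ∧-identityʳ; ∧-comm; xor-same; not-involutive) renaming (_≟_ to _≟ᵇ_)
open import Data.Empty using (⊥; ⊥-elim)
open import Data.Fin using (Fin; zero; suc; toℕ; fromℕ<; _≟_; #_; remQuot; combine)
open import Data.Fin.Patterns
open import Data.Fin.Properties using (any?; all?; injective⇒≤; suc-injective; combine-remQuot; toℕ<n)
open import Data.Fin.Subset.Properties using (anySubset?)
open import Data.List using (List; []; _∷_; length; lookup; removeAt; filterᵇ; _++_) renaming (map to mapL)
open import Data.List.Relation.Unary.Any using (index)
open import Data.List.Relation.Unary.Any.Properties using (lookup-index)
open import Data.List.Membership.Propositional.Properties using (∈-lookup)
open import Data.List.Relation.Binary.Permutation.Propositional using (_↭_; refl; prep; swap; trans)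
open import Data.Nat using (ℕ; zero; suc; _+_; _≤_; z≤n; s≤s)
import Data.Nat as ℕ
open import Data.Nat.DivMod using (_%_; _mod_)
open import Data.Nat.Properties using (≤-antisym; ≤-refl; ≤-trans; +-suc; +-comm; +-identityʳ; +-monoˡ-≤; +-monoʳ-≤; m≤m+n; m≤n⇒m≤1+n)
open import Data.Nat.ListAction using (sum)
open import Data.Nat.ListAction.Properties using (sum-++)
open import Data.Product using (Σ; ∃; ∃₂; _×_; _,_; proj₁; proj₂; uncurry)
open import Data.Sum using (_⊎_; inj₁; inj₂; [_,_]′)
open import Data.Vec using (Vec; []; _∷_; tabulate) renaming (lookup to lookupᵛ)
open import Data.Vec.Properties using (lookup∘tabulate)
open import Data.Product.Properties using (≡-dec)
open import Function using (_∘_; id; case_of_)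
open import Function.Bundles using (Equivalence; Inverse; mk⇔; mk↔ₛ′; _⇔_)
open import Relation.Binary.PropositionalEquality using (_≡_; _≢_; refl; sym; cong; cong₂; subst; subst₂; ≢-sym) renaming (trans to ≡-trans)
open import Relation.Nullary using (¬_; Dec; yes; no; contradiction)
open import Relation.Nullary.Decidable using (⌊_⌋; _×-dec_; _⊎-dec_; ¬?; map′; toWitness; _→-dec_; decidable-stable)

-- A spinal edge gets the coordinate 0 if it is in the matching and 1 if it is missed. So the
-- matching of all spinal edges is the zero vector, and being a matching it meets a tight cut in
-- exactly one spinal edge. A matching through a rib (a non-spinal edge) at an end of that edge
-- omits it and has to cross elsewhere, which produces ribs in the cut; sums of matchings then rule
-- out all but three cut edges. Two difficulties shape the definitions. The digon, triangle or
-- diamond found at a vertex is found without regard to its neighbours, so whether an edge is spinal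
-- must not depend on such a choice; it is read off from parallels and triangles in the whole graph.
-- And a contraction creates parallel edges, each of which can be deleted whatever its status in the
-- original graph; counting them would spoil additivity. The case distinctions on matchings and cuts
-- are decided by search through the finitely many sets of edges or vertices.

¬true : ∀ {b} → b ≢ true → b ≡ false
¬true {false} _ = refl
¬true {true}  h = contradiction refl h

¬false : ∀ {b} → b ≢ false → b ≡ true
¬false {true}  _ = refl
¬false {false} h = contradiction refl h

true≢false : ∀ {b} → b ≡ true → b ≡ false → ⊥
true≢false refl ()

∧-true : ∀ {a b} → a ∧ b ≡ true → a ≡ true × b ≡ true
∧-true {true} {true} _ = refl , refl

∧-intro : ∀ {a b} → a ≡ true → b ≡ true → a ∧ b ≡ true
∧-intro refl refl = refl

∨-true : ∀ {a b} → a ∨ b ≡ true → a ≡ true ⊎ b ≡ true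
∨-true {true}  _ = inj₁ refl
∨-true {false} h = inj₂ h

∨-introˡ : ∀ {a} b → a ≡ true → a ∨ b ≡ true
∨-introˡ b refl = refl

∨-introʳ : ∀ a {b} → b ≡ true → a ∨ b ≡ true
∨-introʳ a refl = ∨-zeroʳ a

⌊⌋-true : ∀ {P : Set} {d : Dec P} → ⌊ d ⌋ ≡ true → P
⌊⌋-true {d = yes p} _ = p

⌊⌋-intro : ∀ {P : Set} (d : Dec P) → P → ⌊ d ⌋ ≡ true
⌊⌋-intro (yes _) _ = refl
⌊⌋-intro (no ¬p) p = contradiction p ¬p

⌊⌋-reject : ∀ {P : Set} (d : Dec P) → ¬ P → ⌊ d ⌋ ≡ false
⌊⌋-reject (yes p) ¬p = contradiction p ¬p
⌊⌋-reject (no _)  _  = refl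

bool-ext : ∀ {a b} → (a ≡ true → b ≡ true) → (b ≡ true → a ≡ true) → a ≡ b
bool-ext {true}  {true}  _ _ = refl
bool-ext {false} {false} _ _ = refl
bool-ext {true}  {false} f _ = sym (f refl)
bool-ext {false} {true}  _ g = g refl

-- Boolean formulas and truth tables

infixr 4.5 _⇒_
_⇒_ : Bool → Bool → Bool
true  ⇒ b = b
false ⇒ b = true

mp : ∀ {a b} → a ⇒ b ≡ true → a ≡ true → b ≡ true
mp h refl = h

infix 7 _==_
-- On spinal edges this is the addition of perfect matchings: if both arguments are complements of
-- elements of 𝔽₂, the result is the complement of their sum.
_==_ : Bool → Bool → Bool
true  == b = b
false == b = not b

==-sound : ∀ {a b} → a == b ≡ true → a ≡ b
==-sound {true}  {true}  _ = refl
==-sound {false} {false} _ = refl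

==-intro : ∀ {a b} → a ≡ b → a == b ≡ true
==-intro {true}  refl = refl
==-intro {false} refl = refl

==-cancel : ∀ {a b c d} → a == b ≡ c == d → b ≡ d → a ≡ c
==-cancel {true}  {true}  {true}  {true}  _ refl = refl
==-cancel {true}  {false} {true}  {false} _ refl = refl
==-cancel {false} {true}  {false} {true}  _ refl = refl
==-cancel {false} {false} {false} {false} _ refl = refl

allRows : ∀ n → (Vec Bool n → Bool) → Bool
allRows zero    f = f []
allRows (suc n) f = allRows n (λ v → f (true ∷ v)) ∧ allRows n (λ v → f (false ∷ v))

-- Proof by reflection: with `refl` as second argument the type checker evaluates the whole table.
-- All linear algebra inside a digon, triangle or diamond, with up to twelve edge values, is settled
-- in this way.
tautology : ∀ {n} (f : Vec Bool n → Bool) → allRows n f ≡ true → ∀ v → f v ≡ true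
tautology f h []          = h
tautology f h (true  ∷ v) = tautology (f ∘ (true ∷_)) (proj₁ (∧-true h)) v
tautology f h (false ∷ v) = tautology (f ∘ (false ∷_)) (proj₂ (∧-true {allRows _ (f ∘ (true ∷_))} h)) v

-- Counting

-- `pick` lists the elements satisfying `p` in order and `rank` gives the place of an element in
-- this list. Comparing two counts thereby becomes finding an injection between finite types.
pick : ∀ {m} (p : Fin m → Bool) → Fin (count p) → Fin m
pick {suc m} p j with p zero
pick {suc m} p zero    | true  = zero
pick {suc m} p (suc j) | true  = suc (pick (p ∘ suc) j)
pick {suc m} p j       | false = suc (pick (p ∘ suc) j)

pick-true : ∀ {m} (p : Fin m → Bool) j → p (pick p j) ≡ true
pick-true {suc m} p j with p zero in eq
pick-true {suc m} p zero    | true  = eq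
pick-true {suc m} p (suc j) | true  = pick-true (p ∘ suc) j
pick-true {suc m} p j       | false = pick-true (p ∘ suc) j

pick-injective : ∀ {m} (p : Fin m → Bool) {i j} → pick p i ≡ pick p j → i ≡ j
pick-injective {suc m} p {i} {j} eq with p zero
pick-injective {suc m} p {zero}  {zero}  eq | true  = refl
pick-injective {suc m} p {suc i} {suc j} eq | true  = cong suc (pick-injective (p ∘ suc) (suc-injective eq))
pick-injective {suc m} p {i}     {j}     eq | false = pick-injective (p ∘ suc) (suc-injective eq)

rank : ∀ {m} (p : Fin m → Bool) i → p i ≡ true → Fin (count p)
rank {suc m} p zero h with p zero
rank {suc m} p zero h | true = zero
rank {suc m} p (suc i) h with p zero
... | true  = suc (rank (p ∘ suc) i h)
... | false = rank (p ∘ suc) i h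

pick-rank : ∀ {m} (p : Fin m → Bool) i h → pick p (rank p i h) ≡ i
pick-rank {suc m} p zero h with p zero
pick-rank {suc m} p zero h | true = refl
pick-rank {suc m} p (suc i) h with p zero
... | true  = cong suc (pick-rank (p ∘ suc) i h)
... | false = cong suc (pick-rank (p ∘ suc) i h)

rank-injective : ∀ {m} (p : Fin m → Bool) {i j} h k → rank p i h ≡ rank p j k → i ≡ j
rank-injective p h k eq =
  ≡-trans (sym (pick-rank p _ h)) (≡-trans (cong (pick p) eq) (pick-rank p _ k))

count-≤ : ∀ {m k} {p : Fin m → Bool} {q : Fin k → Bool} (f : Fin m → Fin k) →
          (∀ i → p i ≡ true → q (f i) ≡ true) →
          (∀ i j → p i ≡ true → p j ≡ true → f i ≡ f j → i ≡ j) → count p ≤ count q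
count-≤ {p = p} {q} f f-true f-inj =
  injective⇒≤ {f = λ j → rank q (f (pick p j)) (f-true _ (pick-true p j))}
    λ {i} {j} eq → pick-injective p
      (f-inj _ _ (pick-true p i) (pick-true p j) (rank-injective q _ _ eq))

count-cong : ∀ {m} {p q : Fin m → Bool} → (∀ i → p i ≡ q i) → count p ≡ count q
count-cong {zero}  eq = refl
count-cong {suc m} eq = cong₂ (λ b c → (if b then 1 else 0) + c) (eq zero) (count-cong (eq ∘ suc))

count-bij : ∀ {m k} {p : Fin m → Bool} {q : Fin k → Bool} (f : Fin m → Fin k) →
            (∀ i → p i ≡ true → q (f i) ≡ true) →
            (∀ i j → p i ≡ true → p j ≡ true → f i ≡ f j → i ≡ j) →
            (∀ j → q j ≡ true → ∃ λ i → p i ≡ true × f i ≡ j) → count p ≡ count q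
count-bij {m} {k} {p} {q} f f-true f-inj f-onto = ≤-antisym (count-≤ f f-true f-inj)
  (injective⇒≤ {f = λ j → rank p (inv j) (inv-true j)}
    λ {i} {j} eq → pick-injective q (≡-trans (sym (inv-f i))
      (≡-trans (cong f (rank-injective p _ _ eq)) (inv-f j))))
  where
  inv : Fin (count q) → Fin m
  inv j = proj₁ (f-onto (pick q j) (pick-true q j))
  inv-true : ∀ j → p (inv j) ≡ true
  inv-true j = proj₁ (proj₂ (f-onto (pick q j) (pick-true q j)))
  inv-f : ∀ j → f (inv j) ≡ pick q j
  inv-f j = proj₂ (proj₂ (f-onto (pick q j) (pick-true q j)))

count-all : ∀ m → count {m} (λ _ → true) ≡ m
count-all zero    = refl
count-all (suc m) = cong suc (count-all m)

count-none : ∀ {m} {p : Fin m → Bool} → (∀ i → p i ≢ true) → count p ≡ 0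
count-none {zero}          h = refl
count-none {suc m} {p} h with p zero in eq
... | true  = contradiction eq (h zero)
... | false = count-none (h ∘ suc)

count-∨ : ∀ {m} (p q : Fin m → Bool) → (∀ i → p i ≡ true → q i ≡ true → ⊥) →
          count (λ i → p i ∨ q i) ≡ count p + count q
count-∨ {zero}  p q disj = refl
count-∨ {suc m} p q disj with p zero in eq | q zero in eq′
... | true  | true  = ⊥-elim (disj zero eq eq′)
... | true  | false = cong suc (count-∨ (p ∘ suc) (q ∘ suc) (disj ∘ suc))
... | false | true  = ≡-trans (cong suc (count-∨ (p ∘ suc) (q ∘ suc) (disj ∘ suc))) (sym (+-suc _ _))
... | false | false = count-∨ (p ∘ suc) (q ∘ suc) (disj ∘ suc)

count-enum : ∀ {m k} {p : Fin m → Bool} → count p ≡ k →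
             ∃ λ (f : Fin k → Fin m) → (∀ i j → f i ≡ f j → i ≡ j) × (∀ i → p (f i) ≡ true) ×
                                       (∀ i → p i ≡ true → ∃ λ j → f j ≡ i)
count-enum {p = p} refl =
  pick p , (λ _ _ → pick-injective p) , pick-true p , (λ i h → rank p i h , pick-rank p i h)

-- Counts equal to 1, which define perfect matchings and tight cuts, are converted to this form, in
-- which the unique edge is available by name.
Unique : ∀ {m} → (Fin m → Set) → Set
Unique P = ∃ λ e → P e × (∀ f → P f → f ≡ e)

count1⇒unique : ∀ {m} {p : Fin m → Bool} → count p ≡ 1 → Unique (λ e → p e ≡ true)
count1⇒unique {p = p} h with count-enum {p = p} h
... | f , _ , f-true , f-onto = f zero , f-true zero , λ i hi → case f-onto i hi of λ { (zero , eq) → sym eq }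

unique⇒count1 : ∀ {m} {p : Fin m → Bool} → Unique (λ e → p e ≡ true) → count p ≡ 1
unique⇒count1 {p = p} (e , pe , uniq) =
  count-bij {q = λ (_ : Fin 1) → true} (λ _ → zero) (λ _ _ → refl)
    (λ i j hi hj _ → ≡-trans (uniq i hi) (sym (uniq j hj))) (λ { zero _ → e , pe , refl })

two≤⇒another : ∀ {m} {p : Fin m → Bool} → 2 ≤ count p → ∀ v → ∃ λ u → u ≢ v × p u ≡ true
two≤⇒another {p = p} h v with count p in eq
two≤⇒another {p = p} (s≤s (s≤s _)) v | suc (suc k) with count-enum {p = p} eq
... | f , f-inj , f-true , _ with f zero ≟ v
... | no f≢v  = f zero , f≢v , f-true zero
... | yes refl = f (suc zero) , (λ eq′ → case f-inj (suc zero) zero eq′ of λ ()) , f-true (suc zero)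

distinct⇒two≤ : ∀ {m} {p : Fin m → Bool} {u v} → u ≢ v → p u ≡ true → p v ≡ true → 2 ≤ count p
distinct⇒two≤ {p = p} {u} {v} u≢v pu pv =
  injective⇒≤ {f = f} (λ { {zero} {zero} _ → refl ; {suc zero} {suc zero} _ → refl
                         ; {zero} {suc zero} eq → contradiction (rank-injective p pu pv eq) u≢v
                         ; {suc zero} {zero} eq → contradiction (sym (rank-injective p pv pu eq)) u≢v })
  where
  f : Fin 2 → Fin (count p)
  f zero       = rank p u pu
  f (suc zero) = rank p v pv

decide-all : ∀ {m} {P Q : Fin m → Set} → (∀ i → P i ⊎ Q i) → (∀ i → P i) ⊎ ∃ Q
decide-all {zero}  h = inj₁ λ ()
decide-all {suc m} h with h zero
... | inj₂ q = inj₂ (zero , q)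
... | inj₁ p with decide-all (h ∘ suc)
... | inj₁ ps      = inj₁ λ { zero → p ; (suc i) → ps i }
... | inj₂ (i , q) = inj₂ (suc i , q)

-- Incidence, stars and perfect matchings

module _ (G : Graph) where

  V : Set
  V = Fin (n G)

  src tgt : Edge G → V
  src e = proj₁ (ends G e)
  tgt e = proj₂ (ends G e)

  data In (e : Edge G) (v : V) : Set where
    at-src : src e ≡ v → In e v
    at-tgt : tgt e ≡ v → In e v

  data Joins (e : Edge G) (u v : V) : Set where
    fwd : src e ≡ u → tgt e ≡ v → Joins e u v
    bwd : src e ≡ v → tgt e ≡ u → Joins e u v

  Loopless : Set
  Loopless = ∀ e → src e ≢ tgt e

  record Star (v : V) (a b c : Edge G) : Set where
    constructor mkStar
    field
      a≢b : a ≢ b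
      a≢c : a ≢ c
      b≢c : b ≢ c
      a-in : In a v
      b-in : In b v
      c-in : In c v
      cover : ∀ e → In e v → e ≡ a ⊎ e ≡ b ⊎ e ≡ c

  -- The edges p and q at v lie in a common triangle or form a digon; in contrast to claw-freeness
  -- this is inherited by contractions along tight cuts.
  record Corner (v : V) : Set where
    constructor mkCorner
    field
      {s p q} : Edge G
      {x y}   : V
      star    : Star v s p q
      p-joins : Joins p v x
      q-joins : Joins q v y
      close   : x ≡ y ⊎ ∃ λ r → Joins r x y

  record Cornered : Set where
    field
      loopless : Loopless
      corner   : ∀ v → Corner v

  record PM (M : Edge G → Bool) : Set where
    constructor mkPM
    field matched : ∀ v → Unique (λ e → M e ≡ true × In e v)


joins-sym : ∀ {G e u v} → Joins G e u v → Joins G e v u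
joins-sym (fwd h k) = bwd h k
joins-sym (bwd h k) = fwd h k

joins-inˡ : ∀ {G e u v} → Joins G e u v → In G e u
joins-inˡ (fwd h k) = at-src h
joins-inˡ (bwd h k) = at-tgt k

joins-inʳ : ∀ {G e u v} → Joins G e u v → In G e v
joins-inʳ = joins-inˡ ∘ joins-sym

joins-ends : ∀ {G e u v w} → Joins G e u v → In G e w → w ≡ u ⊎ w ≡ v
joins-ends (fwd refl refl) (at-src l) = inj₁ (sym l)
joins-ends (fwd refl refl) (at-tgt l) = inj₂ (sym l)
joins-ends (bwd refl refl) (at-src l) = inj₂ (sym l)
joins-ends (bwd refl refl) (at-tgt l) = inj₁ (sym l)

joins-unique : ∀ {G e u v w} → Joins G e u v → Joins G e u w → v ≡ w
joins-unique (fwd h k) (fwd h′ k′) = ≡-trans (sym k) k′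
joins-unique (fwd h k) (bwd h′ k′) = ≡-trans (sym k) (≡-trans k′ (≡-trans (sym h) h′))
joins-unique (bwd h k) (fwd h′ k′) = ≡-trans (sym h) (≡-trans h′ (≡-trans (sym k) k′))
joins-unique (bwd h k) (bwd h′ k′) = ≡-trans (sym h) h′

joins-irrefl : ∀ {G e u v} → Loopless G → Joins G e u v → u ≢ v
joins-irrefl ll (fwd h k) refl = ll _ (≡-trans h (sym k))
joins-irrefl ll (bwd h k) refl = ll _ (≡-trans h (sym k))

in⇒joins : ∀ {G e u} → In G e u → ∃ λ v → Joins G e u v
in⇒joins (at-src h) = _ , fwd h refl
in⇒joins (at-tgt h) = _ , bwd refl h

in²⇒joins : ∀ {G e u v} → u ≢ v → In G e u → In G e v → Joins G e u v
in²⇒joins u≢v (at-src h) (at-src k) = contradiction (≡-trans (sym h) k) u≢v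
in²⇒joins u≢v (at-src h) (at-tgt k) = fwd h k
in²⇒joins u≢v (at-tgt h) (at-src k) = bwd k h
in²⇒joins u≢v (at-tgt h) (at-tgt k) = contradiction (≡-trans (sym h) k) u≢v

ends-joins : ∀ G e → Joins G e (src G e) (tgt G e)
ends-joins G e = fwd refl refl

joins? : ∀ G e u v → Dec (Joins G e u v)
joins? G e u v = map′ [ (λ (h , k) → fwd h k) , (λ (h , k) → bwd h k) ]′
  (λ { (fwd h k) → inj₁ (h , k) ; (bwd h k) → inj₂ (h , k) })
  (((src G e ≟ u) ×-dec (tgt G e ≟ v)) ⊎-dec ((src G e ≟ v) ×-dec (tgt G e ≟ u)))

incident⇒in : ∀ G e v → incidentᵇ (ends G e) v ≡ true → In G e v
incident⇒in G e v h with ∨-true {⌊ src G e ≟ v ⌋} h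
... | inj₁ k = at-src (⌊⌋-true k)
... | inj₂ k = at-tgt (⌊⌋-true k)

in⇒incident : ∀ G e v → In G e v → incidentᵇ (ends G e) v ≡ true
in⇒incident G e v (at-src h) = ∨-introˡ _ (⌊⌋-intro (src G e ≟ v) h)
in⇒incident G e v (at-tgt h) = ∨-introʳ ⌊ src G e ≟ v ⌋ (⌊⌋-intro (tgt G e ≟ v) h)

adj⇒joins : ∀ G {u v} → Adj G u v → ∃ λ e → Joins G e u v
adj⇒joins G (inj₁ m) = index m , fwd (cong proj₁ (sym (lookup-index m))) (cong proj₂ (sym (lookup-index m)))
adj⇒joins G (inj₂ m) = index m , bwd (cong proj₁ (sym (lookup-index m))) (cong proj₂ (sym (lookup-index m)))

joins⇒adj : ∀ G {u v} e → Joins G e u v → Adj G u v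
joins⇒adj G e (fwd refl refl) = inj₁ (∈-lookup e)
joins⇒adj G e (bwd refl refl) = inj₂ (∈-lookup e)

module _ {G : Graph} where

  rotate : ∀ {v a b c} → Star G v a b c → Star G v b c a
  rotate (mkStar a≢b a≢c b≢c ia ib ic cov) = mkStar b≢c (≢-sym a≢b) (≢-sym a≢c) ib ic ia
    λ e h → [ inj₂ ∘ inj₂ , [ inj₁ , inj₂ ∘ inj₁ ]′ ]′ (cov e h)

  flip : ∀ {v a b c} → Star G v a b c → Star G v a c b
  flip (mkStar a≢b a≢c b≢c ia ib ic cov) = mkStar a≢c a≢b (≢-sym b≢c) ia ic ib
    λ e h → [ inj₁ , [ inj₂ ∘ inj₂ , inj₂ ∘ inj₁ ]′ ]′ (cov e h)

  private
    complete₁ : ∀ {v a b c q} → Star G v a b c → In G q v → a ≢ q → ∃ λ t → Star G v t a q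
    complete₁ st q-in a≢q with Star.cover st _ q-in
    ... | inj₁ refl        = contradiction refl a≢q
    ... | inj₂ (inj₁ refl) = _ , rotate (rotate st)
    ... | inj₂ (inj₂ refl) = _ , rotate (rotate (flip st))

  complete : ∀ {v a b c p q} → Star G v a b c → In G p v → In G q v → p ≢ q → ∃ λ t → Star G v t p q
  complete st p-in q-in p≢q with Star.cover st _ p-in
  ... | inj₁ refl        = complete₁ st q-in p≢q
  ... | inj₂ (inj₁ refl) = complete₁ (rotate st) q-in p≢q
  ... | inj₂ (inj₂ refl) = complete₁ (rotate (rotate st)) q-in p≢q

  pm⇒PM : ∀ {M} → PerfectMatching G M → PM G M
  pm⇒PM {M} h .PM.matched v with count1⇒unique {p = λ e → M e ∧ incidentᵇ (ends G e) v} (h v)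
  ... | e , pe , uniq = e , (proj₁ (∧-true pe) , incident⇒in G e v (proj₂ (∧-true {M e} pe)))
      , λ f (Mf , f-in) → uniq f (∧-intro Mf (in⇒incident G f v f-in))

  PM⇒pm : ∀ {M} → PM G M → PerfectMatching G M
  PM⇒pm {M} h v with PM.matched h v
  ... | e , (Me , e-in) , uniq = unique⇒count1
    (e , ∧-intro Me (in⇒incident G e v e-in)
       , λ f pf → uniq f (proj₁ (∧-true pf) , incident⇒in G f v (proj₂ (∧-true {M f} pf))))

  PM-cong : ∀ {M N : Edge G → Bool} → (∀ e → M e ≡ N e) → PM G M → PM G N
  PM-cong eq h .PM.matched v with PM.matched h v
  ... | e , (Me , e-in) , uniq = e , (≡-trans (sym (eq e)) Me , e-in)
      , λ f (Nf , f-in) → uniq f (≡-trans (eq f) Nf , f-in)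

  PM-unique : ∀ {M : Edge G → Bool} {e f v} → PM G M → M e ≡ true → In G e v → M f ≡ true → In G f v → e ≡ f
  PM-unique {v = v} pm Me e-in Mf f-in =
    ≡-trans (proj₂ (proj₂ (PM.matched pm v)) _ (Me , e-in)) (sym (proj₂ (proj₂ (PM.matched pm v)) _ (Mf , f-in)))

  PM-reject : ∀ {M : Edge G → Bool} {e f v} → PM G M → M e ≡ true → In G e v → In G f v → f ≢ e → M f ≡ false
  PM-reject pm Me e-in f-in f≢e = ¬true λ Mf → f≢e (PM-unique pm Mf f-in Me e-in)

one : Bool → Bool → Bool → Bool
one a b c = (a ∧ not b ∧ not c) ∨ (not a ∧ b ∧ not c) ∨ (not a ∧ not b ∧ c)

one-left : ∀ a b c → one a b c ≡ true → b ≡ false → c ≡ false → a ≡ true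
one-left true _ _ _ refl refl = refl

two-left : ∀ a b c → one a b c ≡ true → a ≡ false → b ∨ c ≡ true
two-left _ true  _    _ refl = refl
two-left _ false true _ refl = refl

module _ {G : Graph} where

  PM⇒one : ∀ {M : Edge G → Bool} {v a b c} → Star G v a b c → PM G M → one (M a) (M b) (M c) ≡ true
  PM⇒one {M} {v} {a} {b} {c} st pm with PM.matched pm v
  ... | e , (Me , e-in) , uniq with Star.cover st e e-in
  ... | inj₁ refl rewrite Me | PM-reject pm Me e-in (Star.b-in st) (≢-sym (Star.a≢b st))
                             | PM-reject pm Me e-in (Star.c-in st) (≢-sym (Star.a≢c st)) = refl
  ... | inj₂ (inj₁ refl) rewrite Me | PM-reject pm Me e-in (Star.a-in st) (Star.a≢b st)
                                    | PM-reject pm Me e-in (Star.c-in st) (≢-sym (Star.b≢c st)) = refl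
  ... | inj₂ (inj₂ refl) rewrite Me | PM-reject pm Me e-in (Star.a-in st) (Star.a≢c st)
                                    | PM-reject pm Me e-in (Star.b-in st) (Star.b≢c st) = refl

  -- The predicate is left open because it serves two purposes: the three edges at a vertex, and the
  -- three edges of a cut that is to be shown tight.
  one⇒unique-among : ∀ {M : Edge G → Bool} {P : Edge G → Set} {a b c} → P a → P b → P c →
                     (∀ e → P e → e ≡ a ⊎ e ≡ b ⊎ e ≡ c) → one (M a) (M b) (M c) ≡ true →
                     Unique (λ e → M e ≡ true × P e)
  one⇒unique-among {M} {P} {a} {b} {c} pa pb pc cov h with M a in Ma | M b in Mb | M c in Mc | h
  ... | true  | false | false | _ = a , (Ma , pa) , λ f (Mf , pf) → case cov f pf of λ
    { (inj₁ eq) → eq ; (inj₂ (inj₁ refl)) → ⊥-elim (true≢false Mf Mb) ; (inj₂ (inj₂ refl)) → ⊥-elim (true≢false Mf Mc) }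
  ... | false | true  | false | _ = b , (Mb , pb) , λ f (Mf , pf) → case cov f pf of λ
    { (inj₁ refl) → ⊥-elim (true≢false Mf Ma) ; (inj₂ (inj₁ eq)) → eq ; (inj₂ (inj₂ refl)) → ⊥-elim (true≢false Mf Mc) }
  ... | false | false | true  | _ = c , (Mc , pc) , λ f (Mf , pf) → case cov f pf of λ
    { (inj₁ refl) → ⊥-elim (true≢false Mf Ma) ; (inj₂ (inj₁ refl)) → ⊥-elim (true≢false Mf Mb) ; (inj₂ (inj₂ eq)) → eq }

  one⇒unique : ∀ {M : Edge G → Bool} {v a b c} → Star G v a b c → one (M a) (M b) (M c) ≡ true →
               Unique (λ e → M e ≡ true × In G e v)
  one⇒unique st = one⇒unique-among (Star.a-in st) (Star.b-in st) (Star.c-in st) (Star.cover st)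

-- Matching covered graphs

record Covered (G : Graph) : Set where
  field
    connected : Connected G
    two≤      : 2 ≤ n G
    through   : ∀ e → ∃ λ M → PM G M × M e ≡ true

mc⇒covered : ∀ {G} → MatchingCovered G → Covered G
mc⇒covered (con , two , thr) = record
  { connected = con ; two≤ = two
  ; through = λ e → proj₁ (thr e) , pm⇒PM (proj₁ (proj₂ (thr e))) , proj₂ (proj₂ (thr e)) }

covered⇒mc : ∀ {G} → Covered G → MatchingCovered G
covered⇒mc h = connected , two≤ , λ e → proj₁ (through e) , PM⇒pm (proj₁ (proj₂ (through e))) , proj₂ (proj₂ (through e))
  where open Covered h

closed-all : ∀ {G} → Connected G → (S : V G → Bool) → (∀ e u w → Joins G e u w → S u ≡ true → S w ≡ true) →
             ∀ {v} → S v ≡ true → ∀ u → S u ≡ true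
closed-all {G} con S closed {v} Sv u = go (con v u) Sv
  where
  go : ∀ {v u} → Reach G v u → S v ≡ true → S u ≡ true
  go here       h = h
  go (step a r) h = go r (closed _ _ _ (proj₂ (adj⇒joins G a)) h)

-- Cuts and tight cuts

record Cut (G : Graph) (X : V G → Bool) (e : Edge G) : Set where
  constructor mkCut
  field crosses : inCutᵇ G X e ≡ true

open Cut

private
  xor-true : ∀ {a b} → a xor b ≡ true → a ≡ not b
  xor-true {true}  {false} _ = refl
  xor-true {false} {true}  _ = refl

  xor-true′ : ∀ {a b} → a xor b ≡ true → b ≡ not a
  xor-true′ {true}  {false} _ = refl
  xor-true′ {false} {true}  _ = refl

cut⇒≢ : ∀ {G X e u v} → Cut G X e → Joins G e u v → X u ≡ not (X v)
cut⇒≢ (mkCut h) (fwd refl refl) = xor-true h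
cut⇒≢ (mkCut h) (bwd refl refl) = xor-true′ h

≢⇒cut : ∀ {G X e u v} → X u ≡ true → X v ≡ false → Joins G e u v → Cut G X e
≢⇒cut hu hv (fwd refl refl) = mkCut (cong₂ _xor_ hu hv)
≢⇒cut hu hv (bwd refl refl) = mkCut (cong₂ _xor_ hv hu)

¬cut⇒≡ : ∀ {G X e u v} → ¬ Cut G X e → Joins G e u v → X u ≡ X v
¬cut⇒≡ {X = X} {u = u} {v} h j with X u in hu | X v in hv
... | true  | true  = refl
... | false | false = refl
... | true  | false = contradiction (≢⇒cut hu hv j) h
... | false | true  = contradiction (≢⇒cut hv hu (joins-sym j)) h

OneCross : ∀ G → (V G → Bool) → (Edge G → Bool) → Set
OneCross G X M = Unique (λ e → M e ≡ true × Cut G X e)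

tight⇒ : ∀ {G X M} → Tight G X → PM G M → OneCross G X M
tight⇒ {M = M} t pm with count1⇒unique (t M (PM⇒pm pm))
... | e , h , uniq = e , (proj₁ (∧-true h) , mkCut (proj₂ (∧-true {M e} h)))
                       , λ f (Mf , f-cut) → uniq f (∧-intro Mf (crosses f-cut))

⇒tight : ∀ {G X} → (∀ {M} → PM G M → OneCross G X M) → Tight G X
⇒tight h M pm with h (pm⇒PM pm)
... | e , (Me , e-cut) , uniq =
  unique⇒count1 (e , ∧-intro Me (crosses e-cut)
                   , λ f hf → uniq f (proj₁ (∧-true hf) , mkCut (proj₂ (∧-true {M f} hf))))

-- That a side has two vertices is expressed as: no single vertex exhausts it. In this form it
-- refutes cuts that isolate one vertex.
record NTC (G : Graph) (X : V G → Bool) : Set where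
  field
    inside  : ∀ v → ∃ λ u → u ≢ v × X u ≡ true
    outside : ∀ v → ∃ λ u → u ≢ v × X u ≡ false
    tight   : ∀ {M} → PM G M → OneCross G X M

not-true : ∀ {b} → not b ≡ true → b ≡ false
not-true {false} _ = refl

not-false : ∀ {b} → b ≡ false → not b ≡ true
not-false refl = refl

ntc⇒NTC : ∀ {G X} → NontrivialTightCut G X → NTC G X
ntc⇒NTC {X = X} ((i , o) , t) = record
  { inside = two≤⇒another i
  ; outside = λ v → let u , u≢v , h = two≤⇒another {p = λ v → not (X v)} o v in u , u≢v , not-true h
  ; tight = tight⇒ t }

-- Removability

-- A perfect matching of G - e through `f`, viewed in `G` itself, so that no deletion has to be
-- carried out.
record Avoid (G : Graph) (f e : Edge G) : Set where
  constructor mkAvoid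
  field
    {M} : Edge G → Bool
    pm  : PM G M
    has : M f ≡ true
    not-has : M e ≡ false

record Parallel (G : Graph) (e f : Edge G) : Set where
  constructor mkParallel
  field
    f≢e   : f ≢ e
    joins : Joins G f (src G e) (tgt G e)

-- Excluding edges that have a parallel makes the count of removable edges additive along tight cuts.
record StrictlyRemovable (G : Graph) (e : Edge G) : Set where
  constructor mkSR
  field
    avoidable   : ∀ f → f ≢ e → Avoid G f e
    nonparallel : ∀ f → ¬ Parallel G e f

-- Search through all edge sets. This makes removability a Boolean function that can be counted, and
-- allows arguing from the failure of avoidance.
avoid? : ∀ G f e → Dec (Avoid G f e)
avoid? G f e = map′
  (λ (s , pm , Mf , Me) → mkAvoid (pm⇒PM pm) Mf Me)
  (λ (mkAvoid {M} pm Mf Me) → tabulate M , PM⇒pm (PM-cong (λ i → sym (lookup∘tabulate M i)) pm)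
     , ≡-trans (lookup∘tabulate M f) Mf , ≡-trans (lookup∘tabulate M e) Me)
  (anySubset? λ s → all? (λ v → count (λ i → lookupᵛ s i ∧ incidentᵇ (ends G i) v) ℕ.≟ 1)
                    ×-dec ((lookupᵛ s f ≟ᵇ true) ×-dec (lookupᵛ s e ≟ᵇ false)))

strictlyRemovable? : ∀ G e → Dec (StrictlyRemovable G e)
strictlyRemovable? G e = map′
  (λ (a , np) → mkSR a λ f (mkParallel f≢e j) → np f (f≢e , j))
  (λ (mkSR a np) → a , λ f (f≢e , j) → np f (mkParallel f≢e j))
  (all? (λ f → ¬? (f ≟ e) →-dec avoid? G f e) ×-dec
   all? (λ f → ¬? (¬? (f ≟ e) ×-dec joins? G f (src G e) (tgt G e))))

opaque
  removableᵇ : ∀ G → Edge G → Bool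
  removableᵇ G e = ⌊ strictlyRemovable? G e ⌋

  removableᵇ⇒ : ∀ {G e} → removableᵇ G e ≡ true → StrictlyRemovable G e
  removableᵇ⇒ = ⌊⌋-true

  ⇒removableᵇ : ∀ {G e} → StrictlyRemovable G e → removableᵇ G e ≡ true
  ⇒removableᵇ {G} {e} = ⌊⌋-intro (strictlyRemovable? G e)

weight : Graph → ℕ
weight G = count (removableᵇ G)

parallel-of : ∀ {G e f u v} → Joins G e u v → Joins G f u v → f ≢ e → Parallel G e f
parallel-of (fwd refl refl) j f≢e = mkParallel f≢e j
parallel-of (bwd refl refl) j f≢e = mkParallel f≢e (joins-sym j)

of-parallel : ∀ {G e f u v} → Joins G e u v → Parallel G e f → Joins G f u v
of-parallel (fwd refl refl) (mkParallel _ j) = j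
of-parallel (bwd refl refl) (mkParallel _ j) = joins-sym j

-- Local structure of cornered graphs: digons, triangles and diamonds

Nbr : ∀ G → V G → V G → Set
Nbr G u z = ∃ λ f → Joins G f u z

Common : ∀ G → Edge G → V G → Set
Common G e z = Nbr G (src G e) z × Nbr G (tgt G e) z

-- An edge is spinal unless it has a parallel or lies in exactly one triangle; the spinal
-- edges of a large enough matching covered cornered graph form a perfect matching.
Ribbed : ∀ G → Edge G → Set
Ribbed G e = (∃ λ f → f ≢ e × Joins G f (src G e) (tgt G e))
           ⊎ (∃ λ z → Common G e z × (∀ z′ → Common G e z′ → z′ ≡ z))

common? : ∀ G e z → Dec (Common G e z)
common? G e z = any? (λ f → joins? G f _ z) ×-dec any? (λ f → joins? G f _ z)

ribbed? : ∀ G e → Dec (Ribbed G e)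
ribbed? G e = any? (λ f → ¬? (f ≟ e) ×-dec joins? G f _ _)
            ⊎-dec any? (λ z → common? G e z ×-dec all? (λ z′ → common? G e z′ →-dec (z′ ≟ z)))

opaque
  spinal : ∀ G → Edge G → Bool
  spinal G e = not ⌊ ribbed? G e ⌋

  ribbed⇒ : ∀ {G e} → Ribbed G e → spinal G e ≡ false
  ribbed⇒ {G} {e} h = cong not (⌊⌋-intro (ribbed? G e) h)

  ¬ribbed⇒ : ∀ {G e} → ¬ Ribbed G e → spinal G e ≡ true
  ¬ribbed⇒ {G} {e} h = cong not (⌊⌋-reject (ribbed? G e) h)

record Hub (G : Graph) (v : V G) (s p q : Edge G) (w x y : V G) : Set where
  constructor mkHub
  field
    star : Star G v s p q
    js   : Joins G s v w
    jp   : Joins G p v x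
    jq   : Joins G q v y

hub-flip : ∀ {G v s p q w x y} → Hub G v s p q w x y → Hub G v s q p w y x
hub-flip (mkHub st js jp jq) = mkHub (flip st) js jq jp

hub-rotate : ∀ {G v s p q w x y} → Hub G v s p q w x y → Hub G v p q s x y w
hub-rotate (mkHub st js jp jq) = mkHub (rotate st) jp jq js

record Digon (G : Graph) (v x : V G) : Set where
  constructor mkDigon
  field
    {s t p q} : Edge G
    {w w′}    : V G
    hub-v     : Hub G v s p q w x x
    hub-x     : Hub G x t p q w′ v v
    w≢x       : w ≢ x

record Tri (G : Graph) (v x y : V G) : Set where
  constructor mkTri
  field
    {s sx sy p q r} : Edge G
    {w wx wy}       : V G
    hub-v           : Hub G v s p q w x y
    hub-x           : Hub G x sx p r wx v y
    hub-y           : Hub G y sy q r wy v x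

tri-flip : ∀ {G v x y} → Tri G v x y → Tri G v y x
tri-flip (mkTri hv hx hy) = mkTri (hub-flip hv) hy hx

tri-rotate : ∀ {G v x y} → Tri G v x y → Tri G x y v
tri-rotate (mkTri hv hx hy) = mkTri (hub-flip hx) (hub-flip hy) hv

-- The tips are `a` and `d`, the chord `k` joins `u` and `b`, and `sa`, `sd` leave at the tips. The
-- inequations place the other ends of `sa` and `sd` outside the diamond; in particular the graph is
-- not K₄.
record Diamond (G : Graph) (a u b d : V G) : Set where
  constructor mkDiamond
  field
    {k p q p′ q′ sa sd} : Edge G
    {wa wd}             : V G
    hub-a : Hub G a sa p q wa u b
    hub-u : Hub G u p′ p k d a b
    hub-b : Hub G b q′ q k d a u
    hub-d : Hub G d sd p′ q′ wd u b
    a≢d   : a ≢ d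
    wa≢d  : wa ≢ d
    wa≢u  : wa ≢ u
    wa≢b  : wa ≢ b
    wd≢a  : wd ≢ a
    wd≢u  : wd ≢ u
    wd≢b  : wd ≢ b

diamond-flip : ∀ {G a u b d} → Diamond G a u b d → Diamond G a b u d
diamond-flip (mkDiamond ha hu hb hd a≢d h₁ h₂ h₃ h₄ h₅ h₆) =
  mkDiamond (hub-flip ha) hb hu (hub-flip hd) a≢d h₁ h₃ h₂ h₄ h₆ h₅

diamond-turn : ∀ {G a u b d} → Diamond G a u b d → Diamond G d u b a
diamond-turn (mkDiamond ha hu hb hd a≢d h₁ h₂ h₃ h₄ h₅ h₆) =
  mkDiamond hd (swap₁₂ hu) (swap₁₂ hb) ha (≢-sym a≢d) h₄ h₅ h₆ h₁ h₂ h₃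
  where
  swap₁₂ : ∀ {G v s p q w x y} → Hub G v s p q w x y → Hub G v p s q x w y
  swap₁₂ = hub-flip ∘ hub-rotate

-- A common neighbour outside the triangle of two of its vertices would put the edge between them
-- into a second triangle; the inequations exclude this.
record Clean (G : Graph) (v x y : V G) : Set where
  constructor mkClean
  field
    tri   : Tri G v x y
    w≢wx  : Tri.w tri ≢ Tri.wx tri
    w≢wy  : Tri.w tri ≢ Tri.wy tri
    wx≢wy : Tri.wx tri ≢ Tri.wy tri
  open Tri tri public

clean-flip : ∀ {G v x y} → Clean G v x y → Clean G v y x
clean-flip (mkClean t h₁ h₂ h₃) = mkClean (tri-flip t) h₂ h₁ (≢-sym h₃)

clean-rotate : ∀ {G v x y} → Clean G v x y → Clean G x y v
clean-rotate (mkClean t h₁ h₂ h₃) = mkClean (tri-rotate t) h₃ (≢-sym h₁) (≢-sym h₂)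

data Unit (G : Graph) (v : V G) : Set where
  digon : ∀ {x} → Digon G v x → Unit G v
  clean : ∀ {x y} → Clean G v x y → Unit G v
  tip   : ∀ {u b d} → Diamond G v u b d → Unit G v
  mid   : ∀ {a b d} → Diamond G a v b d → Unit G v

-- The two exceptions: with two vertices every edge has a parallel and none is spinal, while in K₄
-- every edge lies in two triangles and all are spinal. In neither case do the spinal edges form a
-- perfect matching.
data Small (G : Graph) : Set where
  theta : ∀ {v x : V G} → (∀ u → u ≡ v ⊎ u ≡ x) → Small G
  k4    : ∀ {v x y w : V G} (t : Tri G v x y) → Tri.w t ≡ w → Tri.wx t ≡ w → Tri.wy t ≡ w →
          (∀ u → u ≡ v ⊎ u ≡ x ⊎ u ≡ y ⊎ u ≡ w) → Small G

module Local (G : Graph) (loopless : Loopless G) (cov : Covered G) where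

  open Covered cov

  irrefl : ∀ {e u v} → Joins G e u v → u ≢ v
  irrefl = joins-irrefl loopless

  hub-edge : ∀ {v s p q w x y e z} → Hub G v s p q w x y → Joins G e v z →
             (e ≡ s × z ≡ w) ⊎ (e ≡ p × z ≡ x) ⊎ (e ≡ q × z ≡ y)
  hub-edge (mkHub st js jp jq) j with Star.cover st _ (joins-inˡ j)
  ... | inj₁ refl        = inj₁ (refl , joins-unique j js)
  ... | inj₂ (inj₁ refl) = inj₂ (inj₁ (refl , joins-unique j jp))
  ... | inj₂ (inj₂ refl) = inj₂ (inj₂ (refl , joins-unique j jq))

  hub-nbr : ∀ {v s p q w x y z} → Hub G v s p q w x y → Nbr G v z → z ≡ w ⊎ z ≡ x ⊎ z ≡ y
  hub-nbr h (e , j) with hub-edge h j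
  ... | inj₁ (_ , eq)        = inj₁ eq
  ... | inj₂ (inj₁ (_ , eq)) = inj₂ (inj₁ eq)
  ... | inj₂ (inj₂ (_ , eq)) = inj₂ (inj₂ eq)

  spanning : ∀ {P : V G → Set} → (∀ u → Dec (P u)) → (∀ {e u w} → Joins G e u w → P u → P w) →
             ∀ {v} → P v → ∀ u → P u
  spanning P? closed {v} Pv u = ⌊⌋-true (closed-all connected (λ u → ⌊ P? u ⌋)
    (λ e u w j h → ⌊⌋-intro (P? w) (closed j (⌊⌋-true h))) (⌊⌋-intro (P? v) Pv) u)

  parallel⇒ribbed : ∀ {e f u v} → Joins G e u v → Joins G f u v → f ≢ e → spinal G e ≡ false
  parallel⇒ribbed {e} j k f≢e with parallel-of j k f≢e
  ... | mkParallel _ l = ribbed⇒ (inj₁ (_ , f≢e , l))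

  apex⇒ribbed : ∀ {e u v z} → Joins G e u v → Nbr G u z → Nbr G v z →
                (∀ z′ → Nbr G u z′ → Nbr G v z′ → z′ ≡ z) → spinal G e ≡ false
  apex⇒ribbed {e} (fwd refl refl) a b uniq =
    ribbed⇒ (inj₂ (_ , (a , b) , λ z′ (c , d) → uniq z′ c d))
  apex⇒ribbed {e} (bwd refl refl) a b uniq =
    ribbed⇒ (inj₂ (_ , (b , a) , λ z′ (c , d) → uniq z′ d c))

  ⇒spinal : ∀ {e u v} → Joins G e u v → (∀ {f} → Joins G f u v → f ≡ e) →
            (∀ {z} → Nbr G u z → Nbr G v z → (∀ z′ → Nbr G u z′ → Nbr G v z′ → z′ ≡ z) → ⊥) →
            spinal G e ≡ true
  ⇒spinal {e} (fwd refl refl) single h = ¬ribbed⇒ λ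
    { (inj₁ (f , f≢e , j)) → f≢e (single j)
    ; (inj₂ (z , (a , b) , uniq)) → h a b λ z′ c d → uniq z′ (c , d) }
  ⇒spinal {e} (bwd refl refl) single h = ¬ribbed⇒ λ
    { (inj₁ (f , f≢e , j)) → f≢e (single (joins-sym j))
    ; (inj₂ (z , (a , b) , uniq)) → h b a λ z′ c d → uniq z′ (d , c) }

  -- If w = w′ then no perfect matching contains s.
  digon-w≢w′ : ∀ {v x} (d : Digon G v x) → Digon.w d ≢ Digon.w′ d
  digon-w≢w′ (mkDigon {s} {t} {p} {q} hv hx w≢x) refl with through s
  ... | M , pm , Ms with PM.matched pm _
  ... | e , (Me , e-in) , _ with Star.cover (Hub.star hx) e e-in
  ... | inj₁ refl = w≢x (case joins-ends (Hub.jp hx) (subst (λ e → In G e _) eq (joins-inʳ (Hub.js hv))) of λ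
        { (inj₁ eq′) → eq′ ; (inj₂ eq′) → contradiction (sym eq′) (irrefl (Hub.js hv)) })
        where eq : s ≡ p
              eq = contradiction (PM-unique pm Ms (joins-inʳ (Hub.js hv)) Me (joins-inʳ (Hub.js hx)))
                λ { refl → case joins-ends (Hub.js hv) (joins-inˡ (Hub.js hx)) of λ
                  { (inj₁ eq) → irrefl (Hub.jp hx) eq ; (inj₂ eq) → w≢x (sym eq) } }
  ... | inj₂ (inj₁ refl) = Star.a≢b (Hub.star hv) (PM-unique pm Ms (joins-inˡ (Hub.js hv)) Me (joins-inˡ (Hub.jp hv)))
  ... | inj₂ (inj₂ refl) = Star.a≢c (Hub.star hv) (PM-unique pm Ms (joins-inˡ (Hub.js hv)) Me (joins-inˡ (Hub.jq hv)))

  digon-flip : ∀ {v x} → Digon G v x → Digon G x v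
  digon-flip (mkDigon hv hx w≢x) = mkDigon hx hv λ { refl → case hub-edge hv (joins-sym (Hub.js hx)) of λ
    { (inj₁ (_ , eq)) → w≢x (sym eq)
    ; (inj₂ (inj₁ (refl , _))) → Star.a≢b (Hub.star hx) refl
    ; (inj₂ (inj₂ (refl , _))) → Star.a≢c (Hub.star hx) refl } }

  digon-ribbed : ∀ {v x} (d : Digon G v x) → spinal G (Digon.p d) ≡ false × spinal G (Digon.q d) ≡ false
  digon-ribbed (mkDigon (mkHub st _ jp jq) _ _) =
    parallel⇒ribbed jp jq (≢-sym (Star.b≢c st)) , parallel⇒ribbed jq jp (Star.b≢c st)

  digon-spinal : ∀ {v x} (d : Digon G v x) → spinal G (Digon.s d) ≡ true
  digon-spinal D@(mkDigon {w = w} {w′} hv hx w≢x) = ⇒spinal (Hub.js hv)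
    (λ j → case hub-edge hv j of λ
      { (inj₁ (eq , _)) → eq ; (inj₂ (inj₁ (_ , eq))) → contradiction eq w≢x
      ; (inj₂ (inj₂ (_ , eq))) → contradiction eq w≢x })
    (λ {z} a b _ → case hub-nbr hv a of λ
      { (inj₁ refl) → irrefl (proj₂ b) refl
      ; (inj₂ h) → case hub-nbr hx (proj₁ b , joins-sym (subst (Joins G (proj₁ b) w) ([ id , id ]′ h) (proj₂ b))) of λ
          { (inj₁ eq) → digon-w≢w′ D eq
          ; (inj₂ (inj₁ eq)) → irrefl (Hub.js hv) (sym eq)
          ; (inj₂ (inj₂ eq)) → irrefl (Hub.js hv) (sym eq) } })

  -- If w = x then s is parallel to p, and no perfect matching contains q.
  tri-w≢x : ∀ {v x y} (t : Tri G v x y) → Tri.w t ≢ x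
  tri-w≢x (mkTri {q = q} hv hx hy) refl with through q
  ... | M , pm , Mq with PM.matched pm _
  ... | e , (Me , e-in) , _ with Star.cover (Hub.star hx) e e-in
  ... | inj₂ (inj₁ refl) = Star.b≢c (Hub.star hv) (PM-unique pm Me (joins-inˡ (Hub.jp hv)) Mq (joins-inˡ (Hub.jq hv)))
  ... | inj₂ (inj₂ refl) = Star.b≢c (Hub.star hy) (PM-unique pm Mq (joins-inˡ (Hub.jp hy)) Me (joins-inˡ (Hub.jq hy)))
  ... | inj₁ refl with hub-edge hx (joins-sym (Hub.js hv))
  ... | inj₁ (refl , _) = Star.a≢c (Hub.star hv) (PM-unique pm Me (joins-inˡ (Hub.js hv)) Mq (joins-inˡ (Hub.jq hv)))
  ... | inj₂ (inj₁ (eq , _)) = Star.a≢b (Hub.star hv) eq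
  ... | inj₂ (inj₂ (_ , eq)) = irrefl (Hub.jq hv) eq

  tri-w≢y : ∀ {v x y} (t : Tri G v x y) → Tri.w t ≢ y
  tri-w≢y t = tri-w≢x (tri-flip t)

  clean-spinal : ∀ {v x y} (c : Clean G v x y) → spinal G (Clean.s c) ≡ true
  clean-spinal {v} {x} {y} (mkClean t@(mkTri {w = w} hv hx hy) w≢wx w≢wy _) = ⇒spinal (Hub.js hv)
    (λ j → case hub-edge hv j of λ
      { (inj₁ (eq , _)) → eq ; (inj₂ (inj₁ (_ , eq))) → contradiction eq (tri-w≢x t)
      ; (inj₂ (inj₂ (_ , eq))) → contradiction eq (tri-w≢y t) })
    (λ a b _ → case hub-nbr hv a of λ
      { (inj₁ refl) → irrefl (proj₂ b) refl
      ; (inj₂ (inj₁ refl)) → case hub-nbr hx (proj₁ b , joins-sym (proj₂ b)) of λ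
          { (inj₁ eq) → w≢wx eq ; (inj₂ (inj₁ eq)) → irrefl (Hub.js hv) (sym eq)
          ; (inj₂ (inj₂ eq)) → tri-w≢y t eq }
      ; (inj₂ (inj₂ refl)) → case hub-nbr hy (proj₁ b , joins-sym (proj₂ b)) of λ
          { (inj₁ eq) → w≢wy eq ; (inj₂ (inj₁ eq)) → irrefl (Hub.js hv) (sym eq)
          ; (inj₂ (inj₂ eq)) → tri-w≢x t eq } })

  -- Only the outer neighbours of the two ends of the edge have to differ. So the lemma also applies
  -- to the outer edges of a diamond, whose triangles are not clean.
  tri-ribbed : ∀ {v x y} (t : Tri G v x y) → Tri.w t ≢ Tri.wx t → spinal G (Tri.p t) ≡ false
  tri-ribbed t@(mkTri hv hx hy) w≢wx = apex⇒ribbed (Hub.jp hv) (_ , Hub.jq hv) (_ , Hub.jq hx)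
    λ z′ a b → case hub-nbr hv a , hub-nbr hx b of λ
      { (inj₂ (inj₂ eq) , _) → eq
      ; (_ , inj₂ (inj₂ eq)) → eq
      ; (inj₁ eq , inj₁ eq′) → contradiction (≡-trans (sym eq) eq′) w≢wx
      ; (inj₁ eq , inj₂ (inj₁ eq′)) → contradiction (≡-trans (sym eq′) eq) (irrefl (Hub.js hv))
      ; (inj₂ (inj₁ eq) , inj₁ eq′) → contradiction (≡-trans (sym eq) eq′) (irrefl (Hub.js hx))
      ; (inj₂ (inj₁ eq) , inj₂ (inj₁ eq′)) → contradiction (≡-trans (sym eq′) eq) (irrefl (Hub.jp hv)) }

  clean-ribbed : ∀ {v x y} (c : Clean G v x y) → spinal G (Clean.p c) ≡ false
  clean-ribbed c = tri-ribbed (Clean.tri c) (Clean.w≢wx c)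

  diamond-tri : ∀ {a u b d} → Diamond G a u b d → Tri G a u b
  diamond-tri D = mkTri hub-a hub-u hub-b where open Diamond D

  diamond-ribbed : ∀ {a u b d} (D : Diamond G a u b d) → spinal G (Diamond.p D) ≡ false
  diamond-ribbed D = tri-ribbed (diamond-tri D) (Diamond.wa≢d D)

  diamond-spinal : ∀ {a u b d} (D : Diamond G a u b d) → spinal G (Diamond.sa D) ≡ true
  diamond-spinal D = ⇒spinal (Hub.js hub-a)
    (λ j → case hub-edge hub-a j of λ
      { (inj₁ (eq , _)) → eq ; (inj₂ (inj₁ (_ , eq))) → contradiction eq wa≢u
      ; (inj₂ (inj₂ (_ , eq))) → contradiction eq wa≢b })
    (λ a b _ → case hub-nbr hub-a a of λ
      { (inj₁ refl) → irrefl (proj₂ b) refl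
      ; (inj₂ (inj₁ refl)) → case hub-nbr hub-u (proj₁ b , joins-sym (proj₂ b)) of λ
          { (inj₁ eq) → wa≢d eq ; (inj₂ (inj₁ eq)) → irrefl (Hub.js hub-a) (sym eq)
          ; (inj₂ (inj₂ eq)) → wa≢b eq }
      ; (inj₂ (inj₂ refl)) → case hub-nbr hub-b (proj₁ b , joins-sym (proj₂ b)) of λ
          { (inj₁ eq) → wa≢d eq ; (inj₂ (inj₁ eq)) → irrefl (Hub.js hub-a) (sym eq)
          ; (inj₂ (inj₂ eq)) → wa≢u eq } })
    where open Diamond D

  -- The chord lies in two triangles, with apexes `a` and `d`, and is spinal for this reason. It is
  -- the spinal edge that `u` and `b` need, since their other edges are ribs.
  diamond-mid : ∀ {a u b d} (D : Diamond G a u b d) → spinal G (Diamond.k D) ≡ true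
  diamond-mid D = ⇒spinal (Hub.jq hub-u)
    (λ j → case hub-edge hub-u j of λ
      { (inj₁ (_ , eq)) → contradiction eq (irrefl (Hub.js hub-b))
      ; (inj₂ (inj₁ (_ , eq))) → contradiction (sym eq) (irrefl (Hub.jq hub-a))
      ; (inj₂ (inj₂ (eq , _))) → eq })
    (λ _ _ uniq → a≢d (≡-trans (uniq _ (_ , Hub.jp hub-u) (_ , Hub.jp hub-b))
                                (sym (uniq _ (_ , Hub.js hub-u) (_ , Hub.js hub-b)))))
    where open Diamond D

-- Classification of the vertices by digons, triangles and diamonds

module Units (G : Graph) (cg : Cornered G) (cov : Covered G) where

  open Cornered cg
  open Covered cov
  open Local G loopless cov

  star-at : ∀ v → ∃ λ a → ∃ λ b → ∃ λ c → Star G v a b c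
  star-at v = _ , _ , _ , Corner.star (corner v)

  hub-of : ∀ {v p q x y} → Joins G p v x → Joins G q v y → p ≢ q →
           ∃ λ s → ∃ λ w → Hub G v s p q w x y
  hub-of {v} jp jq p≢q with complete (proj₂ (proj₂ (proj₂ (star-at v)))) (joins-inˡ jp) (joins-inˡ jq) p≢q
  ... | s , st = s , proj₁ (in⇒joins (Star.a-in st)) , mkHub st (proj₂ (in⇒joins (Star.a-in st))) jp jq

  distinct-edges : ∀ {e f u v w z} → Joins G e u v → Joins G f w z → w ≢ u → w ≢ v → e ≢ f
  distinct-edges je jf w≢u w≢v refl = [ w≢u , w≢v ]′ (joins-ends je (joins-inˡ jf))

  tri⇒diamond : ∀ {a u b} (t : Tri G a u b) → Tri.wx t ≡ Tri.wy t → Tri.w t ≢ Tri.wx t →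
                Diamond G a u b (Tri.wx t)
  tri⇒diamond {a} {u} {b} t@(mkTri ha hu hb) refl wa≢d
    with hub-of (joins-sym (Hub.js hu)) (joins-sym (Hub.js hb))
           (distinct-edges (Hub.js hu) (Hub.js hb) (≢-sym (irrefl (Hub.jq hu))) (irrefl (Hub.js hb)))
  ... | sd , wd , hd = mkDiamond ha hu hb hd (≢-sym (tri-w≢y (tri-rotate t)))
    wa≢d (tri-w≢x t) (tri-w≢y t)
    (λ { refl → case hub-nbr ha (_ , joins-sym (Hub.js hd)) of λ
      { (inj₁ eq) → wa≢d (sym eq) ; (inj₂ (inj₁ eq)) → irrefl (Hub.js hu) (sym eq)
      ; (inj₂ (inj₂ eq)) → irrefl (Hub.js hb) (sym eq) } })
    (tri-w≢x t′) (tri-w≢y t′)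
    where
    t′ : Tri G _ u b
    t′ = mkTri hd (hub-flip (hub-rotate hu)) (hub-flip (hub-rotate hb))

  tri⇒k4 : ∀ {v x y} (t : Tri G v x y) → Tri.w t ≡ Tri.wx t → Tri.wx t ≡ Tri.wy t → Small G
  tri⇒k4 {v} {x} {y} t@(mkTri {w = w} hv hx hy) refl refl
    with hub-of (joins-sym (Hub.js hv)) (joins-sym (Hub.js hx))
           (distinct-edges (Hub.js hv) (Hub.js hx) (≢-sym (irrefl (Hub.jp hv))) (irrefl (Hub.js hx)))
  ... | s′ , w′ , hw = k4 t refl refl refl (spanning
    (λ u → (u ≟ v) ⊎-dec ((u ≟ x) ⊎-dec ((u ≟ y) ⊎-dec (u ≟ w)))) closed (inj₁ refl))
    where
    w′≡y : w′ ≡ y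
    w′≡y with hub-edge hw (joins-sym (Hub.js hy))
    ... | inj₁ (_ , eq)        = sym eq
    ... | inj₂ (inj₁ (_ , eq)) = contradiction (sym eq) (irrefl (Hub.jq hv))
    ... | inj₂ (inj₂ (_ , eq)) = contradiction (sym eq) (irrefl (Hub.jq hx))
    closed : ∀ {e u z} → Joins G e u z → u ≡ v ⊎ u ≡ x ⊎ u ≡ y ⊎ u ≡ w → z ≡ v ⊎ z ≡ x ⊎ z ≡ y ⊎ z ≡ w
    closed j (inj₁ refl) with hub-nbr hv (_ , j)
    ... | inj₁ eq        = inj₂ (inj₂ (inj₂ eq))
    ... | inj₂ (inj₁ eq) = inj₂ (inj₁ eq)
    ... | inj₂ (inj₂ eq) = inj₂ (inj₂ (inj₁ eq))
    closed j (inj₂ (inj₁ refl)) with hub-nbr hx (_ , j)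
    ... | inj₁ eq        = inj₂ (inj₂ (inj₂ eq))
    ... | inj₂ (inj₁ eq) = inj₁ eq
    ... | inj₂ (inj₂ eq) = inj₂ (inj₂ (inj₁ eq))
    closed j (inj₂ (inj₂ (inj₁ refl))) with hub-nbr hy (_ , j)
    ... | inj₁ eq        = inj₂ (inj₂ (inj₂ eq))
    ... | inj₂ (inj₁ eq) = inj₁ eq
    ... | inj₂ (inj₂ eq) = inj₂ (inj₁ eq)
    closed j (inj₂ (inj₂ (inj₂ refl))) with hub-nbr hw (_ , j)
    ... | inj₁ eq        = inj₂ (inj₂ (inj₁ (≡-trans eq w′≡y)))
    ... | inj₂ (inj₁ eq) = inj₁ eq
    ... | inj₂ (inj₂ eq) = inj₂ (inj₁ eq)

  hub⇒digon : ∀ {v x s p q w} → Hub G v s p q w x x → Unit G v ⊎ Small G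
  hub⇒digon {v} {x} {s} {p} {q} {w} hv
    with hub-of (joins-sym (Hub.jp hv)) (joins-sym (Hub.jq hv)) (Star.b≢c (Hub.star hv)) | w ≟ x
  ... | t , w′ , hx | no w≢x   = inj₁ (digon (mkDigon hv hx w≢x))
  ... | t , w′ , hx | yes refl = inj₂ (theta (spanning (λ u → (u ≟ v) ⊎-dec (u ≟ x)) closed (inj₁ refl)))
    where
    w′≡v : w′ ≡ v
    w′≡v with hub-edge hx (joins-sym (Hub.js hv))
    ... | inj₁ (_ , eq)          = sym eq
    ... | inj₂ (inj₁ (refl , _)) = contradiction refl (Star.a≢b (Hub.star hv))
    ... | inj₂ (inj₂ (refl , _)) = contradiction refl (Star.a≢c (Hub.star hv))
    closed : ∀ {e u z} → Joins G e u z → u ≡ v ⊎ u ≡ x → z ≡ v ⊎ z ≡ x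
    closed j (inj₁ refl) with hub-nbr hv (_ , j)
    ... | inj₁ eq        = inj₂ eq
    ... | inj₂ (inj₁ eq) = inj₂ eq
    ... | inj₂ (inj₂ eq) = inj₂ eq
    closed j (inj₂ refl) with hub-nbr hx (_ , j)
    ... | inj₁ eq        = inj₁ (≡-trans eq w′≡v)
    ... | inj₂ (inj₁ eq) = inj₁ eq
    ... | inj₂ (inj₂ eq) = inj₁ eq

  -- Two vertices of the triangle with the same outer neighbour span the chord of a diamond. Hence
  -- `v` is a tip if these are `x` and `y`, and an end of the chord if `v` is one of them; if all
  -- three agree, the graph is K₄.
  tri⇒unit : ∀ {v x y} → Tri G v x y → Unit G v ⊎ Small G
  tri⇒unit t with Tri.wx t ≟ Tri.wy t | Tri.w t ≟ Tri.wx t | Tri.w t ≟ Tri.wy t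
  ... | yes wx≡wy | yes w≡wx | _        = inj₂ (tri⇒k4 t w≡wx wx≡wy)
  ... | yes wx≡wy | no w≢wx  | _        = inj₁ (tip (tri⇒diamond t wx≡wy w≢wx))
  ... | no wx≢wy  | yes w≡wx | _        = inj₁ (mid (tri⇒diamond (tri-rotate (tri-rotate t)) w≡wx
                                            λ eq → wx≢wy (≡-trans (sym w≡wx) (sym eq))))
  ... | no wx≢wy  | no w≢wx  | yes w≡wy = inj₁ (mid (tri⇒diamond (tri-flip (tri-rotate t)) w≡wy
                                            λ eq → w≢wx (sym eq)))
  ... | no wx≢wy  | no w≢wx  | no w≢wy  = inj₁ (clean (mkClean t w≢wx w≢wy wx≢wy))

  corner⇒hub : ∀ {v} (c : Corner G v) → ∃ λ w → Hub G v (Corner.s c) (Corner.p c) (Corner.q c) w (Corner.x c) (Corner.y c)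
  corner⇒hub (mkCorner st jp jq _) = proj₁ (in⇒joins (Star.a-in st)) , mkHub st (proj₂ (in⇒joins (Star.a-in st))) jp jq

  corner⇒tri : ∀ {v s p q w x y r} → Hub G v s p q w x y → Joins G r x y → Tri G v x y
  corner⇒tri {v} {x = x} {y} hv jr
    with hub-of (joins-sym (Hub.jp hv)) jr (≢-sym (distinct-edges jr (Hub.jp hv) (irrefl (Hub.jp hv)) (irrefl (Hub.jq hv))))
       | hub-of (joins-sym (Hub.jq hv)) (joins-sym jr) (≢-sym (distinct-edges jr (Hub.jq hv) (irrefl (Hub.jp hv)) (irrefl (Hub.jq hv))))
  ... | _ , _ , hx | _ , _ , hy = mkTri hv hx hy

  unit⊎small : ∀ v → Unit G v ⊎ Small G
  unit⊎small v with corner v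
  ... | c@(mkCorner _ _ _ (inj₁ refl))     = hub⇒digon (proj₂ (corner⇒hub c))
  ... | c@(mkCorner _ _ _ (inj₂ (_ , jr))) = tri⇒unit (corner⇒tri (proj₂ (corner⇒hub c)) jr)

-- The z-coordinates of a perfect matching are the complemented values on spinal edges.  On each
-- digon, triangle or diamond the z-coordinates of perfect matchings form an 𝔽₂-vector space,
-- and ribSum is a choice of rib values for the sum of two such coordinate vectors.
ribSum : Bool → Bool → Bool → Bool → Bool → Bool → Bool
ribSum a b x₁ x₂ y₁ y₂ = (a ∧ x₂ ∧ y₂) ∨ (b ∧ x₁ ∧ y₁) ∨ (not x₁ ∧ y₁ ∧ x₂ ∧ not y₂) ∨ (x₁ ∧ not y₁ ∧ not x₂ ∧ y₂)

-- Edges are stored with an orientation; the value on a rib must not depend on which end comes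
-- first.
ribSum-sym : ∀ a b x₁ x₂ y₁ y₂ → ribSum a b x₁ x₂ y₁ y₂ ≡ ribSum a b y₁ y₂ x₁ x₂
ribSum-sym a b x₁ x₂ y₁ y₂ = ==-sound (tautology
  (λ { (a ∷ b ∷ x₁ ∷ x₂ ∷ y₁ ∷ y₂ ∷ []) → ribSum a b x₁ x₂ y₁ y₂ == ribSum a b y₁ y₂ x₁ x₂ })
  refl (a ∷ b ∷ x₁ ∷ x₂ ∷ y₁ ∷ y₂ ∷ []))

-- The result type is inferred from the formula in the body: whenever the old values match all
-- vertices of the digon, the new ones match the vertex with stem `s`. The next lemmas have the same
-- form.
digon-sum : ∀ s t p q s′ t′ p′ q′ → _
digon-sum s t p q s′ t′ p′ q′ = tautology
  (λ { (s ∷ t ∷ p ∷ q ∷ s′ ∷ t′ ∷ p′ ∷ q′ ∷ []) →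
       one s p q ⇒ one t p q ⇒ one s′ p′ q′ ⇒ one t′ p′ q′ ⇒
       one (s == s′) (ribSum p p′ s s′ t t′) (ribSum q q′ s s′ t t′) })
  refl (s ∷ t ∷ p ∷ q ∷ s′ ∷ t′ ∷ p′ ∷ q′ ∷ [])

tri-sum : ∀ s x y p q r s′ x′ y′ p′ q′ r′ → _
tri-sum s x y p q r s′ x′ y′ p′ q′ r′ = tautology
  (λ { (s ∷ x ∷ y ∷ p ∷ q ∷ r ∷ s′ ∷ x′ ∷ y′ ∷ p′ ∷ q′ ∷ r′ ∷ []) →
       one s p q ⇒ one x p r ⇒ one y q r ⇒ one s′ p′ q′ ⇒ one x′ p′ r′ ⇒ one y′ q′ r′ ⇒
       one (s == s′) (ribSum p p′ s s′ x x′) (ribSum q q′ s s′ y y′) })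
  refl (s ∷ x ∷ y ∷ p ∷ q ∷ r ∷ s′ ∷ x′ ∷ y′ ∷ p′ ∷ q′ ∷ r′ ∷ [])

-- All three spinal edges of a diamond have the same value and opposite ribs agree. So the diamond
-- contributes a single coordinate, like an edge that is subdivided.
diamond-pattern : ∀ a p q k p′ q′ d → _
diamond-pattern a p q k p′ q′ d = tautology
  (λ { (a ∷ p ∷ q ∷ k ∷ p′ ∷ q′ ∷ d ∷ []) →
       one a p q ⇒ one p′ p k ⇒ one q′ q k ⇒ one d p′ q′ ⇒ k == a ∧ d == a ∧ p′ == q ∧ q′ == p })
  refl (a ∷ p ∷ q ∷ k ∷ p′ ∷ q′ ∷ d ∷ [])

tip-sum : ∀ a p q a′ p′ q′ → _
tip-sum a p q a′ p′ q′ = tautology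
  (λ { (a ∷ p ∷ q ∷ a′ ∷ p′ ∷ q′ ∷ []) → one a p q ⇒ one a′ p′ q′ ⇒
       one (a == a′) (ribSum p p′ a a′ a a′) (ribSum q q′ a a′ a a′) })
  refl (a ∷ p ∷ q ∷ a′ ∷ p′ ∷ q′ ∷ [])

one-subst : ∀ {a a′ b b′ c c′} → a ≡ a′ → b ≡ b′ → c ≡ c′ → one a′ b′ c′ ≡ true → one a b c ≡ true
one-subst refl refl refl h = h

-- Addition of perfect matchings

module Spine (G : Graph) (cg : Cornered G) (cov : Covered G) (unit : ∀ v → Unit G v) where

  open Cornered cg
  open Covered cov
  open Local G loopless cov
  open Units G cg cov

  record Vertebra (v : V G) : Set where
    constructor mkVertebra
    field
      {s p q} : Edge G
      star    : Star G v s p q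
      s-spine : spinal G s ≡ true
      p-rib   : spinal G p ≡ false
      q-rib   : spinal G q ≡ false

  unit⇒vertebra : ∀ {v} → Unit G v → Vertebra v
  unit⇒vertebra (digon d) = mkVertebra (Hub.star (Digon.hub-v d)) (digon-spinal d)
    (proj₁ (digon-ribbed d)) (proj₂ (digon-ribbed d))
  unit⇒vertebra (clean c) = mkVertebra (Hub.star (Clean.hub-v c)) (clean-spinal c)
    (clean-ribbed c) (clean-ribbed (clean-flip c))
  unit⇒vertebra (tip D)   = mkVertebra (Hub.star (Diamond.hub-a D)) (diamond-spinal D)
    (diamond-ribbed D) (diamond-ribbed (diamond-flip D))
  unit⇒vertebra (mid D)   = mkVertebra (rotate (rotate (Hub.star (Diamond.hub-u D)))) (diamond-mid D)
    (diamond-ribbed (diamond-turn D)) (diamond-ribbed D)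

  vertebra : ∀ v → Vertebra v
  vertebra v = unit⇒vertebra (unit v)

  stem : V G → Edge G
  stem v = Vertebra.s (vertebra v)

  spinal-unique : ∀ {e v} → In G e v → spinal G e ≡ true → stem v ≡ e
  spinal-unique {v = v} e-in e-spine with vertebra v
  ... | mkVertebra st s-spine p-rib q-rib with Star.cover st _ e-in
  ... | inj₁ eq          = sym eq
  ... | inj₂ (inj₁ refl) = ⊥-elim (true≢false e-spine p-rib)
  ... | inj₂ (inj₂ refl) = ⊥-elim (true≢false e-spine q-rib)

  -- The zero vector of the space of perfect matchings.
  spinal-PM : PM G (spinal G)
  spinal-PM .PM.matched v with vertebra v
  ... | mkVertebra st s-spine p-rib q-rib = one⇒unique st (one-subst s-spine p-rib q-rib refl)

  module Sum {M₁ M₂ : Edge G → Bool} (pm₁ : PM G M₁) (pm₂ : PM G M₂) where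

    -- If only one of the two matchings uses ribs of a digon, triangle or diamond, they are copied
    -- from it; if both have the same nonzero coordinates there, no rib is used. Two different
    -- nonzero vectors occur only at a triangle: they share one vertex, and the last two terms of
    -- `ribSum` select the rib opposite to it.
    total : Edge G → Bool
    total e = if spinal G e then M₁ e == M₂ e
              else ribSum (M₁ e) (M₂ e) (M₁ (stem (src G e))) (M₂ (stem (src G e)))
                                        (M₁ (stem (tgt G e))) (M₂ (stem (tgt G e)))

    total-spine : ∀ {e} → spinal G e ≡ true → total e ≡ M₁ e == M₂ e
    total-spine h rewrite h = refl

    total-rib : ∀ {e u v x₁ x₂ y₁ y₂} → spinal G e ≡ false → Joins G e u v →
                M₁ (stem u) ≡ x₁ → M₂ (stem u) ≡ x₂ → M₁ (stem v) ≡ y₁ → M₂ (stem v) ≡ y₂ →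
                total e ≡ ribSum (M₁ e) (M₂ e) x₁ x₂ y₁ y₂
    total-rib h (fwd refl refl) refl refl refl refl rewrite h = refl
    total-rib {e} h (bwd refl refl) refl refl refl refl rewrite h = 
      ribSum-sym (M₁ e) (M₂ e) (M₁ (stem (src G e))) (M₂ (stem (src G e))) (M₁ (stem (tgt G e))) (M₂ (stem (tgt G e)))

    stem₁ : ∀ {e v} → In G e v → spinal G e ≡ true → M₁ (stem v) ≡ M₁ e
    stem₁ e-in h = cong M₁ (spinal-unique e-in h)

    stem₂ : ∀ {e v} → In G e v → spinal G e ≡ true → M₂ (stem v) ≡ M₂ e
    stem₂ e-in h = cong M₂ (spinal-unique e-in h)

    diamond-equal : ∀ {a u b d M} (D : Diamond G a u b d) → PM G M →
                    M (Diamond.k D) ≡ M (Diamond.sa D) × M (Diamond.sd D) ≡ M (Diamond.sa D) ×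
                    M (Diamond.q′ D) ≡ M (Diamond.p D)
    diamond-equal {M = M} D pm =
      let k≡sa , rest = ∧-true {M k == M sa} pat
          sd≡sa , rest′ = ∧-true {M sd == M sa} rest
          _ , q′≡p = ∧-true {M p′ == M q} rest′
      in ==-sound k≡sa , ==-sound sd≡sa , ==-sound q′≡p
      where
      open Diamond D
      pat : M k == M sa ∧ M sd == M sa ∧ M p′ == M q ∧ M q′ == M p ≡ true
      pat = mp (mp (mp (mp (diamond-pattern (M sa) (M p) (M q) (M k) (M p′) (M q′) (M sd))
        (PM⇒one (Hub.star hub-a) pm)) (PM⇒one (Hub.star hub-u) pm)) (PM⇒one (Hub.star hub-b) pm)) (PM⇒one (Hub.star hub-d) pm)

    total-PM : PM G total
    total-PM .PM.matched v with unit v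
    ... | digon d@(mkDigon {s} {t} {p} {q} hv hx _) = one⇒unique (Hub.star hv)
      (one-subst (total-spine (digon-spinal d)) (rib (proj₁ (digon-ribbed d)) (Hub.jp hv)) (rib (proj₂ (digon-ribbed d)) (Hub.jq hv))
        (mp (mp (mp (mp (digon-sum (M₁ s) (M₁ t) (M₁ p) (M₁ q) (M₂ s) (M₂ t) (M₂ p) (M₂ q))
          (PM⇒one (Hub.star hv) pm₁)) (PM⇒one (Hub.star hx) pm₁)) (PM⇒one (Hub.star hv) pm₂)) (PM⇒one (Hub.star hx) pm₂)))
      where
      s-in = Star.a-in (Hub.star hv)
      t-in = Star.a-in (Hub.star hx)
      rib : ∀ {e} → spinal G e ≡ false → Joins G e v _ → total e ≡ ribSum (M₁ e) (M₂ e) (M₁ s) (M₂ s) (M₁ t) (M₂ t)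
      rib h j = total-rib h j (stem₁ s-in (digon-spinal d)) (stem₂ s-in (digon-spinal d))
        (stem₁ t-in (digon-spinal (digon-flip d))) (stem₂ t-in (digon-spinal (digon-flip d)))
    ... | clean c@(mkClean (mkTri {s} {sx} {sy} {p} {q} {r} hv hx hy) _ _ _) = one⇒unique (Hub.star hv)
      (one-subst (total-spine (clean-spinal c))
        (total-rib (clean-ribbed c) (Hub.jp hv) (stem₁ s-in (clean-spinal c)) (stem₂ s-in (clean-spinal c)) (stem₁ x-in x-spine) (stem₂ x-in x-spine))
        (total-rib (clean-ribbed (clean-flip c)) (Hub.jq hv) (stem₁ s-in (clean-spinal c)) (stem₂ s-in (clean-spinal c)) (stem₁ y-in y-spine) (stem₂ y-in y-spine))
        (mp (mp (mp (mp (mp (mp (tri-sum (M₁ s) (M₁ sx) (M₁ sy) (M₁ p) (M₁ q) (M₁ r) (M₂ s) (M₂ sx) (M₂ sy) (M₂ p) (M₂ q) (M₂ r))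
          (PM⇒one (Hub.star hv) pm₁)) (PM⇒one (Hub.star hx) pm₁)) (PM⇒one (Hub.star hy) pm₁))
          (PM⇒one (Hub.star hv) pm₂)) (PM⇒one (Hub.star hx) pm₂)) (PM⇒one (Hub.star hy) pm₂)))
      where
      s-in = Star.a-in (Hub.star hv)
      x-in = Star.a-in (Hub.star hx)
      y-in = Star.a-in (Hub.star hy)
      x-spine = clean-spinal (clean-rotate c)
      y-spine = clean-spinal (clean-rotate (clean-rotate c))
    ... | tip D = one⇒unique (Hub.star hub-a) (one-subst (total-spine spine-a)
        (total-rib (diamond-ribbed D) (Hub.jp hub-a) (stem₁ a-in spine-a) (stem₂ a-in spine-a)
          (≡-trans (stem₁ (Star.c-in (Hub.star hub-u)) spine-k) (proj₁ (diamond-equal D pm₁)))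
          (≡-trans (stem₂ (Star.c-in (Hub.star hub-u)) spine-k) (proj₁ (diamond-equal D pm₂))))
        (total-rib (diamond-ribbed (diamond-flip D)) (Hub.jq hub-a) (stem₁ a-in spine-a) (stem₂ a-in spine-a)
          (≡-trans (stem₁ (Star.c-in (Hub.star hub-b)) spine-k) (proj₁ (diamond-equal D pm₁)))
          (≡-trans (stem₂ (Star.c-in (Hub.star hub-b)) spine-k) (proj₁ (diamond-equal D pm₂))))
        (mp (mp (tip-sum (M₁ sa) (M₁ p) (M₁ q) (M₂ sa) (M₂ p) (M₂ q)) (PM⇒one (Hub.star hub-a) pm₁)) (PM⇒one (Hub.star hub-a) pm₂)))
      where
      open Diamond D
      a-in = Star.a-in (Hub.star hub-a)
      spine-a = diamond-spinal D
      spine-k = diamond-mid D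
    -- At `u` the stem is the chord. The stems at the tips have the same values as the chord, so
    -- both ribs at `u` join ends with equal coordinates and `tip-sum` applies.
    ... | mid D = one⇒unique st (one-subst (total-spine spine-k)
        (total-rib (diamond-ribbed (diamond-turn D)) (Hub.js hub-u) (stem₁ u-in spine-k) (stem₂ u-in spine-k)
          (≡-trans (stem₁ (Star.a-in (Hub.star hub-d)) (diamond-spinal (diamond-turn D))) (d≡k pm₁))
          (≡-trans (stem₂ (Star.a-in (Hub.star hub-d)) (diamond-spinal (diamond-turn D))) (d≡k pm₂)))
        (total-rib (diamond-ribbed D) (Hub.jp hub-u) (stem₁ u-in spine-k) (stem₂ u-in spine-k)
          (≡-trans (stem₁ (Star.a-in (Hub.star hub-a)) (diamond-spinal D)) (sym (proj₁ (diamond-equal D pm₁))))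
          (≡-trans (stem₂ (Star.a-in (Hub.star hub-a)) (diamond-spinal D)) (sym (proj₁ (diamond-equal D pm₂)))))
        (mp (mp (tip-sum (M₁ k) (M₁ p′) (M₁ p) (M₂ k) (M₂ p′) (M₂ p)) (PM⇒one st pm₁)) (PM⇒one st pm₂)))
      where
      open Diamond D
      st = rotate (rotate (Hub.star hub-u))
      u-in = Star.c-in (Hub.star hub-u)
      spine-k = diamond-mid D
      d≡k : ∀ {M} → PM G M → M sd ≡ M k
      d≡k pm = ≡-trans (proj₁ (proj₂ (diamond-equal D pm))) (sym (proj₁ (diamond-equal D pm)))

-- Nontrivial tight cuts

module _ {G : Graph} {X : V G → Bool} (ntc : NTC G X) where

  open NTC ntc

  lonely : ∀ a → (∀ u → u ≡ a ⊎ X u ≡ not (X a)) → ⊥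
  lonely a h with X a in Xa
  ... | true  = let u , u≢a , Xu = inside a in case h u of λ { (inj₁ eq) → u≢a eq ; (inj₂ eq) → true≢false Xu eq }
  ... | false = let u , u≢a , Xu = outside a in case h u of λ { (inj₁ eq) → u≢a eq ; (inj₂ eq) → true≢false eq Xu }

  -- If the cut is the star of `v`, no edge leaves the set of the other vertices on the side of `v`.
  -- By connectivity this set is empty, so `v` is alone on its side.
  star-not-cut : ∀ {v a b c} → Loopless G → Connected G → Star G v a b c → Cut G X a → Cut G X b → Cut G X c →
                 (∀ e → Cut G X e → In G e v) → ⊥
  star-not-cut {v} {a} loopless con st ca cb cc at = lonely v λ u → case u ≟ v of λ
    { (yes eq) → inj₁ eq ; (no u≢v) → inj₂ (divide u u≢v) }
    where
    S : V G → Bool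
    S u = ⌊ ¬? (u ≟ v) ×-dec (X u ≟ᵇ X v) ⌋
    all-cut : ∀ {e u} → Joins G e v u → Cut G X e
    all-cut j with Star.cover st _ (joins-inˡ j)
    ... | inj₁ refl        = ca
    ... | inj₂ (inj₁ refl) = cb
    ... | inj₂ (inj₂ refl) = cc
    b≢not : ∀ {b} → b ≢ not b
    b≢not {true}  ()
    b≢not {false} ()
    closed : ∀ e u w → Joins G e u w → S u ≡ true → S w ≡ true
    closed e u w j Su with ⌊⌋-true {d = ¬? (u ≟ v) ×-dec (X u ≟ᵇ X v)} Su | inCutᵇ G X e ≟ᵇ true
    ... | u≢v , Xu | yes c with joins-ends j (at e (mkCut c))
    ...   | inj₁ eq   = contradiction (sym eq) u≢v
    ...   | inj₂ refl = contradiction (≡-trans (sym Xu) (cut⇒≢ (mkCut c) j)) b≢not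
    closed e u w j Su | u≢v , Xu | no ¬c = ⌊⌋-intro (¬? (w ≟ v) ×-dec (X w ≟ᵇ X v))
      ((λ { refl → ¬c (crosses (all-cut (joins-sym j))) })
      , ≡-trans (sym (¬cut⇒≡ (¬c ∘ crosses) j)) Xu)
    divide : ∀ u → u ≢ v → X u ≡ not (X v)
    divide u u≢v with X u ≟ᵇ X v
    ... | yes eq = ⊥-elim (proj₁ (⌊⌋-true {d = ¬? (v ≟ v) ×-dec (X v ≟ᵇ X v)}
                     (closed-all con S closed (⌊⌋-intro (¬? (u ≟ v) ×-dec (X u ≟ᵇ X v)) (u≢v , eq)) v)) refl)
    ... | no neq with X u | X v
    ...   | true  | true  = contradiction refl neq
    ...   | true  | false = refl
    ...   | false | true  = refl
    ...   | false | false = contradiction refl neq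

differ⇒cut : ∀ {G X e u v} → X u ≡ not (X v) → Joins G e u v → Cut G X e
differ⇒cut {X = X} {u = u} {v} h j with X v in Xv
... | true  = ≢⇒cut Xv h (joins-sym j)
... | false = ≢⇒cut h Xv j

flip-not : ∀ {a b} → a ≡ not b → b ≡ not a
flip-not {b = true}  refl = refl
flip-not {b = false} refl = refl

¬cut : ∀ {G X e u v} → X u ≡ X v → Joins G e u v → ¬ Cut G X e
¬cut {X = X} {v = v} eq j c with ≡-trans (sym eq) (cut⇒≢ c j)
... | h with X v
¬cut eq j c | () | true
¬cut eq j c | () | false

≟not : ∀ (a b : Bool) → a ≡ b ⊎ a ≡ not b
≟not true  true  = inj₁ refl
≟not true  false = inj₂ refl
≟not false true  = inj₂ refl
≟not false false = inj₁ refl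

-- The form is symmetric in the two sides; which of them contains `a` is asked only when the weights
-- of the contractions are added.
record Neck (G : Graph) (X : V G → Bool) : Set where
  constructor mkNeck
  field
    {a b c}    : V G
    {g e₁ e₂}  : Edge G
    j₁         : Joins G e₁ a b
    j₂         : Joins G e₂ a c
    close      : b ≡ c ⊎ ∃ λ r → Joins G r b c
    cut-g      : Cut G X g
    cut₁       : Cut G X e₁
    cut₂       : Cut G X e₂
    g≢e₁       : g ≢ e₁
    g≢e₂       : g ≢ e₂
    e₁≢e₂      : e₁ ≢ e₂
    cover      : ∀ e → Cut G X e → e ≡ g ⊎ e ≡ e₁ ⊎ e ≡ e₂

module NeckOf (G : Graph) (cg : Cornered G) (cov : Covered G) {X : V G → Bool} (ntc : NTC G X) where

  open Cornered cg
  open Covered cov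
  open Local G loopless cov
  open Units G cg cov
  open NTC ntc

  cross-unique : ∀ {M e f} → PM G M → M e ≡ true → Cut G X e → M f ≡ true → Cut G X f → e ≡ f
  cross-unique pm Me ce Mf cf with tight pm
  ... | _ , _ , uniq = ≡-trans (uniq _ (Me , ce)) (sym (uniq _ (Mf , cf)))

  -- In K₄ the perfect matching consisting of vx and yw crosses a cut twice if it separates both
  -- pairs and never if it separates neither. If exactly one pair is separated, one vertex is alone
  -- on its side.
  ¬small : ¬ Small G
  ¬small (theta {v} {x} all) with inside v | outside v
  ... | u , u≢v , Xu | u′ , u′≢v , Xu′ with all u | all u′
  ... | inj₁ eq   | _         = u≢v eq
  ... | inj₂ _    | inj₁ eq   = u′≢v eq
  ... | inj₂ refl | inj₂ refl = true≢false Xu Xu′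
  ¬small (k4 {v} {x} {y} {w} t@(mkTri {s} {sx} {sy} {p} {q} {r} hv hx hy) refl refl refl all)
    with through p
  ... | M , pm , Mp with tight pm
  ... | e , (Me , ce) , uniq = go (≟not (X v) (X x)) (≟not (X y) (X w))
    where
    Msy : M sy ≡ true
    Msy = one-left (M sy) (M q) (M r) (PM⇒one (Hub.star hy) pm)
      (PM-reject pm Mp (joins-inˡ (Hub.jp hv)) (joins-inˡ (Hub.jq hv)) (≢-sym (Star.b≢c (Hub.star hv))))
      (PM-reject pm Mp (joins-inˡ (Hub.jp hx)) (joins-inˡ (Hub.jq hx)) (≢-sym (Star.b≢c (Hub.star hx))))
    p≢sy : p ≢ sy
    p≢sy = distinct-edges (Hub.jp hv) (Hub.js hy) (≢-sym (irrefl (Hub.jq hv))) (≢-sym (irrefl (Hub.jq hx)))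
    other : ∀ {a b c} → a ≡ not b → c ≡ a ⊎ c ≡ b
    other {c = c} refl = [ inj₂ , inj₁ ]′ (≟not c _)
    go : X v ≡ X x ⊎ X v ≡ not (X x) → X y ≡ X w ⊎ X y ≡ not (X w) → ⊥
    go (inj₂ vx) (inj₂ yw) = p≢sy (cross-unique pm Mp (differ⇒cut vx (Hub.jp hv)) Msy (differ⇒cut yw (Hub.js hy)))
    go (inj₂ vx) (inj₁ yw) with other {c = X y} vx
    ... | inj₁ yv = lonely ntc x λ u → case all u of λ
      { (inj₁ refl) → inj₂ vx ; (inj₂ (inj₁ eq)) → inj₁ eq
      ; (inj₂ (inj₂ (inj₁ refl))) → inj₂ (≡-trans yv vx) ; (inj₂ (inj₂ (inj₂ refl))) → inj₂ (≡-trans (sym yw) (≡-trans yv vx)) }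
    ... | inj₂ yx = lonely ntc v λ u → case all u of λ
      { (inj₁ eq) → inj₁ eq ; (inj₂ (inj₁ refl)) → inj₂ (flip-not vx)
      ; (inj₂ (inj₂ (inj₁ refl))) → inj₂ (≡-trans yx (flip-not vx)) ; (inj₂ (inj₂ (inj₂ refl))) → inj₂ (≡-trans (sym yw) (≡-trans yx (flip-not vx))) }
    go (inj₁ vx) (inj₂ yw) with other {c = X v} yw
    ... | inj₁ vy = lonely ntc w λ u → case all u of λ
      { (inj₁ refl) → inj₂ (≡-trans vy yw) ; (inj₂ (inj₁ refl)) → inj₂ (≡-trans (sym vx) (≡-trans vy yw))
      ; (inj₂ (inj₂ (inj₁ refl))) → inj₂ yw ; (inj₂ (inj₂ (inj₂ eq))) → inj₁ eq }
    ... | inj₂ vw = lonely ntc y λ u → case all u of λ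
      { (inj₁ refl) → inj₂ (≡-trans vw (flip-not yw)) ; (inj₂ (inj₁ refl)) → inj₂ (≡-trans (sym vx) (≡-trans vw (flip-not yw)))
      ; (inj₂ (inj₂ (inj₁ eq))) → inj₁ eq ; (inj₂ (inj₂ (inj₂ refl))) → inj₂ (flip-not yw) }
    go (inj₁ vx) (inj₁ yw) with all (src G e)
    ... | inj₁ eq = at-p (PM-unique pm Me (at-src eq) Mp (joins-inˡ (Hub.jp hv)))
      where at-p : e ≡ p → ⊥
            at-p refl = ¬cut vx (Hub.jp hv) ce
    ... | inj₂ (inj₁ eq) = at-p (PM-unique pm Me (at-src eq) Mp (joins-inˡ (Hub.jp hx)))
      where at-p : e ≡ p → ⊥
            at-p refl = ¬cut vx (Hub.jp hv) ce
    ... | inj₂ (inj₂ (inj₁ eq)) = at-sy (PM-unique pm Me (at-src eq) Msy (joins-inˡ (Hub.js hy)))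
      where at-sy : e ≡ sy → ⊥
            at-sy refl = ¬cut yw (Hub.js hy) ce
    ... | inj₂ (inj₂ (inj₂ eq)) = at-sy (PM-unique pm Me (at-src eq) Msy (joins-inʳ (Hub.js hy)))
      where at-sy : e ≡ sy → ⊥
            at-sy refl = ¬cut yw (Hub.js hy) ce

  unit : ∀ v → Unit G v
  unit v with unit⊎small v
  ... | inj₁ u = u
  ... | inj₂ s = ⊥-elim (¬small s)

  open Spine G cg cov unit

  record Apex : Set where
    constructor mkApex
    field
      {a b c}   : V G
      {s e₁ e₂} : Edge G
      star      : Star G a s e₁ e₂
      s-spine   : spinal G s ≡ true
      rib₁      : spinal G e₁ ≡ false
      rib₂      : spinal G e₂ ≡ false
      j₁        : Joins G e₁ a b
      j₂        : Joins G e₂ a c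
      cut₁      : Cut G X e₁
      cut₂      : Cut G X e₂

  spine-cross : OneCross G X (spinal G)
  spine-cross = tight spinal-PM

  g : Edge G
  g = proj₁ spine-cross

  g-spine : spinal G g ≡ true
  g-spine = proj₁ (proj₁ (proj₂ spine-cross))

  g-cut : Cut G X g
  g-cut = proj₂ (proj₁ (proj₂ spine-cross))

  spine-cut : ∀ {e} → spinal G e ≡ true → Cut G X e → e ≡ g
  spine-cut h c = proj₂ (proj₂ spine-cross) _ (h , c)

  rib≢g : ∀ {e} → spinal G e ≡ false → g ≢ e
  rib≢g h refl = true≢false g-spine h

  -- If e is a further cut edge, add a perfect matching M₁ through e₁ and a perfect matching M₂
  -- through e: the sum contains g, and it uses e₁ or e₂ because exactly M₂ contains the stem at a.
  apex-cover : (A : Apex) → ∀ e → Cut G X e → e ≡ g ⊎ e ≡ Apex.e₁ A ⊎ e ≡ Apex.e₂ A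
  apex-cover (mkApex {s = s} {e₁} {e₂} st s-spine rib₁ rib₂ _ _ cut₁ cut₂) e ce with e ≟ g | e ≟ e₁ | e ≟ e₂
  ... | yes eq | _      | _      = inj₁ eq
  ... | no _   | yes eq | _      = inj₂ (inj₁ eq)
  ... | no _   | no _   | yes eq = inj₂ (inj₂ eq)
  ... | no e≢g | no e≢e₁ | no e≢e₂ with through e₁ | through e
  ... | M₁ , pm₁ , M₁e₁ | M₂ , pm₂ , M₂e = ⊥-elim (contra (∨-true total-e₁₂))
    where
    open Sum pm₁ pm₂
    off : ∀ {M f h} → PM G M → M f ≡ true → Cut G X f → Cut G X h → f ≢ h → M h ≡ false
    off pm Mf cf ch f≢h = ¬true λ Mh → f≢h (cross-unique pm Mf cf Mh ch)
    M₂s : M₂ s ≡ true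
    M₂s = one-left (M₂ s) (M₂ e₁) (M₂ e₂) (PM⇒one st pm₂) (off pm₂ M₂e ce cut₁ e≢e₁) (off pm₂ M₂e ce cut₂ e≢e₂)
    total-g : total g ≡ true
    total-g = ≡-trans (total-spine g-spine) (cong₂ _==_ (off pm₁ M₁e₁ cut₁ g-cut (≢-sym (rib≢g rib₁)))
                                                       (off pm₂ M₂e ce g-cut e≢g))
    total-s : total s ≡ false
    total-s = ≡-trans (total-spine s-spine) (cong₂ _==_
      (PM-reject pm₁ M₁e₁ (Star.b-in st) (Star.a-in st) (Star.a≢b st)) M₂s)
    total-e₁₂ : total e₁ ∨ total e₂ ≡ true
    total-e₁₂ = two-left (total s) (total e₁) (total e₂) (PM⇒one st total-PM) total-s
    contra : total e₁ ≡ true ⊎ total e₂ ≡ true → ⊥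
    contra (inj₁ h) = rib≢g rib₁ (cross-unique total-PM total-g g-cut h cut₁)
    contra (inj₂ h) = rib≢g rib₂ (cross-unique total-PM total-g g-cut h cut₂)

  Closed : Apex → Set
  Closed A = Apex.b A ≡ Apex.c A ⊎ ∃ λ r → Joins G r (Apex.b A) (Apex.c A)

  -- A perfect matching through a rib at an end of `g` omits `g`, which is the only spinal edge of
  -- the cut; so it crosses the cut in a rib.
  rib-cut : ∃ λ e → spinal G e ≡ false × Cut G X e
  rib-cut with vertebra (src G g)
  ... | mkVertebra {s} {p} st s-spine p-rib _ with through p
  ... | M , pm , Mp with tight pm
  ... | e , (Me , ce) , _ = e , ¬true (λ h → true≢false (subst (λ e → M e ≡ true) (spine-cut h ce) Me)
    (PM-reject pm Mp (Star.b-in st) (at-src refl) (rib≢g p-rib))) , ce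

  digon-apex : ∀ {v x} (d : Digon G v x) → X v ≡ not (X x) → ∃ Closed
  digon-apex d h = mkApex (Hub.star hub-v) (digon-spinal d) (proj₁ (digon-ribbed d)) (proj₂ (digon-ribbed d))
    (Hub.jp hub-v) (Hub.jq hub-v) (differ⇒cut h (Hub.jp hub-v)) (differ⇒cut h (Hub.jq hub-v)) , inj₁ refl
    where open Digon d

  clean-apex : ∀ {v x y} (c : Clean G v x y) → Cut G X (Clean.p c) → Cut G X (Clean.q c) → ∃ Closed
  clean-apex c cp cq = mkApex (Hub.star hub-v) (clean-spinal c) (clean-ribbed c) (clean-ribbed (clean-flip c))
    (Hub.jp hub-v) (Hub.jq hub-v) cp cq , inj₂ (_ , Hub.jq hub-x)
    where open Clean c

  -- A triangle that is cut at all is cut in two edges, and these meet in the apex.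
  clean-cut : ∀ {v x y} (c : Clean G v x y) → Cut G X (Clean.p c) → ∃ Closed
  clean-cut {v} {x} {y} c cp with inCutᵇ G X (Clean.q c) ≟ᵇ true
  ... | yes cq = clean-apex c cp (mkCut cq)
  ... | no ¬cq = clean-apex (clean-rotate c) (differ⇒cut (≡-trans (flip-not (cut⇒≢ cp (Hub.jp hub-v)))
      (cong not (¬cut⇒≡ (¬cq ∘ crosses) (Hub.jq hub-v)))) (Hub.jq hub-x)) cp
    where open Clean c

  -- If the opposite rib `q′` is cut too, a matching through `p` contains both and crosses twice.
  -- Otherwise either `q` is cut and `a` is the apex, or `u` is separated from the rest of the
  -- diamond. In the latter case the chord is the spinal cut edge, and by `apex-cover` the cut is
  -- the star of `u`.
  diamond-cut : ∀ {a u b d} (D : Diamond G a u b d) → Cut G X (Diamond.p D) → ∃ Closed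
  diamond-cut {a} {u} {b} {d} D cp with inCutᵇ G X q′ ≟ᵇ true
    where open Diamond D
  ... | yes cq′ with through (Diamond.p D)
  ...   | M , pm , Mp = ⊥-elim (distinct-edges (Hub.jp hub-a) (Hub.js hub-b) (≢-sym (irrefl (Hub.jq hub-a)))
                          (≢-sym (irrefl (Hub.jq hub-u)))
                          (cross-unique pm Mp cp (≡-trans (proj₂ (proj₂ (Sum.diamond-equal pm pm D pm))) Mp) (mkCut cq′)))
    where open Diamond D
  diamond-cut {a} {u} {b} {d} D cp | no ¬cq′ with inCutᵇ G X (Diamond.q D) ≟ᵇ true
  ... | yes cq = mkApex (Hub.star hub-a) (diamond-spinal D) (diamond-ribbed D) (diamond-ribbed (diamond-flip D))
      (Hub.jp hub-a) (Hub.jq hub-a) cp (mkCut cq) , inj₂ (_ , Hub.jq hub-u)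
    where open Diamond D
  ... | no ¬cq = ⊥-elim (star-not-cut ntc loopless connected (Hub.star hub-u) cp′ cp ck λ e ce →
      case apex-cover apex e ce of λ
        { (inj₁ refl) → subst (λ e → In G e u) (spine-cut (diamond-mid D) ck) (Star.c-in (Hub.star hub-u))
        ; (inj₂ (inj₁ refl)) → Star.a-in (Hub.star hub-u)
        ; (inj₂ (inj₂ refl)) → Star.b-in (Hub.star hub-u) })
    where
    open Diamond D
    ab : X a ≡ X b
    ab = ¬cut⇒≡ (¬cq ∘ crosses) (Hub.jq hub-a)
    bd : X b ≡ X d
    bd = ¬cut⇒≡ (¬cq′ ∘ crosses) (Hub.js hub-b)
    ua : X u ≡ not (X a)
    ua = flip-not (cut⇒≢ cp (Hub.jp hub-a))
    cp′ : Cut G X p′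
    cp′ = differ⇒cut (≡-trans ua (cong not (≡-trans ab bd))) (Hub.js hub-u)
    ck : Cut G X k
    ck = differ⇒cut (≡-trans ua (cong not ab)) (Hub.jq hub-u)
    apex : Apex
    apex = mkApex (rotate (rotate (Hub.star hub-u))) (diamond-mid D) (diamond-ribbed (diamond-turn D)) (diamond-ribbed D)
      (Hub.js hub-u) (Hub.jp hub-u) cp′ cp

  apex : ∃ Closed
  apex with rib-cut
  ... | e , rib , ce with unit (src G e)
  ... | digon d with Star.cover (Hub.star (Digon.hub-v d)) e (at-src refl)
  ...   | inj₁ refl        = ⊥-elim (true≢false (digon-spinal d) rib)
  ...   | inj₂ (inj₁ refl) = digon-apex d (cut⇒≢ ce (Hub.jp (Digon.hub-v d)))
  ...   | inj₂ (inj₂ refl) = digon-apex d (cut⇒≢ ce (Hub.jq (Digon.hub-v d)))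
  apex | e , rib , ce | clean c with Star.cover (Hub.star (Clean.hub-v c)) e (at-src refl)
  ...   | inj₁ refl        = ⊥-elim (true≢false (clean-spinal c) rib)
  ...   | inj₂ (inj₁ refl) = clean-cut c ce
  ...   | inj₂ (inj₂ refl) = clean-cut (clean-flip c) ce
  apex | e , rib , ce | tip D with Star.cover (Hub.star (Diamond.hub-a D)) e (at-src refl)
  ...   | inj₁ refl        = ⊥-elim (true≢false (diamond-spinal D) rib)
  ...   | inj₂ (inj₁ refl) = diamond-cut D ce
  ...   | inj₂ (inj₂ refl) = diamond-cut (diamond-flip D) ce
  apex | e , rib , ce | mid D with Star.cover (Hub.star (Diamond.hub-u D)) e (at-src refl)
  ...   | inj₁ refl        = diamond-cut (diamond-turn D) ce
  ...   | inj₂ (inj₁ refl) = diamond-cut D ce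
  ...   | inj₂ (inj₂ refl) = ⊥-elim (true≢false (diamond-mid D) rib)

  neck : Neck G X
  neck with apex
  ... | A@(mkApex st _ rib₁ rib₂ j₁ j₂ cut₁ cut₂) , close =
    mkNeck j₁ j₂ close g-cut cut₁ cut₂ (rib≢g rib₁) (rib≢g rib₂) (Star.b≢c st) (apex-cover A)

-- Contractions

-- An edge is a position in a list, so filtering, mapping and permuting the list changes its name.
-- `Selection` and `Reindexing` trace each edge of a contraction back to the edge it comes from.
record Selection {A B : Set} (f : A → B) (keep? : A → Bool) (ys : List B) (xs : List A) : Set where
  field
    σ         : Fin (length ys) → Fin (length xs)
    σ-inj     : ∀ {i j} → σ i ≡ σ j → i ≡ j
    selected  : ∀ i → keep? (lookup xs (σ i)) ≡ true
    onto      : ∀ j → keep? (lookup xs j) ≡ true → ∃ λ i → σ i ≡ j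
    at        : ∀ i → lookup ys i ≡ f (lookup xs (σ i))

filter-selection : ∀ {A B : Set} (f : A → B) (keep? : A → Bool) (xs : List A) →
                   Selection f keep? (mapL f (filterᵇ keep? xs)) xs
filter-selection f keep? [] = record
  { σ = λ () ; σ-inj = λ { {()} } ; selected = λ () ; onto = λ () ; at = λ () }
filter-selection f keep? (x ∷ xs) with keep? x in eq | filter-selection f keep? xs
... | true | S = record
  { σ = λ { zero → zero ; (suc i) → suc (σ i) }
  ; σ-inj = λ { {zero} {zero} _ → refl ; {suc i} {suc j} h → cong suc (σ-inj (suc-injective h)) }
  ; selected = λ { zero → eq ; (suc i) → selected i }
  ; onto = λ { zero _ → zero , refl ; (suc j) h → let i , h′ = onto j h in suc i , cong suc h′ }
  ; at = λ { zero → refl ; (suc i) → at i } }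
  where open Selection S
... | false | S = record
  { σ = λ i → suc (σ i)
  ; σ-inj = λ h → σ-inj (suc-injective h)
  ; selected = selected
  ; onto = λ { zero h → ⊥-elim (true≢false h eq) ; (suc j) h → let i , h′ = onto j h in i , cong suc h′ }
  ; at = at }
  where open Selection S

record Reindexing {A : Set} (xs ys : List A) : Set where
  field
    τ     : Fin (length xs) → Fin (length ys)
    τ-inj : ∀ {i j} → τ i ≡ τ j → i ≡ j
    τ-onto : ∀ j → ∃ λ i → τ i ≡ j
    τ-at  : ∀ i → lookup xs i ≡ lookup ys (τ i)

↭-reindexing : ∀ {A : Set} {xs ys : List A} → xs ↭ ys → Reindexing xs ys
↭-reindexing refl = record { τ = id ; τ-inj = id ; τ-onto = λ j → j , refl ; τ-at = λ _ → refl }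
↭-reindexing (prep x p) = record
  { τ = λ { zero → zero ; (suc i) → suc (τ i) }
  ; τ-inj = λ { {zero} {zero} _ → refl ; {suc i} {suc j} h → cong suc (τ-inj (suc-injective h)) }
  ; τ-onto = λ { zero → zero , refl ; (suc j) → let i , h = τ-onto j in suc i , cong suc h }
  ; τ-at = λ { zero → refl ; (suc i) → τ-at i } }
  where open Reindexing (↭-reindexing p)
↭-reindexing (swap x y p) = record
  { τ = λ { zero → suc zero ; (suc zero) → zero ; (suc (suc i)) → suc (suc (τ i)) }
  ; τ-inj = λ { {zero} {zero} _ → refl ; {suc zero} {suc zero} _ → refl
              ; {zero} {suc zero} () ; {zero} {suc (suc j)} () ; {suc zero} {zero} () ; {suc zero} {suc (suc j)} ()
              ; {suc (suc i)} {zero} () ; {suc (suc i)} {suc zero} ()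
              ; {suc (suc i)} {suc (suc j)} h → cong (λ k → suc (suc k)) (τ-inj (suc-injective (suc-injective h))) }
  ; τ-onto = λ { zero → suc zero , refl ; (suc zero) → zero , refl
               ; (suc (suc j)) → let i , h = τ-onto j in suc (suc i) , cong (λ k → suc (suc k)) h }
  ; τ-at = λ { zero → refl ; (suc zero) → refl ; (suc (suc i)) → τ-at i } }
  where open Reindexing (↭-reindexing p)
↭-reindexing (trans p q) = record
  { τ = R₂.τ ∘ R₁.τ
  ; τ-inj = R₁.τ-inj ∘ R₂.τ-inj
  ; τ-onto = λ k → let j , h = R₂.τ-onto k ; i , h′ = R₁.τ-onto j in i , ≡-trans (cong R₂.τ h′) h
  ; τ-at = λ i → ≡-trans (R₁.τ-at i) (R₂.τ-at (R₁.τ i)) }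
  where module R₁ = Reindexing (↭-reindexing p)
        module R₂ = Reindexing (↭-reindexing q)

-- H arises from G by shrinking the complement of P to c.
record Side (G H : Graph) (P : V G → Bool) : Set where
  field
    φ      : V G → V H
    c      : V H
    φ-inj  : ∀ {u v} → P u ≡ true → P v ≡ true → φ u ≡ φ v → u ≡ v
    φ-out  : ∀ {v} → P v ≡ false → φ v ≡ c
    φ-in   : ∀ {v} → P v ≡ true → φ v ≢ c
    φ-onto : ∀ w → w ≡ c ⊎ ∃ λ v → P v ≡ true × φ v ≡ w
    σ      : Edge H → Edge G
    σ-inj  : ∀ {i j} → σ i ≡ σ j → i ≡ j
    σ-meets : ∀ i → ∃ λ v → In G (σ i) v × P v ≡ true
    σ-onto : ∀ {e v} → In G e v → P v ≡ true → ∃ λ i → σ i ≡ e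
    σ-joins : ∀ {i u v} → Joins G (σ i) u v → Joins H i (φ u) (φ v)

contraction⇒side : ∀ {G H X P} → (∀ v → P v ≡ X v) → Contraction G X H → Side G H P
contraction⇒side {G} {H} {X} {P} P≡X (φ , c , inj , out , ins , onto , perm) = record
  { φ = φ ; c = c
  ; φ-inj = λ hu hv → inj _ _ (X-true hu) (X-true hv)
  ; φ-out = λ h → out _ (≡-trans (sym (P≡X _)) h)
  ; φ-in = λ h → ins _ (X-true h)
  ; φ-onto = φ-onto
  ; σ = Sel.σ ∘ Re.τ
  ; σ-inj = Re.τ-inj ∘ Sel.σ-inj
  ; σ-meets = λ i → case ∨-true {X (src G _)} (Sel.selected (Re.τ i)) of λ
      { (inj₁ h) → _ , at-src refl , ≡-trans (P≡X _) h ; (inj₂ h) → _ , at-tgt refl , ≡-trans (P≡X _) h }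
  ; σ-onto = λ e-in h → let j , h′ = Sel.onto _ (meets e-in (X-true h)) ; i , h″ = Re.τ-onto j in
      i , ≡-trans (cong Sel.σ h″) h′
  ; σ-joins = σ-joins }
  where
  module Re = Reindexing (↭-reindexing perm)
  module Sel = Selection (filter-selection (λ e → φ (proj₁ e) , φ (proj₂ e)) (λ e → X (proj₁ e) ∨ X (proj₂ e)) (edges G))
  X-true : ∀ {v} → P v ≡ true → X v ≡ true
  X-true h = ≡-trans (sym (P≡X _)) h
  meets : ∀ {e v} → In G e v → X v ≡ true → X (src G e) ∨ X (tgt G e) ≡ true
  meets (at-src refl) h = ∨-introˡ _ h
  meets (at-tgt refl) h = ∨-introʳ _ h
  ends-at : ∀ i → ends H i ≡ (φ (src G (Sel.σ (Re.τ i))) , φ (tgt G (Sel.σ (Re.τ i))))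
  ends-at i = ≡-trans (Re.τ-at i) (Sel.at (Re.τ i))
  σ-joins : ∀ {i u v} → Joins G (Sel.σ (Re.τ i)) u v → Joins H i (φ u) (φ v)
  σ-joins {i} (fwd refl refl) = fwd (cong proj₁ (ends-at i)) (cong proj₂ (ends-at i))
  σ-joins {i} (bwd refl refl) = bwd (cong proj₁ (ends-at i)) (cong proj₂ (ends-at i))
  φ-onto : ∀ w → w ≡ c ⊎ ∃ λ v → P v ≡ true × φ v ≡ w
  φ-onto w with onto w
  ... | v , refl with P v in eq
  ...   | true  = inj₂ (v , eq , refl)
  ...   | false = inj₁ (out v (≡-trans (sym (P≡X v)) eq))

module SideLemmas {G H : Graph} {P : V G → Bool} (S : Side G H P) where

  open Side S

  unjoins : ∀ {i u v} → Joins H i u v → ∃₂ λ u′ v′ → Joins G (σ i) u′ v′ × φ u′ ≡ u × φ v′ ≡ v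
  unjoins {i} j with σ-joins {i} (ends-joins G (σ i)) | j
  ... | fwd a b | fwd a′ b′ = _ , _ , ends-joins G (σ i) , ≡-trans (sym a) a′ , ≡-trans (sym b) b′
  ... | fwd a b | bwd a′ b′ = _ , _ , joins-sym (ends-joins G (σ i)) , ≡-trans (sym b) b′ , ≡-trans (sym a) a′
  ... | bwd a b | fwd a′ b′ = _ , _ , joins-sym (ends-joins G (σ i)) , ≡-trans (sym a) a′ , ≡-trans (sym b) b′
  ... | bwd a b | bwd a′ b′ = _ , _ , ends-joins G (σ i) , ≡-trans (sym b) b′ , ≡-trans (sym a) a′

  σ-in : ∀ {i v} → In G (σ i) v → In H i (φ v)
  σ-in e-in = joins-inˡ (σ-joins (proj₂ (in⇒joins e-in)))

  φ-cancel : ∀ {u v} → P v ≡ true → φ u ≡ φ v → u ≡ v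
  φ-cancel {u} hv eq with P u in hu
  ... | true  = φ-inj hu hv eq
  ... | false = contradiction (≡-trans (sym eq) (φ-out hu)) (φ-in hv)

  in-σ : ∀ {i v} → P v ≡ true → In H i (φ v) → In G (σ i) v
  in-σ hv i-in with unjoins (proj₂ (in⇒joins i-in))
  ... | u , _ , j , eq , _ = subst (In G _) (φ-cancel hv eq) (joins-inˡ j)

  joins-σ : ∀ {i u v} → P u ≡ true → P v ≡ true → Joins H i (φ u) (φ v) → Joins G (σ i) u v
  joins-σ hu hv j with unjoins j
  ... | _ , _ , j′ , eq , eq′ = subst₂ (Joins G _) (φ-cancel hu eq) (φ-cancel hv eq′) j′

  c⇒cut : ∀ {i} → In H i c → Cut G P (σ i)
  c⇒cut {i} i-in with unjoins (proj₂ (in⇒joins i-in)) | σ-meets i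
  ... | u , w , j , φu≡c , _ | v , v-in , Pv with P u in Pu | joins-ends j v-in
  ...   | true  | _         = contradiction φu≡c (φ-in Pu)
  ...   | false | inj₁ refl = ⊥-elim (true≢false Pv Pu)
  ...   | false | inj₂ refl = ≢⇒cut Pv Pu (joins-sym j)

  cut-ends : ∀ {e} → Cut G P e → ∃₂ λ u w → Joins G e u w × P u ≡ true × P w ≡ false
  cut-ends {e} ce with P (src G e) in eq | P (tgt G e) in eq′ | cut⇒≢ ce (ends-joins G e)
  ... | true  | false | _ = _ , _ , ends-joins G e , eq , eq′
  ... | false | true  | _ = _ , _ , joins-sym (ends-joins G e) , eq′ , eq

  cut⇒c : ∀ {i} → Cut G P (σ i) → In H i c
  cut⇒c ce with cut-ends ce
  ... | u , w , j , _ , Pw = subst (In H _) (φ-out Pw) (σ-in (joins-inʳ j))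

  cut-onto : ∀ {e} → Cut G P e → ∃ λ i → σ i ≡ e
  cut-onto ce with cut-ends ce
  ... | u , _ , j , Pu , _ = σ-onto (joins-inˡ j) Pu

  inner : ∀ {i u v} → ¬ Cut G P (σ i) → Joins G (σ i) u v → P u ≡ true × P v ≡ true
  inner {i} nc j with σ-meets i
  ... | w , w-in , Pw with joins-ends j w-in
  ... | inj₁ refl = Pw , ≡-trans (sym (¬cut⇒≡ nc j)) Pw
  ... | inj₂ refl = ≡-trans (¬cut⇒≡ nc j) Pw , Pw

  -- Crossing the cut exactly once is what matches the shrunk vertex; at all other vertices the
  -- incident edges are unchanged.
  restrict : ∀ {M} → PM G M → OneCross G P M → PM H (M ∘ σ)
  restrict {M} pm (e , (Me , ce) , uniq) .PM.matched w with φ-onto w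
  ... | inj₁ refl with cut-onto ce
  ...   | i , refl = i , (Me , cut⇒c ce) , λ k (Mk , k-in) → σ-inj (uniq (σ k) (Mk , c⇒cut k-in))
  restrict {M} pm one .PM.matched w | inj₂ (v , Pv , refl) with PM.matched pm v
  ... | e , (Me , e-in) , uniq with σ-onto e-in Pv
  ...   | i , refl = i , (Me , σ-in e-in) , λ k (Mk , k-in) → σ-inj (uniq (σ k) (Mk , in-σ Pv k-in))

  avoid-restrict : (∀ {M} → PM G M → OneCross G P M) → ∀ {i} → (∀ f → f ≢ σ i → Avoid G f (σ i)) →
                   ∀ k → k ≢ i → Avoid H k i
  avoid-restrict tight h k k≢i with h (σ k) (k≢i ∘ σ-inj)
  ... | mkAvoid pm has not-has = mkAvoid (restrict pm (tight pm)) has not-has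

  star-lift : ∀ {v a b d} → P v ≡ true → Star G v a b d →
              ∃ λ i → ∃ λ j → ∃ λ k → Star H (φ v) i j k × σ i ≡ a × σ j ≡ b × σ k ≡ d
  star-lift Pv (mkStar a≢b a≢c b≢c ia ib ic cov)
    with σ-onto ia Pv | σ-onto ib Pv | σ-onto ic Pv
  ... | i , refl | j , refl | k , refl = i , j , k , mkStar
    (a≢b ∘ cong σ) (a≢c ∘ cong σ) (b≢c ∘ cong σ) (σ-in ia) (σ-in ib) (σ-in ic)
    (λ l l-in → case cov (σ l) (in-σ Pv l-in) of λ
      { (inj₁ eq) → inj₁ (σ-inj eq) ; (inj₂ (inj₁ eq)) → inj₂ (inj₁ (σ-inj eq)) ; (inj₂ (inj₂ eq)) → inj₂ (inj₂ (σ-inj eq)) })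
    , refl , refl , refl

  joins-lift : ∀ {e u v} → P u ≡ true → Joins G e u v → ∃ λ i → Joins H i (φ u) (φ v)
  joins-lift Pu j with σ-onto (joins-inˡ j) Pu
  ... | i , refl = i , σ-joins j

  side-loopless : Loopless G → Loopless H
  side-loopless ll i eq with unjoins (ends-joins H i)
  ... | u , v , j , eq₁ , eq₂ with σ-meets i
  ... | w , w-in , Pw with joins-ends j w-in
  ... | inj₁ refl = joins-irrefl ll j (sym (φ-cancel Pw (≡-trans eq₂ (≡-trans (sym eq) (sym eq₁)))))
  ... | inj₂ refl = joins-irrefl ll j (φ-cancel Pw (≡-trans eq₁ (≡-trans eq (sym eq₂))))

  module _ (nk : Neck G P) where

    open Neck nk renaming (c to c′)

    opaque
      c-star : ∃ λ i → ∃ λ i₁ → ∃ λ i₂ → Star H c i i₁ i₂ × σ i ≡ g × σ i₁ ≡ e₁ × σ i₂ ≡ e₂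
      c-star with cut-onto cut-g | cut-onto cut₁ | cut-onto cut₂
      ... | i , eq | i₁ , eq₁ | i₂ , eq₂ = i , i₁ , i₂ , mkStar
        (λ h → g≢e₁ (via eq eq₁ h)) (λ h → g≢e₂ (via eq eq₂ h)) (λ h → e₁≢e₂ (via eq₁ eq₂ h))
        (cut⇒c (subst (Cut G P) (sym eq) cut-g)) (cut⇒c (subst (Cut G P) (sym eq₁) cut₁)) (cut⇒c (subst (Cut G P) (sym eq₂) cut₂))
        (λ k k-in → case cover (σ k) (c⇒cut k-in) of λ
          { (inj₁ h) → inj₁ (σ-inj (≡-trans h (sym eq))) ; (inj₂ (inj₁ h)) → inj₂ (inj₁ (σ-inj (≡-trans h (sym eq₁))))
          ; (inj₂ (inj₂ h)) → inj₂ (inj₂ (σ-inj (≡-trans h (sym eq₂)))) })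
        , eq , eq₁ , eq₂
        where via : ∀ {i j e f} → σ i ≡ e → σ j ≡ f → i ≡ j → e ≡ f
              via refl refl refl = refl

    -- If `a` survives, `e₁` and `e₂` become a digon between it and the shrunk vertex. If `a` is
    -- shrunk, `b` and `c′` survive, and their coincidence or adjacency closes the corner.
    c-corner : Corner H c
    c-corner with c-star
    ... | i , i₁ , i₂ , st , _ , eq₁ , eq₂ with P a in Pa
    ...   | true  = mkCorner st (to-c eq₁ cut₁ j₁) (to-c eq₂ cut₂ j₂) (inj₁ refl)
      where to-c : ∀ {i e u} → σ i ≡ e → Cut G P e → Joins G e a u → Joins H i c (φ a)
            to-c refl ce j = subst (λ z → Joins H _ z (φ a))
              (φ-out (≡-trans (flip-not (cut⇒≢ ce j)) (cong not Pa))) (σ-joins (joins-sym j))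
    ...   | false = mkCorner st (subst (λ z → Joins H i₁ z (φ b)) (φ-out Pa) (σ-joins (subst (λ e → Joins G e a b) (sym eq₁) j₁)))
                                (subst (λ z → Joins H i₂ z (φ c′)) (φ-out Pa) (σ-joins (subst (λ e → Joins G e a c′) (sym eq₂) j₂)))
                                (closed close)
      where closed : b ≡ c′ ⊎ (∃ λ r → Joins G r b c′) → φ b ≡ φ c′ ⊎ ∃ λ r → Joins H r (φ b) (φ c′)
            closed (inj₁ eq)      = inj₁ (cong φ eq)
            closed (inj₂ (r , j)) = inj₂ (joins-lift (≡-trans (flip-not (cut⇒≢ cut₁ j₁)) (cong not Pa)) j)

    opaque
      side-cornered : Cornered G → Cornered H
      side-cornered cg = record { loopless = side-loopless loopless ; corner = corner-at }
        where
        open Cornered cg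
        -- A triangle with two vertices in the shrunk part turns into a digon.
        close-up : ∀ {x y} → x ≡ y ⊎ (∃ λ r → Joins G r x y) → φ x ≡ φ y ⊎ ∃ λ r → Joins H r (φ x) (φ y)
        close-up (inj₁ eq) = inj₁ (cong φ eq)
        close-up {x} {y} (inj₂ (r , j)) with P x in Px | P y in Py
        ... | true  | _     = inj₂ (joins-lift Px j)
        ... | false | true  = inj₂ (let i , j′ = joins-lift Py (joins-sym j) in i , joins-sym j′)
        ... | false | false = inj₁ (≡-trans (φ-out Px) (sym (φ-out Py)))
        corner-at : ∀ w → Corner H w
        corner-at w with φ-onto w
        ... | inj₁ refl = c-corner
        ... | inj₂ (v , Pv , refl) with corner v
        ...   | mkCorner st jp jq cl with star-lift Pv st
        ...     | _ , _ , _ , st′ , refl , refl , refl = mkCorner st′ (σ-joins jp) (σ-joins jq) (close-up cl)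

-- Additivity of the weight along a nontrivial tight cut

-- In a perfect matching through `f` that contains `e`, exchange `e` for the parallel edge `e′`.
parallel⇒avoidable : ∀ {G e e′} → Covered G → Parallel G e e′ → ∀ f → f ≢ e → Avoid G f e
parallel⇒avoidable {G} {e} {e′} cov (mkParallel e′≢e j′) f f≢e with Covered.through cov f
... | M , pm , Mf with M e in Me
...   | false = mkAvoid pm Mf Me
...   | true  = mkAvoid {M = N} N-pm (≡-trans (N-other f≢e f≢e′) Mf) N-e
  where
  same-ends : ∀ {v} → In G e v → In G e′ v
  same-ends (at-src refl) = joins-inˡ j′
  same-ends (at-tgt refl) = joins-inʳ j′
  same-ends′ : ∀ {v} → In G e′ v → In G e v
  same-ends′ e-in with joins-ends j′ e-in
  ... | inj₁ eq = at-src (sym eq)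
  ... | inj₂ eq = at-tgt (sym eq)
  f≢e′ : f ≢ e′
  f≢e′ refl = e′≢e (PM-unique pm Mf (joins-inˡ j′) Me (at-src refl))
  N : Edge G → Bool
  N x = (⌊ x ≟ e′ ⌋ ∨ M x) ∧ not ⌊ x ≟ e ⌋
  N-e : N e ≡ false
  N-e with e ≟ e
  ... | yes _  = ∧-zeroʳ _
  ... | no neq = contradiction refl neq
  N-e′ : N e′ ≡ true
  N-e′ with e′ ≟ e′ | e′ ≟ e
  ... | no neq | _     = contradiction refl neq
  ... | _      | yes h = contradiction h e′≢e
  ... | yes _  | no _  = refl
  N-other : ∀ {x} → x ≢ e → x ≢ e′ → N x ≡ M x
  N-other {x} h h′ with x ≟ e′ | x ≟ e
  ... | yes k | _     = contradiction k h′
  ... | _     | yes k = contradiction k h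
  ... | no _  | no _  = ∧-identityʳ _
  N-true : ∀ {x} → N x ≡ true → x ≡ e′ ⊎ (x ≢ e × M x ≡ true)
  N-true {x} h with x ≟ e | x ≟ e′
  ... | yes refl | _     = ⊥-elim (true≢false h (∧-zeroʳ _))
  ... | no x≢e | yes k   = inj₁ k
  ... | no x≢e | no _    = inj₂ (x≢e , proj₁ (∧-true h))
  N-pm : PM G N
  N-pm .PM.matched v with PM.matched pm v
  ... | x , (Mx , x-in) , uniq with x ≟ e
  ... | yes refl = e′ , (N-e′ , same-ends x-in) , λ y (Ny , y-in) → case N-true {y} Ny of λ
      { (inj₁ h) → h ; (inj₂ (y≢e , My)) → contradiction (uniq y (My , y-in)) y≢e }
  ... | no x≢e = x , (≡-trans (N-other x≢e x≢e′) Mx , x-in) , λ y (Ny , y-in) → case N-true {y} Ny of λ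
      { (inj₁ refl) → contradiction (sym (uniq e (Me , same-ends′ y-in))) x≢e ; (inj₂ (_ , My)) → uniq y (My , y-in) }
    where x≢e′ : x ≢ e′
          x≢e′ refl = x≢e (sym (uniq e (Me , same-ends′ x-in)))

-- The opposite edge of a triangle, or the third edge at the far end of a digon, forces the stem.
opaque
  stem-not-removable : ∀ {G v s p q x y} → Cornered G → Star G v s p q → Joins G p v x → Joins G q v y →
                       x ≡ y ⊎ (∃ λ r → Joins G r x y) → ¬ StrictlyRemovable G s
  stem-not-removable {G} {v} {s} {p} {q} cg st jp jq (inj₂ (r , jr)) (mkSR av _)
    with av r r≢s
    where
    open Cornered cg
    r∌v : ¬ In G r v
    r∌v r-in = [ joins-irrefl loopless jp , joins-irrefl loopless jq ]′ (joins-ends jr r-in)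
    r≢s : r ≢ s
    r≢s refl = r∌v (Star.a-in st)
  ... | mkAvoid {M} pm Mr Ms with PM.matched pm v
  ... | e , (Me , e-in) , _ with Star.cover st e e-in
  ... | inj₁ refl        = true≢false Me Ms
  ... | inj₂ (inj₁ refl) = [ joins-irrefl (Cornered.loopless cg) jp , joins-irrefl (Cornered.loopless cg) jq ]′
        (joins-ends jr (subst (λ e → In G e v) (PM-unique pm Me (joins-inʳ jp) Mr (joins-inˡ jr)) e-in))
  ... | inj₂ (inj₂ refl) = [ joins-irrefl (Cornered.loopless cg) jp , joins-irrefl (Cornered.loopless cg) jq ]′
        (joins-ends jr (subst (λ e → In G e v) (PM-unique pm Me (joins-inʳ jq) Mr (joins-inʳ jr)) e-in))
  stem-not-removable {G} {v} {s} {p} {q} {x} cg st jp jq (inj₁ refl) (mkSR av np)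
    with complete (Corner.star (Cornered.corner cg x)) (joins-inʳ jp) (joins-inʳ jq) (Star.b≢c st)
  ... | t , st′ with av t t≢s
    where
    t≢s : t ≢ s
    t≢s refl = np p (parallel-of (in²⇒joins (joins-irrefl (Cornered.loopless cg) jp) (Star.a-in st) (Star.a-in st′)) jp
      (≢-sym (Star.a≢b st)))
  ... | mkAvoid {M} pm Mt Ms with PM.matched pm v
  ... | e , (Me , e-in) , _ with Star.cover st e e-in
  ... | inj₁ refl        = true≢false Me Ms
  ... | inj₂ (inj₁ refl) = Star.a≢b st′ (PM-unique pm Mt (Star.a-in st′) Me (joins-inʳ jp))
  ... | inj₂ (inj₂ refl) = Star.a≢c st′ (PM-unique pm Mt (Star.a-in st′) Me (joins-inʳ jq))

cut-flip : ∀ {G P Q e} → (∀ v → Q v ≡ not (P v)) → Cut G P e → Cut G Q e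
cut-flip {G} {P} {Q} {e} Q≡¬P ce = differ⇒cut (≡-trans (Q≡¬P _) (cong not (≡-trans (cut⇒≢ ce (ends-joins G e)) (sym (Q≡¬P _)))))
  (ends-joins G e)

-- The sides are two predicates related pointwise. Complementing twice returns `P` only pointwise,
-- and the roles of the two halves have to be interchangeable.
record Halves (G H₁ H₂ : Graph) (P Q : V G → Bool) : Set where
  field
    left   : Side G H₁ P
    right  : Side G H₂ Q
    Q≡¬P   : ∀ v → Q v ≡ not (P v)
    cov    : Covered G
    cov₁   : Covered H₁
    cov₂   : Covered H₂
    ntc    : NTC G P

¬-flip : ∀ {G} {P Q : V G → Bool} → (∀ v → Q v ≡ not (P v)) → ∀ v → P v ≡ not (Q v)
¬-flip h v = flip-not (h v)

halves-swap : ∀ {G H₁ H₂ P Q} → Halves G H₁ H₂ P Q → Halves G H₂ H₁ Q P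
halves-swap {G} {P = P} {Q} h = record
  { left = right ; right = left ; Q≡¬P = ¬-flip {G} {P} {Q} Q≡¬P ; cov = cov ; cov₁ = cov₂ ; cov₂ = cov₁
  ; ntc = record
    { inside  = λ v → let u , u≢v , Pu = NTC.outside ntc v in u , u≢v , ≡-trans (Q≡¬P u) (cong not Pu)
    ; outside = λ v → let u , u≢v , Pu = NTC.inside ntc v in u , u≢v , ≡-trans (Q≡¬P u) (cong not Pu)
    ; tight   = λ pm → let e , (Me , ce) , uniq = NTC.tight ntc pm in
        e , (Me , cut-flip Q≡¬P ce) , λ f (Mf , cf) → uniq f (Mf , cut-flip (¬-flip {G} {P} {Q} Q≡¬P) cf) } }
  where open Halves h

neck-swap : ∀ {G P Q} → (∀ v → Q v ≡ not (P v)) → Neck G P → Neck G Q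
neck-swap {G} {P} {Q} h nk = record
  { j₁ = j₁ ; j₂ = j₂ ; close = close ; cut-g = cut-flip h cut-g ; cut₁ = cut-flip h cut₁ ; cut₂ = cut-flip h cut₂
  ; g≢e₁ = g≢e₁ ; g≢e₂ = g≢e₂ ; e₁≢e₂ = e₁≢e₂ ; cover = λ e ce → cover e (cut-flip (¬-flip {G} {P} {Q} h) ce) }
  where open Neck nk

neck-flip : ∀ {G P} → Neck G P → Neck G P
neck-flip nk = record
  { j₁ = j₂ ; j₂ = j₁ ; close = [ inj₁ ∘ sym , (λ (r , j) → inj₂ (r , joins-sym j)) ]′ close
  ; cut-g = cut-g ; cut₁ = cut₂ ; cut₂ = cut₁ ; g≢e₁ = g≢e₂ ; g≢e₂ = g≢e₁ ; e₁≢e₂ = ≢-sym e₁≢e₂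
  ; cover = λ e ce → [ inj₁ , [ inj₂ ∘ inj₂ , inj₂ ∘ inj₁ ]′ ]′ (cover e ce) }
  where open Neck nk

-- An edge of `G` parallel to `σ i` has the same ends, hence also meets `P` and survives as a
-- parallel of `i`.
side-parallel : ∀ {G H P} (S : Side G H P) {i} → (∀ f → ¬ Parallel H i f) → ∀ f → ¬ Parallel G (Side.σ S i) f
side-parallel {G} {H} S {i} np f par@(mkParallel f≢ j) with Side.σ-meets S i
... | v , v-in , Pv with Side.σ-onto S (f-in v-in) Pv
  where f-in : ∀ {v} → In G (Side.σ S i) v → In G f v
        f-in (at-src refl) = joins-inˡ j
        f-in (at-tgt refl) = joins-inʳ j
... | k , refl = np k (parallel-of (Side.σ-joins S (ends-joins G (Side.σ S i))) (Side.σ-joins S j)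
                        λ { refl → f≢ refl })

module Gluing {G H₁ H₂ : Graph} {P Q : V G → Bool} (hv : Halves G H₁ H₂ P Q) where

  open Halves hv
  module L = Side left
  module R = Side right
  module LL = SideLemmas left
  module RR = SideLemmas right

  Q-true : ∀ {v} → Q v ≡ true → P v ≡ false
  Q-true h = ≡-trans (flip-not (Q≡¬P _)) (cong not h)

  ¬P⇒Q : ∀ {v} → P v ≡ false → Q v ≡ true
  ¬P⇒Q h = ≡-trans (Q≡¬P _) (cong not h)

  both⇒cut : ∀ {i j} → L.σ i ≡ R.σ j → Cut G P (L.σ i)
  both⇒cut {i} {j} eq with L.σ-meets i | R.σ-meets j
  ... | u , u-in , Pu | v , v-in , Qv =
    ≢⇒cut Pu (Q-true Qv) (in²⇒joins (λ { refl → true≢false Pu (Q-true Qv) }) u-in (subst (λ e → In G e v) (sym eq) v-in))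

  cut⇒both : ∀ {i} → Cut G P (L.σ i) → ∃ λ j → R.σ j ≡ L.σ i
  cut⇒both ce = RR.cut-onto (cut-flip Q≡¬P ce)

  side-of : ∀ e → (∃ λ i → L.σ i ≡ e) ⊎ (∃ λ j → R.σ j ≡ e)
  side-of e with P (src G e) in eq
  ... | true  = inj₁ (L.σ-onto (at-src refl) eq)
  ... | false = inj₂ (R.σ-onto (at-src refl) (¬P⇒Q eq))

  module Glue {M₁ : Edge H₁ → Bool} {M₂ : Edge H₂ → Bool} (pm₁ : PM H₁ M₁) (pm₂ : PM H₂ M₂) {i₀ j₀}
    (same : L.σ i₀ ≡ R.σ j₀) (h₁ : M₁ i₀ ≡ true) (h₂ : M₂ j₀ ≡ true) where

    From : Edge G → Set
    From e = (∃ λ i → L.σ i ≡ e × M₁ i ≡ true) ⊎ (∃ λ j → R.σ j ≡ e × M₂ j ≡ true)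

    from? : ∀ e → Dec (From e)
    from? e = any? (λ i → (L.σ i ≟ e) ×-dec (M₁ i ≟ᵇ true)) ⊎-dec any? (λ j → (R.σ j ≟ e) ×-dec (M₂ j ≟ᵇ true))

    opaque
      glued : Edge G → Bool
      glued e = ⌊ from? e ⌋

      glued⇒ : ∀ {e} → glued e ≡ true → From e
      glued⇒ = ⌊⌋-true

      ⇒glued : ∀ {e} → From e → glued e ≡ true
      ⇒glued {e} = ⌊⌋-intro (from? e)

    cut₀ : Cut G P (L.σ i₀)
    cut₀ = both⇒cut same

    i₀-unique : ∀ {i} → M₁ i ≡ true → Cut G P (L.σ i) → i ≡ i₀
    i₀-unique Mi ci = PM-unique pm₁ Mi (LL.cut⇒c ci) h₁ (LL.cut⇒c cut₀)

    j₀-unique : ∀ {j} → M₂ j ≡ true → Cut G Q (R.σ j) → j ≡ j₀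
    j₀-unique Mj cj = PM-unique pm₂ Mj (RR.cut⇒c cj) h₂ (RR.cut⇒c (cut-flip Q≡¬P (subst (Cut G P) same cut₀)))

    -- An edge contributed by `M₂` that also has a copy on the left lies in the cut. The shrunk
    -- vertex is matched once, so it is the common cut edge, which `M₁` contains as well.
    glued-left : ∀ {i} → glued (L.σ i) ≡ true → M₁ i ≡ true
    glued-left {i} h with glued⇒ h
    ... | inj₁ (k , eq , Mk) = subst (λ i → M₁ i ≡ true) (L.σ-inj eq) Mk
    ... | inj₂ (j , eq , Mj) with j₀-unique Mj (subst (Cut G Q) (sym eq) (cut-flip Q≡¬P (both⇒cut (sym eq))))
    ...   | refl = subst (λ i → M₁ i ≡ true) (L.σ-inj (≡-trans same eq)) h₁

    glued-right : ∀ {j} → glued (R.σ j) ≡ true → M₂ j ≡ true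
    glued-right {j} h with glued⇒ h
    ... | inj₂ (k , eq , Mk) = subst (λ i → M₂ i ≡ true) (R.σ-inj eq) Mk
    ... | inj₁ (i , eq , Mi) with i₀-unique Mi (both⇒cut eq)
    ...   | refl = subst (λ i → M₂ i ≡ true) (R.σ-inj (≡-trans (sym same) eq)) h₂

    glued-PM : PM G glued
    glued-PM .PM.matched v with P v in Pv
    ... | true with PM.matched pm₁ (L.φ v)
    ...   | i , (Mi , i-in) , uniq = L.σ i , (⇒glued (inj₁ (i , refl , Mi)) , LL.in-σ Pv i-in) , unique
      where unique : ∀ f → glued f ≡ true × In G f v → f ≡ L.σ i
            unique f (gf , f-in) with L.σ-onto f-in Pv
            ... | k , refl = cong L.σ (uniq k (glued-left gf , LL.σ-in f-in))
    glued-PM .PM.matched v | false with PM.matched pm₂ (R.φ v)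
    ...   | j , (Mj , j-in) , uniq = R.σ j , (⇒glued (inj₂ (j , refl , Mj)) , RR.in-σ (¬P⇒Q Pv) j-in) , unique
      where unique : ∀ f → glued f ≡ true × In G f v → f ≡ R.σ j
            unique f (gf , f-in) with R.σ-onto f-in (¬P⇒Q Pv)
            ... | k , refl = cong R.σ (uniq k (glued-right gf , RR.σ-in f-in))

  -- It suffices that one of the two matchings avoids its copy of `σ i`; the other is only required
  -- to use the same cut edge. If `f` is on the right and `σ i` is not in the cut, a matching `M₂`
  -- through `f` comes first, and `M₁` is a matching through the cut edge of `M₂` that avoids `i`.
  avoid-glue : ∀ {i} → (∀ k → k ≢ i → Avoid H₁ k i) → (∀ j → R.σ j ≡ L.σ i → ∀ k → k ≢ j → Avoid H₂ k j) →
               ∀ f → f ≢ L.σ i → Avoid G f (L.σ i)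
  avoid-glue {i} av₁ av₂ f f≢ with side-of f
  ... | inj₁ (k , refl) with av₁ k (λ { refl → f≢ refl })
  ...   | mkAvoid {M₁} pm₁ Mk Mi with PM.matched pm₁ L.c
  ...     | i₀ , (Mi₀ , i₀-in) , _ with cut⇒both (LL.c⇒cut i₀-in)
  ...       | j₀ , eq with Covered.through cov₂ j₀
  ...         | M₂ , pm₂ , Mj₀ = mkAvoid glued-PM (⇒glued (inj₁ (k , refl , Mk))) (¬true λ h → true≢false (glued-left h) Mi)
    where open Glue pm₁ pm₂ (sym eq) Mi₀ Mj₀
  avoid-glue {i} av₁ av₂ f f≢ | inj₂ (k , refl) with inCutᵇ G P (L.σ i) ≟ᵇ true
  ... | yes ci with cut⇒both (mkCut ci)
  ...   | j , eq with av₂ j eq k (λ { refl → f≢ eq })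
  ...     | mkAvoid {M₂} pm₂ Mk Mj with PM.matched pm₂ R.c
  ...       | j₀ , (Mj₀ , j₀-in) , _ with LL.cut-onto (cut-flip (¬-flip {G} {P} {Q} Q≡¬P) (RR.c⇒cut j₀-in))
  ...         | i₀ , eq₀ with Covered.through cov₁ i₀
  ...           | M₁ , pm₁ , Mi₀ = mkAvoid glued-PM (⇒glued (inj₂ (k , refl , Mk)))
                    (¬true λ h → true≢false (glued-right (subst (λ e → glued e ≡ true) (sym eq) h)) Mj)
    where open Glue pm₁ pm₂ eq₀ Mi₀ Mj₀
  avoid-glue {i} av₁ av₂ f f≢ | inj₂ (k , refl) | no ¬ci with Covered.through cov₂ k
  ... | M₂ , pm₂ , Mk with PM.matched pm₂ R.c
  ...   | j₀ , (Mj₀ , j₀-in) , _ with LL.cut-onto (cut-flip (¬-flip {G} {P} {Q} Q≡¬P) (RR.c⇒cut j₀-in))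
  ...     | i₀ , eq₀ with av₁ i₀ (λ { refl → ¬ci (crosses (subst (Cut G P) (sym eq₀) (cut-flip (¬-flip {G} {P} {Q} Q≡¬P) (RR.c⇒cut j₀-in)))) })
  ...       | mkAvoid {M₁} pm₁ Mi₀ Mi = mkAvoid glued-PM (⇒glued (inj₂ (k , refl , Mk))) (¬true λ h → true≢false (glued-left h) Mi)
    where open Glue pm₁ pm₂ eq₀ Mi₀ Mj₀

  inner-removable : ∀ {i} → ¬ Cut G P (L.σ i) → StrictlyRemovable H₁ i → StrictlyRemovable G (L.σ i)
  inner-removable nc (mkSR av np) = mkSR (avoid-glue av λ j eq → contradiction (both⇒cut (sym eq)) nc) (side-parallel left np)

  -- An inner edge has both ends in `P`, where the contraction is injective; so it acquires no new
  -- parallels.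
  removable-inner : ∀ {i} → ¬ Cut G P (L.σ i) → StrictlyRemovable G (L.σ i) → StrictlyRemovable H₁ i
  removable-inner {i} nc (mkSR av np) = mkSR (LL.avoid-restrict (NTC.tight ntc) av) np′
    where
    np′ : ∀ k → ¬ Parallel H₁ i k
    np′ k par@(mkParallel k≢i _) with LL.inner nc (ends-joins G (L.σ i))
    ... | Pu , Pv = np (L.σ k) (parallel-of (ends-joins G (L.σ i))
      (LL.joins-σ Pu Pv (of-parallel (L.σ-joins (ends-joins G (L.σ i))) par)) (k≢i ∘ L.σ-inj))

module Additive {G H₁ H₂ : Graph} {P Q : V G → Bool} (hv : Halves G H₁ H₂ P Q) (cg : Cornered G) where

  open Halves hv
  open Cornered cg
  open Gluing hv
  module Swapped = Gluing (halves-swap hv)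

  tightQ : ∀ {M} → PM G M → OneCross G Q M
  tightQ = NTC.tight (Halves.ntc (halves-swap hv))

  module _ (nk : Neck G P) (Pa : P (Neck.a nk) ≡ true) where

    open Neck nk

    nkQ : Neck G Q
    nkQ = neck-swap Q≡¬P nk

    Pb : P b ≡ false
    Pb = ≡-trans (flip-not (cut⇒≢ cut₁ j₁)) (cong not Pa)

    Pc : P c ≡ false
    Pc = ≡-trans (flip-not (cut⇒≢ cut₂ j₂)) (cong not Pa)

    Qa : Q a ≡ false
    Qa = ≡-trans (Q≡¬P a) (cong not Pa)

    left-join : ∀ {i e u} → L.σ i ≡ e → Joins G e a u → P u ≡ false → Joins H₁ i L.c (L.φ a)
    left-join {i} refl j Pu = subst (λ z → Joins H₁ i z (L.φ a)) (L.φ-out Pu) (L.σ-joins (joins-sym j))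

    right-join : ∀ {i e u} → R.σ i ≡ e → Joins G e a u → Joins H₂ i R.c (R.φ u)
    right-join {i} {u = u} refl j = subst (λ z → Joins H₂ i z (R.φ u)) (R.φ-out Qa) (R.σ-joins j)

    -- Otherwise the cut would be the star of `a`, which isolates a vertex.
    g∌a : ¬ In G g a
    g∌a g-in with complete (Corner.star (corner a)) (joins-inˡ j₁) (joins-inˡ j₂) e₁≢e₂
    ... | t , st with Star.cover st g g-in
    ... | inj₂ (inj₁ eq) = g≢e₁ eq
    ... | inj₂ (inj₂ eq) = g≢e₂ eq
    ... | inj₁ refl = star-not-cut ntc loopless (Covered.connected cov) st cut-g cut₁ cut₂ λ e ce →
      case cover e ce of λ { (inj₁ refl) → g-in ; (inj₂ (inj₁ refl)) → joins-inˡ j₁ ; (inj₂ (inj₂ refl)) → joins-inˡ j₂ }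

    left-parallel : ∀ {i} → L.σ i ≡ e₁ → ∃ λ k → Parallel H₁ i k
    left-parallel eq with LL.cut-onto cut₂
    ... | k , eq′ = k , parallel-of (left-join eq j₁ Pb) (left-join eq′ j₂ Pc)
      λ { refl → e₁≢e₂ (≡-trans (sym eq) eq′) }

    left-stem : ∀ {i} → L.σ i ≡ g → ¬ StrictlyRemovable H₁ i
    left-stem eq with LL.c-star nk
    ... | i , i₁ , i₂ , st , eq₀ , eq₁ , eq₂ with L.σ-inj (≡-trans eq (sym eq₀))
    ... | refl = stem-not-removable (LL.side-cornered nk cg) st (left-join eq₁ j₁ Pb) (left-join eq₂ j₂ Pc) (inj₁ refl)

    right-stem : ∀ {j} → R.σ j ≡ g → ¬ StrictlyRemovable H₂ j
    right-stem eq with RR.c-star nkQ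
    ... | i , i₁ , i₂ , st , eq₀ , eq₁ , eq₂ with R.σ-inj (≡-trans eq (sym eq₀))
    ... | refl = stem-not-removable (RR.side-cornered nkQ cg) st (right-join eq₁ j₁) (right-join eq₂ j₂)
      ([ inj₁ ∘ cong R.φ , (λ (r , j) → inj₂ (RR.joins-lift (¬P⇒Q Pb) j)) ]′ close)

    -- Strict removability of `g` would pass to the contraction that keeps `a`, contrary to
    -- `left-stem`. A parallel of `g` there would be a second cut edge at the end of `g` in `P`; but
    -- `e₁` and `e₂` meet `P` only in `a`, which is not an end of `g`.
    stem-fixed : ¬ StrictlyRemovable G g
    stem-fixed (mkSR av np) with LL.cut-onto cut-g | LL.cut-ends cut-g
    ... | i , eq | u , w , j , Pu , Pw = left-stem eq (mkSR
      (LL.avoid-restrict (NTC.tight ntc) (subst (λ e → ∀ f → f ≢ e → Avoid G f e) (sym eq) av)) λ k par → np′ k par)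
      where
      jᵢ : Joins H₁ i (L.φ u) (L.φ w)
      jᵢ = L.σ-joins (subst (λ e → Joins G e u w) (sym eq) j)
      np′ : ∀ k → ¬ Parallel H₁ i k
      np′ k par with of-parallel jᵢ par
      ... | jₖ with cover (L.σ k) (LL.c⇒cut (subst (In H₁ k) (L.φ-out Pw) (joins-inʳ jₖ)))
      ... | inj₁ h = Parallel.f≢e par (L.σ-inj (≡-trans h (sym eq)))
      ... | inj₂ (inj₁ h) = [ (λ { refl → g∌a (joins-inˡ j) }) , (λ { refl → true≢false Pu Pb }) ]′
              (joins-ends j₁ (subst (λ e → In G e u) h (LL.in-σ Pu (joins-inˡ jₖ))))
      ... | inj₂ (inj₂ h) = [ (λ { refl → g∌a (joins-inˡ j) }) , (λ { refl → true≢false Pu Pc }) ]′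
              (joins-ends j₂ (subst (λ e → In G e u) h (LL.in-σ Pu (joins-inˡ jₖ))))

    -- If g met b, then no perfect matching through r = bc could cross the cut.
    g∌b : StrictlyRemovable G e₁ → ¬ In G g b
    g∌b (mkSR _ np) g-in with close
    ... | inj₁ refl = np e₂ (parallel-of j₁ j₂ (≢-sym e₁≢e₂))
    ... | inj₂ (r , jr) with Covered.through cov r
    ... | M , pm , Mr with NTC.tight ntc pm
    ... | e , (Me , ce) , _ with cover e ce
    ... | inj₁ refl = r≢ (PM-unique pm Mr (joins-inˡ jr) Me g-in)
      where r≢ : r ≢ g
            r≢ refl = ¬cut (≡-trans Pb (sym Pc)) jr ce
    ... | inj₂ (inj₁ refl) = r≢ (PM-unique pm Mr (joins-inˡ jr) Me (joins-inʳ j₁))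
      where r≢ : r ≢ e₁
            r≢ refl = ¬cut (≡-trans Pb (sym Pc)) jr ce
    ... | inj₂ (inj₂ refl) = r≢ (PM-unique pm Mr (joins-inʳ jr) Me (joins-inʳ j₂))
      where r≢ : r ≢ e₂
            r≢ refl = ¬cut (≡-trans Pb (sym Pc)) jr ce

    -- A parallel in `H₂` would be another cut edge at `b`. It is not `g` by `g∌b`, and if it were
    -- `e₂`, then `e₁` and `e₂` would already be parallel in `G`.
    rib⇒right : ∀ {j} → R.σ j ≡ e₁ → StrictlyRemovable G e₁ → StrictlyRemovable H₂ j
    rib⇒right {j} refl sr@(mkSR av np) = mkSR (RR.avoid-restrict tightQ av) np′
      where
      np′ : ∀ k → ¬ Parallel H₂ j k
      np′ k par with of-parallel (right-join refl j₁) par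
      ... | jₖ with cover (R.σ k) (cut-flip (¬-flip {G} {P} {Q} Q≡¬P) (RR.c⇒cut (joins-inˡ jₖ)))
      ... | inj₁ h = g∌b sr (subst (λ e → In G e b) h (RR.in-σ (¬P⇒Q Pb) (joins-inʳ jₖ)))
      ... | inj₂ (inj₁ h) = Parallel.f≢e par (R.σ-inj h)
      ... | inj₂ (inj₂ h) with joins-ends j₂ (subst (λ e → In G e b) h (RR.in-σ (¬P⇒Q Pb) (joins-inʳ jₖ)))
      ...   | inj₁ eq   = true≢false Pa (subst (λ z → P z ≡ false) eq Pb)
      ...   | inj₂ refl = np e₂ (parallel-of j₁ j₂ (≢-sym e₁≢e₂))

    -- In `H₁` the copies of `e₁` and `e₂` are parallel, so the copy of `e₁` is avoidable there for
    -- free, and glueing transfers avoidance from `H₂`.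
    right⇒rib : ∀ {j} → R.σ j ≡ e₁ → StrictlyRemovable H₂ j → StrictlyRemovable G (R.σ j)
    right⇒rib eq (mkSR av np) = mkSR
      (Swapped.avoid-glue av λ i eq′ → parallel⇒avoidable cov₁ (proj₂ (left-parallel (≡-trans eq′ eq))))
      (side-parallel right np)

  module _ (nk : Neck G P) (Pa : P (Neck.a nk) ≡ true) where

    open Neck nk

    left-cut : ∀ {i} → Cut G P (L.σ i) → ¬ StrictlyRemovable H₁ i
    left-cut {i} ci sr with cover (L.σ i) ci
    ... | inj₁ eq        = left-stem nk Pa eq sr
    ... | inj₂ (inj₁ eq) = let k , par = left-parallel nk Pa eq in StrictlyRemovable.nonparallel sr k par
    ... | inj₂ (inj₂ eq) = let k , par = left-parallel (neck-flip nk) Pa eq in StrictlyRemovable.nonparallel sr k par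

    left⇒ : ∀ {i} → StrictlyRemovable H₁ i → StrictlyRemovable G (L.σ i)
    left⇒ {i} sr = inner-removable (λ ci → left-cut ci sr) sr

    right⇒ : ∀ {j} → StrictlyRemovable H₂ j → StrictlyRemovable G (R.σ j)
    right⇒ {j} sr with inCutᵇ G P (R.σ j) ≟ᵇ true
    ... | no ¬c = Swapped.inner-removable (λ ci → ¬c (crosses (cut-flip (¬-flip {G} {P} {Q} Q≡¬P) ci))) sr
    ... | yes ci with cover (R.σ j) (mkCut ci)
    ...   | inj₁ eq        = ⊥-elim (right-stem nk Pa eq sr)
    ...   | inj₂ (inj₁ eq) = right⇒rib nk Pa eq sr
    ...   | inj₂ (inj₂ eq) = right⇒rib (neck-flip nk) Pa eq sr

    ⇒either : ∀ {e} → StrictlyRemovable G e →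
              (∃ λ i → L.σ i ≡ e × StrictlyRemovable H₁ i) ⊎ (∃ λ j → R.σ j ≡ e × StrictlyRemovable H₂ j)
    ⇒either {e} sr with inCutᵇ G P e ≟ᵇ true
    ⇒either {e} sr | no ¬c with side-of e
    ... | inj₁ (i , refl) = inj₁ (i , refl , removable-inner (¬c ∘ crosses) sr)
    ... | inj₂ (j , refl) = inj₂ (j , refl , Swapped.removable-inner
                              (λ ci → ¬c (crosses (cut-flip (¬-flip {G} {P} {Q} Q≡¬P) ci))) sr)
    ⇒either {e} sr | yes c′ with cover e (mkCut c′) | RR.cut-onto (cut-flip Q≡¬P (mkCut c′))
    ... | inj₁ refl        | _      = ⊥-elim (stem-fixed nk Pa sr)
    ... | inj₂ (inj₁ refl) | j , eq = inj₂ (j , eq , rib⇒right nk Pa eq sr)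
    ... | inj₂ (inj₂ refl) | j , eq = inj₂ (j , eq , rib⇒right (neck-flip nk) Pa eq sr)

    -- Removable cut edges are credited to `H₂`, the side without `a`. In `H₁` no cut edge counts,
    -- which makes the two contributions disjoint.
    weight-+ : weight G ≡ weight H₁ + weight H₂
    weight-+ = ≡-trans (count-cong agree) (≡-trans (count-∨ inL inR disjoint) (cong₂ _+_ (sym count-L) (sym count-R)))
      where
      L? : ∀ e → Dec (∃ λ i → L.σ i ≡ e × removableᵇ H₁ i ≡ true)
      L? e = any? λ i → (L.σ i ≟ e) ×-dec (removableᵇ H₁ i ≟ᵇ true)
      R? : ∀ e → Dec (∃ λ i → R.σ i ≡ e × removableᵇ H₂ i ≡ true)
      R? e = any? λ i → (R.σ i ≟ e) ×-dec (removableᵇ H₂ i ≟ᵇ true)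
      inL inR : Edge G → Bool
      inL e = ⌊ L? e ⌋
      inR e = ⌊ R? e ⌋
      agree : ∀ e → removableᵇ G e ≡ inL e ∨ inR e
      agree e = bool-ext
        (λ h → case ⇒either (removableᵇ⇒ h) of λ
          { (inj₁ (i , eq , sr)) → ∨-introˡ _ (⌊⌋-intro (L? e) (i , eq , ⇒removableᵇ sr))
          ; (inj₂ (i , eq , sr)) → ∨-introʳ (inL e) (⌊⌋-intro (R? e) (i , eq , ⇒removableᵇ sr)) })
        (λ h → case ∨-true {inL e} h of λ
          { (inj₁ k) → case ⌊⌋-true {d = L? e} k of λ { (i , refl , sr) → ⇒removableᵇ (left⇒ (removableᵇ⇒ sr)) }
          ; (inj₂ k) → case ⌊⌋-true {d = R? e} k of λ { (i , refl , sr) → ⇒removableᵇ (right⇒ (removableᵇ⇒ sr)) } })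
      disjoint : ∀ e → inL e ≡ true → inR e ≡ true → ⊥
      disjoint e hl hr with ⌊⌋-true {d = L? e} hl | ⌊⌋-true {d = R? e} hr
      ... | i , eq , sr | j , eq′ , _ = left-cut (both⇒cut (≡-trans eq (sym eq′))) (removableᵇ⇒ sr)
      count-L : weight H₁ ≡ count inL
      count-L = count-bij L.σ (λ i h → ⌊⌋-intro (L? _) (i , refl , h)) (λ _ _ _ _ → L.σ-inj)
        λ e h → let i , eq , sr = ⌊⌋-true {d = L? e} h in i , sr , eq
      count-R : weight H₂ ≡ count inR
      count-R = count-bij R.σ (λ i h → ⌊⌋-intro (R? _) (i , refl , h)) (λ _ _ _ _ → R.σ-inj)
        λ e h → let i , eq , sr = ⌊⌋-true {d = R? e} h in i , sr , eq

record Split (G H₁ H₂ : Graph) : Set where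
  constructor mkSplit
  field
    cornered₁ : Cornered H₁
    cornered₂ : Cornered H₂
    weight-+  : weight G ≡ weight H₁ + weight H₂

opaque
  halves⇒split : ∀ {G H₁ H₂ P Q} → Halves G H₁ H₂ P Q → Cornered G → Split G H₁ H₂
  halves⇒split {G} {H₁} {H₂} {P} {Q} hv cg = mkSplit
    (SideLemmas.side-cornered left nk cg) (SideLemmas.side-cornered right (neck-swap Q≡¬P nk) cg) additive
    where
    open Halves hv
    nk : Neck G P
    nk = NeckOf.neck G cg cov ntc
    additive : weight G ≡ weight H₁ + weight H₂
    additive with P (Neck.a nk) in Pa
    ... | true  = Additive.weight-+ hv cg nk Pa
    ... | false = ≡-trans (Additive.weight-+ (halves-swap hv) cg (neck-swap Q≡¬P nk) (≡-trans (Q≡¬P _) (cong not Pa)))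
                          (+-comm (weight H₂) (weight H₁))

-- Simple cubic claw-free graphs

adj? : ∀ G u v → Dec (Adj G u v)
adj? G u v = map′ (λ (e , j) → joins⇒adj G e j) (adj⇒joins G) (any? λ e → joins? G e u v)

simple-unique : ∀ {G e f u v} → Simple G → Joins G e u v → Joins G f u v → e ≡ f
simple-unique {G} {e} {f} (_ , distinct) j k with e ≟ f
... | yes eq = eq
simple-unique {G} {e} {f} (_ , distinct) (fwd refl refl) (fwd h k) | no e≢f =
  contradiction (sym (cong₂ _,_ h k)) (proj₁ (distinct e f e≢f))
simple-unique {G} {e} {f} (_ , distinct) (fwd refl refl) (bwd h k) | no e≢f =
  contradiction (sym (cong₂ _,_ k h)) (proj₂ (distinct e f e≢f))
simple-unique {G} {e} {f} (_ , distinct) (bwd refl refl) (fwd h k) | no e≢f =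
  contradiction (sym (cong₂ _,_ k h)) (proj₂ (distinct e f e≢f))
simple-unique {G} {e} {f} (_ , distinct) (bwd refl refl) (bwd h k) | no e≢f =
  contradiction (sym (cong₂ _,_ h k)) (proj₁ (distinct e f e≢f))

cubic⇒star : ∀ {G} → Cubic G → ∀ v → ∃ λ a → ∃ λ b → ∃ λ c → Star G v a b c
cubic⇒star {G} cubic v with count-enum {p = λ e → incidentᵇ (ends G e) v} (cubic v)
... | f , f-inj , f-in , f-onto = f zero , f (suc zero) , f (suc (suc zero)) , mkStar
  (λ h → case f-inj _ _ h of λ ()) (λ h → case f-inj _ _ h of λ ()) (λ h → case f-inj _ _ h of λ ())
  (incident⇒in G _ v (f-in _)) (incident⇒in G _ v (f-in _)) (incident⇒in G _ v (f-in _))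
  λ e e-in → case f-onto e (in⇒incident G e v e-in) of λ
    { (zero , eq) → inj₁ (sym eq) ; (suc zero , eq) → inj₂ (inj₁ (sym eq)) ; (suc (suc zero) , eq) → inj₂ (inj₂ (sym eq)) }

claw-free⇒cornered : ∀ {G} → Simple G → Cubic G → ClawFree G → Cornered G
claw-free⇒cornered {G} simple cubic cf = record { loopless = proj₁ simple ; corner = corner }
  where
  corner : ∀ v → Corner G v
  corner v with cubic⇒star cubic v
  ... | a , b , c , st with in⇒joins (Star.a-in st) | in⇒joins (Star.b-in st) | in⇒joins (Star.c-in st)
  ... | x , jx | y , jy | z , jz with adj? G x y | adj? G x z | adj? G y z
  ...   | yes h | _     | _     = mkCorner (rotate (rotate st)) jx jy (inj₂ (adj⇒joins G h))
  ...   | no _  | yes h | _     = mkCorner (rotate st) jz jx (inj₂ (let e , j = adj⇒joins G h in e , joins-sym j))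
  ...   | no _  | no _  | yes h = mkCorner st jy jz (inj₂ (adj⇒joins G h))
  ...   | no h₁ | no h₂ | no h₃ = ⊥-elim (cf v x y z (joins⇒adj G a jx) (joins⇒adj G b jy) (joins⇒adj G c jz)
    (λ { refl → Star.a≢b st (simple-unique simple jx jy) }) (λ { refl → Star.a≢c st (simple-unique simple jx jz) })
    (λ { refl → Star.b≢c st (simple-unique simple jy jz) }) h₁ h₂ h₃)

record Deletion {A : Set} (xs : List A) (e : Fin (length xs)) : Set where
  field
    ρ      : Fin (length (removeAt xs e)) → Fin (length xs)
    ρ-inj  : ∀ {i j} → ρ i ≡ ρ j → i ≡ j
    ρ-miss : ∀ i → ρ i ≢ e
    ρ-onto : ∀ j → j ≢ e → ∃ λ i → ρ i ≡ j
    ρ-at   : ∀ i → lookup (removeAt xs e) i ≡ lookup xs (ρ i)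

deletion : ∀ {A : Set} (xs : List A) e → Deletion xs e
deletion (x ∷ xs) zero = record
  { ρ = suc ; ρ-inj = suc-injective ; ρ-miss = λ _ () ; ρ-at = λ _ → refl
  ; ρ-onto = λ { zero h → contradiction refl h ; (suc j) _ → j , refl } }
deletion (x ∷ xs) (suc e) = record
  { ρ = λ { zero → zero ; (suc i) → suc (ρ i) }
  ; ρ-inj = λ { {zero} {zero} _ → refl ; {suc i} {suc j} h → cong suc (ρ-inj (suc-injective h)) }
  ; ρ-miss = λ { (suc i) h → ρ-miss i (suc-injective h) }
  ; ρ-onto = λ { zero _ → zero , refl ; (suc j) h → let i , eq = ρ-onto j (h ∘ cong suc) in suc i , cong suc eq }
  ; ρ-at = λ { zero → refl ; (suc i) → ρ-at i } }
  where open Deletion (deletion xs e)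

module Deleted (G : Graph) (e : Edge G) where

  open Deletion (deletion (edges G) e)

  G′ : Graph
  G′ = deleteEdge G e

  in⇒ : ∀ {i v} → In G′ i v → In G (ρ i) v
  in⇒ {i} (at-src h) = at-src (≡-trans (cong proj₁ (sym (ρ-at i))) h)
  in⇒ {i} (at-tgt h) = at-tgt (≡-trans (cong proj₂ (sym (ρ-at i))) h)

  in⇐ : ∀ {i v} → In G (ρ i) v → In G′ i v
  in⇐ {i} (at-src h) = at-src (≡-trans (cong proj₁ (ρ-at i)) h)
  in⇐ {i} (at-tgt h) = at-tgt (≡-trans (cong proj₂ (ρ-at i)) h)

  joins⇐ : ∀ {f u v} → f ≢ e → Joins G f u v → Adj G′ u v
  joins⇐ {f} f≢e j with ρ-onto f f≢e
  joins⇐ f≢e (fwd h k) | i , refl =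
    joins⇒adj G′ i (fwd (≡-trans (cong proj₁ (ρ-at i)) h) (≡-trans (cong proj₂ (ρ-at i)) k))
  joins⇐ f≢e (bwd h k) | i , refl =
    joins⇒adj G′ i (bwd (≡-trans (cong proj₁ (ρ-at i)) h) (≡-trans (cong proj₂ (ρ-at i)) k))

  removable⇒avoidable : Covered G′ → ∀ f → f ≢ e → Avoid G f e
  removable⇒avoidable cov f f≢e with ρ-onto f f≢e
  ... | k , refl with Covered.through cov k
  ... | M , pm , Mk = mkAvoid N-pm (⌊⌋-intro (N? (ρ k)) (k , refl , Mk))
                        (⌊⌋-reject (N? e) λ (i , eq , _) → ρ-miss i eq)
    where
    N? : ∀ x → Dec (∃ λ i → ρ i ≡ x × M i ≡ true)
    N? x = any? λ i → (ρ i ≟ x) ×-dec (M i ≟ᵇ true)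
    N-pm : PM G (λ x → ⌊ N? x ⌋)
    N-pm .PM.matched v with PM.matched pm v
    ... | i , (Mi , i-in) , uniq = ρ i , (⌊⌋-intro (N? (ρ i)) (i , refl , Mi) , in⇒ i-in) , λ y (Ny , y-in) →
      case ⌊⌋-true {d = N? y} Ny of λ { (j , refl , Mj) → cong ρ (uniq j (Mj , in⇐ y-in)) }

  avoidable⇒through : (∀ f → f ≢ e → Avoid G f e) → ∀ i → ∃ λ M → PM G′ M × M i ≡ true
  avoidable⇒through av i with av (ρ i) (ρ-miss i)
  ... | mkAvoid {M} pm Mi Me = M ∘ ρ , M-pm , Mi
    where
    M-pm : PM G′ (M ∘ ρ)
    M-pm .PM.matched v with PM.matched pm v
    ... | x , (Mx , x-in) , uniq with ρ-onto x (λ { refl → true≢false Mx Me })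
    ...   | k , refl = k , (Mx , in⇐ x-in) , λ l (Ml , l-in) → ρ-inj (uniq (ρ l) (Ml , in⇒ l-in))

  detour⇒connected : ∀ {v m x} → Joins G e v x → Adj G′ v m → Adj G′ m x → Connected G → Connected G′
  detour⇒connected {v} {m} {x} je vm mx con u w = walk (con u w)
    where
    adj-sym : ∀ {a b} → Adj G′ a b → Adj G′ b a
    adj-sym (inj₁ h) = inj₂ h
    adj-sym (inj₂ h) = inj₁ h
    walk : ∀ {u w} → Reach G u w → Reach G′ u w
    walk here = here
    walk (step a r) with adj⇒joins G a
    ... | f , j with f ≟ e
    ...   | no f≢e = step (joins⇐ f≢e j) (walk r)
    ...   | yes refl with joins-ends je (joins-inˡ j)
    ...     | inj₁ refl with joins-unique je j
    ...       | refl = step vm (step mx (walk r))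
    walk (step a r) | f , j | yes refl | inj₂ refl with joins-unique (joins-sym je) j
    ...       | refl = step (adj-sym mx) (step (adj-sym vm) (walk r))

simple⇒nonparallel : ∀ {G e} → Simple G → ∀ f → ¬ Parallel G e f
simple⇒nonparallel {G} {e} simple f (mkParallel f≢e j) = f≢e (simple-unique simple j (ends-joins G e))

removable⇒strictly : ∀ {G e} → Simple G → Removable G e → StrictlyRemovable G e
removable⇒strictly {G} {e} simple r =
  mkSR (Deleted.removable⇒avoidable G e (mc⇒covered r)) (simple⇒nonparallel simple)

-- For the connectedness of G - e: `e` is not the stem at its source, hence lies in a triangle
-- there, and the other two edges of the triangle bypass it.
strictly⇒removable : ∀ {G e} → Simple G → Cornered G → Covered G → StrictlyRemovable G e → Removable G e
strictly⇒removable {G} {e} simple cg cov sr@(mkSR av _) = covered⇒mc (record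
  { connected = connected′ ; two≤ = Covered.two≤ cov ; through = avoidable⇒through av })
  where
  open Deleted G e
  open Cornered cg
  connected′ : Connected G′
  connected′ with corner (src G e)
  ... | mkCorner {s} {p} {q} st jp jq close with Star.cover st e (at-src refl) | close
  ... | inj₁ refl | _ = ⊥-elim (stem-not-removable cg st jp jq close sr)
  ... | _ | inj₁ refl = contradiction (simple-unique simple jp jq) (Star.b≢c st)
  ... | inj₂ (inj₁ refl) | inj₂ (r , jr) =
    detour⇒connected jp (joins⇐ (≢-sym (Star.b≢c st)) jq) (joins⇐ r≢ (joins-sym jr)) (Covered.connected cov)
    where r≢ : r ≢ p
          r≢ refl = [ joins-irrefl loopless jp , joins-irrefl loopless jq ]′ (joins-ends jr (joins-inˡ jp))
  ... | inj₂ (inj₂ refl) | inj₂ (r , jr) =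
    detour⇒connected jq (joins⇐ (Star.b≢c st) jp) (joins⇐ r≢ jr) (Covered.connected cov)
    where r≢ : r ≢ q
          r≢ refl = [ joins-irrefl loopless jp , joins-irrefl loopless jq ]′ (joins-ends jr (joins-inˡ jq))

removable⇔ : ∀ {G} → Simple G → Cornered G → Covered G → ∀ e → (removableᵇ G e ≡ true) ⇔ Removable G e
removable⇔ simple cg cov e = mk⇔ (λ h → strictly⇒removable simple cg cov (removableᵇ⇒ h))
                                 (λ r → ⇒removableᵇ (removable⇒strictly simple r))

REcount-weight : ∀ {G} → Simple G → Cornered G → Covered G → REcount G (weight G)
REcount-weight {G} simple cg cov = removableᵇ G , refl , removable⇔ simple cg cov

REcount-unique : ∀ {G k} → Simple G → Cornered G → Covered G → REcount G k → k ≡ weight G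
REcount-unique {G} simple cg cov (S , refl , S⇔) = count-cong λ e → bool-ext
  (λ h → Equivalence.from (removable⇔ simple cg cov e) (Equivalence.to (S⇔ e) h))
  (λ h → Equivalence.from (S⇔ e) (Equivalence.to (removable⇔ simple cg cov e) h))

-- Bipartite graphs, K₄ and the prism have weight zero

weight-zero : ∀ {G} → (∀ e → ¬ StrictlyRemovable G e) → weight G ≡ 0
weight-zero h = count-none λ e r → h e (removableᵇ⇒ r)

-- There is no triangle, so every corner is a digon: its two ribs are parallel, and its stem is not
-- removable.
bipartite⇒0 : ∀ {G} → Cornered G → Bipartite G → weight G ≡ 0
bipartite⇒0 {G} cg (col , proper) = weight-zero none
  where
  open Cornered cg
  bichrome : ∀ {e u v} → Joins G e u v → col u ≢ col v
  bichrome {e} (fwd refl refl) = proper e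
  bichrome {e} (bwd refl refl) = ≢-sym (proper e)
  two-colours : ∀ {a b c : Bool} → a ≢ b → a ≢ c → b ≢ c → ⊥
  two-colours {true}  {true}          h _ _ = h refl
  two-colours {false} {false}         h _ _ = h refl
  two-colours {true}  {false} {true}  _ h _ = h refl
  two-colours {true}  {false} {false} _ _ h = h refl
  two-colours {false} {true}  {true}  _ _ h = h refl
  two-colours {false} {true}  {false} _ h _ = h refl
  none : ∀ e → ¬ StrictlyRemovable G e
  none e sr with corner (src G e)
  ... | mkCorner st jp jq (inj₂ (r , jr)) = two-colours (bichrome jp) (bichrome jq) (bichrome jr)
  ... | mkCorner st jp jq (inj₁ refl) with Star.cover st e (at-src refl)
  ... | inj₁ refl        = stem-not-removable cg st jp jq (inj₁ refl) sr
  ... | inj₂ (inj₁ refl) = StrictlyRemovable.nonparallel sr _ (parallel-of jp jq (≢-sym (Star.b≢c st)))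
  ... | inj₂ (inj₂ refl) = StrictlyRemovable.nonparallel sr _ (parallel-of jq jp (Star.b≢c st))

module Forcing {G : Graph} (loopless : Loopless G) where

  -- In a perfect matching through f = ab, the vertex u can only be matched to v.
  forced₁ : ∀ {e f u v a b} → Joins G e u v → Joins G f a b → a ≢ u → b ≢ u →
            (∀ {z} → Nbr G u z → z ≡ v ⊎ z ≡ a ⊎ z ≡ b) → ¬ StrictlyRemovable G e
  forced₁ {e} {f} {u} je jf a≢u b≢u near (mkSR av np) with av f f≢e
    where f≢e : f ≢ e
          f≢e refl = [ a≢u ∘ sym , b≢u ∘ sym ]′ (joins-ends jf (joins-inˡ je))
  ... | mkAvoid {M} pm Mf Me with PM.matched pm u
  ... | h , (Mh , h-in) , _ with in⇒joins h-in
  ... | z , jh with near (h , jh)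
  ... | inj₁ refl with h ≟ e
  ...   | yes refl = true≢false Mh Me
  ...   | no h≢e   = np h (parallel-of je jh h≢e)
  forced₁ je jf a≢u b≢u near (mkSR av np) | mkAvoid pm Mf Me | h , (Mh , h-in) , _ | z , jh | inj₂ (inj₁ refl)
    with PM-unique pm Mh (joins-inʳ jh) Mf (joins-inˡ jf)
  ... | refl = [ a≢u ∘ sym , b≢u ∘ sym ]′ (joins-ends jf h-in)
  forced₁ je jf a≢u b≢u near (mkSR av np) | mkAvoid pm Mf Me | h , (Mh , h-in) , _ | z , jh | inj₂ (inj₂ refl)
    with PM-unique pm Mh (joins-inʳ jh) Mf (joins-inʳ jf)
  ... | refl = [ a≢u ∘ sym , b≢u ∘ sym ]′ (joins-ends jf h-in)

  -- Otherwise both u and v would have to be matched to t.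
  forced₂ : ∀ {e f u v a b t} → Joins G e u v → Joins G f a b → a ≢ u → b ≢ u → a ≢ v → b ≢ v →
            (∀ {z} → Nbr G u z → z ≡ v ⊎ z ≡ t ⊎ z ≡ a ⊎ z ≡ b) →
            (∀ {z} → Nbr G v z → z ≡ u ⊎ z ≡ t ⊎ z ≡ a ⊎ z ≡ b) → ¬ StrictlyRemovable G e
  forced₂ {e} {f} {u} {v} {a} {b} {t} je jf a≢u b≢u a≢v b≢v near near′ (mkSR av np) with av f f≢e
    where f≢e : f ≢ e
          f≢e refl = [ a≢u ∘ sym , b≢u ∘ sym ]′ (joins-ends jf (joins-inˡ je))
  ... | mkAvoid {M} pm Mf Me = clash (mate je a≢u b≢u near) (mate (joins-sym je) a≢v b≢v near′)
    where
    mate : ∀ {u v} → Joins G e u v → a ≢ u → b ≢ u → (∀ {z} → Nbr G u z → z ≡ v ⊎ z ≡ t ⊎ z ≡ a ⊎ z ≡ b) →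
           ∃ λ h → M h ≡ true × Joins G h u t
    mate {u} je a≢u b≢u near with PM.matched pm u
    ... | h , (Mh , h-in) , _ with in⇒joins h-in
    ... | z , jh with near (h , jh)
    ... | inj₂ (inj₁ refl) = h , Mh , jh
    ... | inj₁ refl with h ≟ e
    ...   | yes refl = ⊥-elim (true≢false Mh Me)
    ...   | no h≢e   = ⊥-elim (np h (parallel-of je jh h≢e))
    mate je a≢u b≢u near | h , (Mh , h-in) , _ | z , jh | inj₂ (inj₂ (inj₁ refl))
      with PM-unique pm Mh (joins-inʳ jh) Mf (joins-inˡ jf)
    ... | refl = ⊥-elim ([ a≢u ∘ sym , b≢u ∘ sym ]′ (joins-ends jf h-in))
    mate je a≢u b≢u near | h , (Mh , h-in) , _ | z , jh | inj₂ (inj₂ (inj₂ refl))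
      with PM-unique pm Mh (joins-inʳ jh) Mf (joins-inʳ jf)
    ... | refl = ⊥-elim ([ a≢u ∘ sym , b≢u ∘ sym ]′ (joins-ends jf h-in))
    clash : (∃ λ h → M h ≡ true × Joins G h u t) → (∃ λ h → M h ≡ true × Joins G h v t) → ⊥
    clash (h , Mh , jh) (h′ , Mh′ , jh′) with PM-unique pm Mh (joins-inʳ jh) Mh′ (joins-inʳ jh′)
    ... | refl = [ joins-irrefl loopless je ∘ sym , joins-irrefl loopless jh′ ]′ (joins-ends jh (joins-inˡ jh′))

module Iso {G : Graph} (loopless : Loopless G) {k : ℕ} {A : Fin k → Fin k → Set} (iso : UnderlyingIso G k A) where

  open Inverse (proj₁ iso) using (to; from; inverseˡ; inverseʳ)

  to-from : ∀ i → to (from i) ≡ i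
  to-from i = inverseˡ refl

  from-to : ∀ v → from (to v) ≡ v
  from-to v = inverseʳ refl

  to≡⇒ : ∀ {v i} → to v ≡ i → v ≡ from i
  to≡⇒ refl = sym (from-to _)

  from≢ : ∀ {v i} → i ≢ to v → from i ≢ v
  from≢ h refl = h (sym (to-from _))

  nbr⇒ : ∀ {u v} → Nbr G u v → A (to u) (to v)
  nbr⇒ {u} {v} (e , j) = Equivalence.to (proj₂ iso u v) (joins-irrefl loopless j , joins⇒adj G e j)

  ⇒nbr : ∀ {i j} → A i j → Nbr G (from i) (from j)
  ⇒nbr {i} {j} h = adj⇒joins G (proj₂ (Equivalence.from (proj₂ iso (from i) (from j))
    (subst₂ A (sym (to-from i)) (sym (to-from j)) h)))

opaque
  k4-others : ∀ (i j : Fin 4) → i ≢ j → ∃₂ λ k l → k ≢ l × k ≢ i × l ≢ i × (∀ z → z ≡ i ⊎ z ≡ j ⊎ z ≡ k ⊎ z ≡ l)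
  k4-others = toWitness {a? = all? λ i → all? λ j → ¬? (i ≟ j) →-dec any? λ k → any? λ l →
    ¬? (k ≟ l) ×-dec (¬? (k ≟ i) ×-dec (¬? (l ≟ i) ×-dec
      all? λ z → (z ≟ i) ⊎-dec ((z ≟ j) ⊎-dec ((z ≟ k) ⊎-dec (z ≟ l)))))} _

k4⇒0 : ∀ {G} → Loopless G → IsK4 G → weight G ≡ 0
k4⇒0 {G} loopless iso = weight-zero none
  where
  open Iso {G} loopless {A = K4Adj} iso
  open Inverse (proj₁ iso) using (to; from)
  none : ∀ e → ¬ StrictlyRemovable G e
  none e with k4-others (to (src G e)) (to (tgt G e)) (nbr⇒ (e , ends-joins G e))
  ... | k , l , k≢l , k≢i , l≢i , all = Forcing.forced₁ {G} loopless (ends-joins G e) (proj₂ (⇒nbr k≢l)) (from≢ k≢i) (from≢ l≢i)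
    λ {z} nb → case all (to z) of λ
      { (inj₁ eq) → contradiction (sym eq) (nbr⇒ nb)
      ; (inj₂ (inj₁ eq)) → inj₁ (≡-trans (to≡⇒ eq) (from-to _))
      ; (inj₂ (inj₂ (inj₁ eq))) → inj₂ (inj₁ (to≡⇒ eq))
      ; (inj₂ (inj₂ (inj₂ eq))) → inj₂ (inj₂ (to≡⇒ eq)) }

c6barAdj? : ∀ i j → Dec (C6barAdj i j)
c6barAdj? i j = ¬? (i ≟ j) ×-dec ¬? ((toℕ j ℕ.≟ (toℕ i + 1) % 6) ⊎-dec (toℕ i ℕ.≟ (toℕ j + 1) % 6))

-- The hypotheses under which the edge kl forces the edge ij: the first alternative is that of
-- `forced₁`, the second that of `forced₂` with `t` as the remaining common neighbour.
Prismatic : Fin 6 → Fin 6 → Fin 6 → Fin 6 → Fin 6 → Set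
Prismatic i j k l t = C6barAdj k l × (k ≢ i × l ≢ i) ×
  ((∀ z → C6barAdj i z → z ≡ j ⊎ z ≡ k ⊎ z ≡ l) ⊎
   ((k ≢ j × l ≢ j) × (∀ z → C6barAdj i z → z ≡ j ⊎ z ≡ t ⊎ z ≡ k ⊎ z ≡ l)
                    × (∀ z → C6barAdj j z → z ≡ i ⊎ z ≡ t ⊎ z ≡ k ⊎ z ≡ l)))

prismatic? : ∀ i j k l t → Dec (Prismatic i j k l t)
prismatic? i j k l t = c6barAdj? k l ×-dec ((¬? (k ≟ i) ×-dec ¬? (l ≟ i)) ×-dec
  ((all? λ z → c6barAdj? i z →-dec ((z ≟ j) ⊎-dec ((z ≟ k) ⊎-dec (z ≟ l)))) ⊎-dec
   ((¬? (k ≟ j) ×-dec ¬? (l ≟ j)) ×-dec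
    ((all? λ z → c6barAdj? i z →-dec ((z ≟ j) ⊎-dec ((z ≟ t) ⊎-dec ((z ≟ k) ⊎-dec (z ≟ l))))) ×-dec
     (all? λ z → c6barAdj? j z →-dec ((z ≟ i) ⊎-dec ((z ≟ t) ⊎-dec ((z ≟ k) ⊎-dec (z ≟ l)))))))))

-- In the complement of the 6-cycle, i is joined to i + 3 by a rung and to i + 2 and i + 4 within
-- its triangle.
shift : ℕ → Fin 6 → Fin 6
shift d i = (toℕ i + d) mod 6

-- A rung is forced by an edge of a triangle at one of its ends, a triangle edge by the parallel
-- edge of the other triangle.
opaque
  prismatic : ∀ i j → C6barAdj i j → ∃ λ t → Prismatic i j (shift 2 i) (shift 4 i) t ⊎ Prismatic i j (shift 3 i) (shift 3 j) t
  prismatic = toWitness {a? = all? λ i → all? λ j → c6barAdj? i j →-dec any? λ t →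
    prismatic? i j (shift 2 i) (shift 4 i) t ⊎-dec prismatic? i j (shift 3 i) (shift 3 j) t} _

c6bar⇒0 : ∀ {G} → Loopless G → IsC6bar G → weight G ≡ 0
c6bar⇒0 {G} loopless iso = weight-zero none
  where
  open Iso {G} loopless {A = C6barAdj} iso
  open Inverse (proj₁ iso) using (to; from)
  open Forcing {G} loopless
  none : ∀ e → ¬ StrictlyRemovable G e
  none e with prismatic (to (src G e)) (to (tgt G e)) (nbr⇒ (e , ends-joins G e))
  ... | t , h = [ forced , forced ]′ h
    where
    forced : ∀ {k l} → Prismatic (to (src G e)) (to (tgt G e)) k l t → ¬ StrictlyRemovable G e
    forced (kl , (k≢i , l≢i) , inj₁ near) =
      forced₁ (ends-joins G e) (proj₂ (⇒nbr kl)) (from≢ k≢i) (from≢ l≢i) λ {z} nb → case near (to z) (nbr⇒ nb) of λ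
        { (inj₁ eq) → inj₁ (≡-trans (to≡⇒ eq) (from-to _))
        ; (inj₂ (inj₁ eq)) → inj₂ (inj₁ (to≡⇒ eq))
        ; (inj₂ (inj₂ eq)) → inj₂ (inj₂ (to≡⇒ eq)) }
    forced {k} {l} (kl , (k≢i , l≢i) , inj₂ ((k≢j , l≢j) , near , near′)) =
      forced₂ (ends-joins G e) (proj₂ (⇒nbr kl)) (from≢ k≢i) (from≢ l≢i) (from≢ k≢j) (from≢ l≢j)
        (λ {z} nb → options (near (to z) (nbr⇒ nb))) (λ {z} nb → options (near′ (to z) (nbr⇒ nb)))
      where
      options : ∀ {z w} → to z ≡ to w ⊎ to z ≡ t ⊎ to z ≡ k ⊎ to z ≡ l → z ≡ w ⊎ z ≡ from t ⊎ z ≡ from k ⊎ z ≡ from l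
      options (inj₁ eq)               = inj₁ (≡-trans (to≡⇒ eq) (from-to _))
      options (inj₂ (inj₁ eq))        = inj₂ (inj₁ (to≡⇒ eq))
      options (inj₂ (inj₂ (inj₁ eq))) = inj₂ (inj₂ (inj₁ (to≡⇒ eq)))
      options (inj₂ (inj₂ (inj₂ eq))) = inj₂ (inj₂ (inj₂ (to≡⇒ eq)))

-- Small configurations in graphs without nontrivial tight cuts

enumeration⇒iso : ∀ {G k} {A : Fin k → Fin k → Set} → Loopless G → (g : Fin k → V G) →
                  (∀ {i j} → g i ≡ g j → i ≡ j) → (∀ v → ∃ λ i → g i ≡ v) →
                  (∀ i j → Nbr G (g i) (g j) → A i j) → (∀ i j → A i j → Nbr G (g i) (g j)) → UnderlyingIso G k A
enumeration⇒iso {G} {k} {A} loopless g g-inj g-onto adj⇒ ⇒adj =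
  mk↔ₛ′ to g (λ i → g-inj (proj₂ (g-onto (g i)))) (λ v → proj₂ (g-onto v)) , λ u v → mk⇔ (fwd′ u v) (bwd′ u v)
  where
  to : V G → Fin k
  to v = proj₁ (g-onto v)
  g-to : ∀ v → g (to v) ≡ v
  g-to v = proj₂ (g-onto v)
  fwd′ : ∀ u v → u ≢ v × Adj G u v → A (to u) (to v)
  fwd′ u v (_ , a) = adj⇒ (to u) (to v) (subst₂ (Nbr G) (sym (g-to u)) (sym (g-to v)) (adj⇒joins G a))
  bwd′ : ∀ u v → A (to u) (to v) → u ≢ v × Adj G u v
  bwd′ u v h with subst₂ (Nbr G) (g-to u) (g-to v) (⇒adj (to u) (to v) h)
  ... | e , j = joins-irrefl loopless j , joins⇒adj G e j

NoNTC : Graph → Set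
NoNTC G = ∀ X {u u′ w w′} → u ≢ u′ → X u ≡ true → X u′ ≡ true → w ≢ w′ → X w ≡ false → X w′ ≡ false →
          (∀ {M} → PM G M → OneCross G X M) → ⊥

brick⇒NoNTC : ∀ {G} → NoNontrivialTightCut G → NoNTC G
brick⇒NoNTC none X u≢u′ Xu Xu′ w≢w′ Xw Xw′ t =
  none X ((distinct⇒two≤ u≢u′ Xu Xu′ , distinct⇒two≤ w≢w′ (not-false Xw) (not-false Xw′)) , ⇒tight t)

star-through : ∀ {G v a b c t} → Star G v a b c → In G t v → ∃₂ λ p q → Star G v t p q
star-through st t-in with Star.cover st _ t-in
... | inj₁ refl        = _ , _ , st
... | inj₂ (inj₁ refl) = _ , _ , rotate st
... | inj₂ (inj₂ refl) = _ , _ , rotate (rotate st)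

memb : ∀ {m} → Fin m → Fin m → Fin m → Fin m → Bool
memb a b c u = ⌊ (u ≟ a) ⊎-dec ((u ≟ b) ⊎-dec (u ≟ c)) ⌋

module _ {m} {a b c u : Fin m} where

  memb⇒ : memb a b c u ≡ true → u ≡ a ⊎ u ≡ b ⊎ u ≡ c
  memb⇒ = ⌊⌋-true

  ⇒memb : u ≡ a ⊎ u ≡ b ⊎ u ≡ c → memb a b c u ≡ true
  ⇒memb = ⌊⌋-intro ((u ≟ a) ⊎-dec ((u ≟ b) ⊎-dec (u ≟ c)))

  ¬memb : u ≢ a → u ≢ b → u ≢ c → memb a b c u ≡ false
  ¬memb h₁ h₂ h₃ = ⌊⌋-reject ((u ≟ a) ⊎-dec ((u ≟ b) ⊎-dec (u ≟ c))) [ h₁ , [ h₂ , h₃ ]′ ]′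

cut-oriented : ∀ {G X e} → Cut G X e → ∃₂ λ u w → Joins G e u w × X u ≡ true × X w ≡ false
cut-oriented {G} {X} {e} ce with X (src G e) in eq | X (tgt G e) in eq′ | cut⇒≢ ce (ends-joins G e)
... | true  | false | _ = _ , _ , ends-joins G e , eq , eq′
... | false | true  | _ = _ , _ , joins-sym (ends-joins G e) , eq′ , eq

module Prime (G : Graph) (cg : Cornered G) (cov : Covered G) (prime : NoNTC G) where

  open Cornered cg
  open Covered cov
  open Local G loopless cov
  open Units G cg cov

  theta⇒bipartite : ∀ {v x} → (∀ u → u ≡ v ⊎ u ≡ x) → Bipartite G
  theta⇒bipartite {v} {x} all = (λ u → ⌊ u ≟ v ⌋) , λ e eq → loopless e (same eq)
    where
    same : ∀ {a b} → ⌊ a ≟ v ⌋ ≡ ⌊ b ≟ v ⌋ → a ≡ b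
    same {a} {b} eq with a ≟ v | b ≟ v | all a | all b
    ... | yes refl | yes refl | _         | _         = refl
    ... | no h     | _        | inj₁ k    | _         = contradiction k h
    ... | no _     | no h     | inj₂ _    | inj₁ k    = contradiction k h
    ... | no _     | no _     | inj₂ refl | inj₂ refl = refl
    same {a} {b} () | yes _ | no _ | _ | _
    same {a} {b} () | no _ | yes _ | _ | _

  small⇒K4 : ∀ {v x y w} (t : Tri G v x y) → Tri.w t ≡ w → Tri.wx t ≡ w → Tri.wy t ≡ w →
             (∀ u → u ≡ v ⊎ u ≡ x ⊎ u ≡ y ⊎ u ≡ w) → IsK4 G
  small⇒K4 {v} {x} {y} {w} t@(mkTri hv hx hy) refl refl refl all =
    enumeration⇒iso loopless g g-inj g-onto (λ { i j (e , k) refl → irrefl k refl }) g-adj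
    where
    g : Fin 4 → V G
    g zero                   = v
    g (suc zero)             = x
    g (suc (suc zero))       = y
    g (suc (suc (suc zero))) = w
    g-onto : ∀ u → ∃ λ i → g i ≡ u
    g-onto u with all u
    ... | inj₁ refl               = zero , refl
    ... | inj₂ (inj₁ refl)        = suc zero , refl
    ... | inj₂ (inj₂ (inj₁ refl)) = suc (suc zero) , refl
    ... | inj₂ (inj₂ (inj₂ refl)) = suc (suc (suc zero)) , refl
    back : ∀ {u z} → Nbr G u z → Nbr G z u
    back (e , j) = e , joins-sym j
    g-adj : ∀ i j → i ≢ j → Nbr G (g i) (g j)
    g-adj zero zero h = contradiction refl h
    g-adj zero (suc zero) _ = _ , Hub.jp hv
    g-adj zero (suc (suc zero)) _ = _ , Hub.jq hv
    g-adj zero (suc (suc (suc zero))) _ = _ , Hub.js hv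
    g-adj (suc zero) zero _ = _ , Hub.jp hx
    g-adj (suc zero) (suc zero) h = contradiction refl h
    g-adj (suc zero) (suc (suc zero)) _ = _ , Hub.jq hx
    g-adj (suc zero) (suc (suc (suc zero))) _ = _ , Hub.js hx
    g-adj (suc (suc zero)) zero _ = _ , Hub.jp hy
    g-adj (suc (suc zero)) (suc zero) _ = _ , Hub.jq hy
    g-adj (suc (suc zero)) (suc (suc zero)) h = contradiction refl h
    g-adj (suc (suc zero)) (suc (suc (suc zero))) _ = _ , Hub.js hy
    g-adj (suc (suc (suc zero))) zero _ = back (_ , Hub.js hv)
    g-adj (suc (suc (suc zero))) (suc zero) _ = back (_ , Hub.js hx)
    g-adj (suc (suc (suc zero))) (suc (suc zero)) _ = back (_ , Hub.js hy)
    g-adj (suc (suc (suc zero))) (suc (suc (suc zero))) h = contradiction refl h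
    g-inj : ∀ {i j} → g i ≡ g j → i ≡ j
    g-inj {i} {j} eq with i ≟ j
    ... | yes h = h
    ... | no h  = contradiction eq (irrefl (proj₂ (g-adj i j h)))

  -- The stems `s` and `t` of the digon agree in every perfect matching. Hence the cut of {v, x,
  -- w′}, which is the star of `w′` with `t` replaced by `s`, is tight. Being trivial, it has only
  -- `w` outside, and v, w′ against x, w is a 2-colouring.
  digon⇒bipartite : ∀ {v x} → Digon G v x → Bipartite G
  digon⇒bipartite {v} {x} D@(mkDigon {s} {t} {p} {q} {w} {w′} hv hx w≢x)
    with star-through (proj₂ (proj₂ (proj₂ (star-at w′)))) (joins-inʳ (Hub.js hx))
  ... | a , b , st with any? (λ z → ¬? (z ≟ w) ×-dec (memb v x w′ z ≟ᵇ false))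
  ... | yes (z , z≢w , Xz) = ⊥-elim (prime X (irrefl (Hub.jp hv)) (⇒memb (inj₁ refl)) (⇒memb (inj₂ (inj₁ refl)))
                               z≢w Xz w-out cross)
    where
    X : V G → Bool
    X = memb v x w′
    w≢w′ : w ≢ w′
    w≢w′ = digon-w≢w′ D
    w′≢v : w′ ≢ v
    w′≢v = Digon.w≢x (digon-flip D)
    w-out : X w ≡ false
    w-out = ¬memb (≢-sym (irrefl (Hub.js hv))) w≢x w≢w′
    cut-s : Cut G X s
    cut-s = ≢⇒cut (⇒memb (inj₁ refl)) w-out (Hub.js hv)
    cut-third : ∀ {e} → In G e w′ → t ≢ e → Cut G X e
    cut-third {e} e-in t≢e with in⇒joins e-in
    ... | z , j = ≢⇒cut (⇒memb (inj₂ (inj₂ refl))) (¬memb z≢v z≢x (≢-sym (irrefl j))) j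
      where
      z≢v : z ≢ v
      z≢v refl with hub-nbr hv (_ , joins-sym j)
      ... | inj₁ eq        = w≢w′ (sym eq)
      ... | inj₂ (inj₁ eq) = irrefl (Hub.js hx) (sym eq)
      ... | inj₂ (inj₂ eq) = irrefl (Hub.js hx) (sym eq)
      z≢x : z ≢ x
      z≢x refl with hub-edge hx (joins-sym j)
      ... | inj₁ (eq , _)        = t≢e (sym eq)
      ... | inj₂ (inj₁ (_ , eq)) = w′≢v eq
      ... | inj₂ (inj₂ (_ , eq)) = w′≢v eq
    only : ∀ e → Cut G X e → e ≡ s ⊎ e ≡ a ⊎ e ≡ b
    only e ce with cut-oriented ce
    ... | u , z , j , Xu , Xz with memb⇒ Xu
    ... | inj₁ refl with hub-edge hv j
    ...   | inj₁ (eq , _)          = inj₁ eq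
    ...   | inj₂ (inj₁ (_ , refl)) = ⊥-elim (true≢false (⇒memb (inj₂ (inj₁ refl))) Xz)
    ...   | inj₂ (inj₂ (_ , refl)) = ⊥-elim (true≢false (⇒memb (inj₂ (inj₁ refl))) Xz)
    only e ce | u , z , j , Xu , Xz | inj₂ (inj₁ refl) with hub-edge hx j
    ...   | inj₁ (_ , refl)        = ⊥-elim (true≢false (⇒memb (inj₂ (inj₂ refl))) Xz)
    ...   | inj₂ (inj₁ (_ , refl)) = ⊥-elim (true≢false (⇒memb (inj₁ refl)) Xz)
    ...   | inj₂ (inj₂ (_ , refl)) = ⊥-elim (true≢false (⇒memb (inj₁ refl)) Xz)
    only e ce | u , z , j , Xu , Xz | inj₂ (inj₂ refl) with Star.cover st e (joins-inˡ j)
    ...   | inj₂ h = inj₂ h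
    ...   | inj₁ refl = ⊥-elim (true≢false (⇒memb (inj₂ (inj₁ (joins-unique j (joins-sym (Hub.js hx)))))) Xz)
    cross : ∀ {M} → PM G M → OneCross G X M
    cross {M} pm = one⇒unique-among {G} {M} {Cut G X} cut-s (cut-third (Star.b-in st) (Star.a≢b st)) (cut-third (Star.c-in st) (Star.a≢c st)) only
      (mp (mp (mp (tautology (λ { (s ∷ t ∷ p ∷ q ∷ a ∷ b ∷ []) → one s p q ⇒ one t p q ⇒ one t a b ⇒ one s a b }) refl
        (M s ∷ M t ∷ M p ∷ M q ∷ M a ∷ M b ∷ [])) (PM⇒one (Hub.star hv) pm)) (PM⇒one (Hub.star hx) pm)) (PM⇒one st pm))
  ... | no none = (λ u → ⌊ (u ≟ v) ⊎-dec (u ≟ w′) ⌋) , λ e → proper (ends-joins G e)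
    where
    col : V G → Bool
    col u = ⌊ (u ≟ v) ⊎-dec (u ≟ w′) ⌋
    black : ∀ {u} → u ≡ v ⊎ u ≡ w′ → col u ≡ true
    black {u} = ⌊⌋-intro ((u ≟ v) ⊎-dec (u ≟ w′))
    white : ∀ {u} → u ≡ x ⊎ u ≡ w → col u ≡ false
    white (inj₁ refl) = ⌊⌋-reject ((x ≟ v) ⊎-dec (x ≟ w′)) [ ≢-sym (irrefl (Hub.jp hv)) , irrefl (Hub.js hx) ]′
    white (inj₂ refl) = ⌊⌋-reject ((w ≟ v) ⊎-dec (w ≟ w′)) [ ≢-sym (irrefl (Hub.js hv)) , digon-w≢w′ D ]′
    every : ∀ u → (u ≡ v ⊎ u ≡ w′) ⊎ (u ≡ x ⊎ u ≡ w)
    every u with u ≟ w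
    ... | yes eq = inj₂ (inj₂ eq)
    ... | no u≢w with memb⇒ (¬false {memb v x w′ u} λ h → none (u , u≢w , h))
    ...   | inj₁ eq        = inj₁ (inj₁ eq)
    ...   | inj₂ (inj₁ eq) = inj₂ (inj₁ eq)
    ...   | inj₂ (inj₂ eq) = inj₁ (inj₂ eq)
    v-white : ∀ {e u} → Joins G e v u → col u ≡ false
    v-white j with hub-nbr hv (_ , j)
    ... | inj₁ eq        = white (inj₂ eq)
    ... | inj₂ (inj₁ eq) = white (inj₁ eq)
    ... | inj₂ (inj₂ eq) = white (inj₁ eq)
    x-black : ∀ {e u} → Joins G e x u → col u ≡ true
    x-black j with hub-nbr hx (_ , j)
    ... | inj₁ eq        = black (inj₂ eq)
    ... | inj₂ (inj₁ eq) = black (inj₁ eq)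
    ... | inj₂ (inj₂ eq) = black (inj₁ eq)
    proper : ∀ {e u z} → Joins G e u z → col u ≢ col z
    proper {u = u} {z} j eq with every u | every z
    ... | inj₁ (inj₁ refl) | _ = true≢false (≡-trans (sym eq) (black (inj₁ refl))) (v-white j)
    ... | _ | inj₁ (inj₁ refl) = true≢false (≡-trans eq (black (inj₁ refl))) (v-white (joins-sym j))
    ... | inj₂ (inj₁ refl) | _ = true≢false (≡-trans eq (x-black j)) (white (inj₁ refl))
    ... | _ | inj₂ (inj₁ refl) = true≢false (≡-trans (sym eq) (x-black (joins-sym j))) (white (inj₁ refl))
    ... | inj₁ h@(inj₂ refl) | inj₂ k@(inj₂ refl) = true≢false (≡-trans (sym eq) (black h)) (white k)
    ... | inj₂ h@(inj₂ refl) | inj₁ k@(inj₂ refl) = true≢false (≡-trans eq (black k)) (white h)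
    ... | inj₁ (inj₂ refl) | inj₁ (inj₂ refl) = irrefl j refl
    ... | inj₂ (inj₂ refl) | inj₂ (inj₂ refl) = irrefl j refl

  -- The stems `sa` and `sd` agree in every perfect matching, so the cut of {u, b, d}, consisting of
  -- `p`, `q` and `sd`, is crossed exactly as often as the star of `a`. Both `a` and the other end
  -- of `sa` lie outside.
  ¬diamond : ∀ {a u b d} → ¬ Diamond G a u b d
  ¬diamond {a} {u} {b} {d} D = prime X (irrefl (Hub.jq hub-u)) (⇒memb (inj₁ refl)) (⇒memb (inj₂ (inj₁ refl)))
    (irrefl (Hub.js hub-a)) a-out (¬memb wa≢u wa≢b wa≢d) cross
    where
    open Diamond D
    X : V G → Bool
    X = memb u b d
    a-out : X a ≡ false
    a-out = ¬memb (irrefl (Hub.jp hub-a)) (irrefl (Hub.jq hub-a)) a≢d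
    only : ∀ e → Cut G X e → e ≡ p ⊎ e ≡ q ⊎ e ≡ sd
    only e ce with cut-oriented ce
    ... | z , z′ , j , Xz , Xz′ with memb⇒ Xz
    ... | inj₁ refl with hub-edge hub-u j
    ...   | inj₁ (_ , refl)        = ⊥-elim (true≢false (⇒memb (inj₂ (inj₂ refl))) Xz′)
    ...   | inj₂ (inj₁ (eq , _))   = inj₁ eq
    ...   | inj₂ (inj₂ (_ , refl)) = ⊥-elim (true≢false (⇒memb (inj₂ (inj₁ refl))) Xz′)
    only e ce | z , z′ , j , Xz , Xz′ | inj₂ (inj₁ refl) with hub-edge hub-b j
    ...   | inj₁ (_ , refl)        = ⊥-elim (true≢false (⇒memb (inj₂ (inj₂ refl))) Xz′)
    ...   | inj₂ (inj₁ (eq , _))   = inj₂ (inj₁ eq)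
    ...   | inj₂ (inj₂ (_ , refl)) = ⊥-elim (true≢false (⇒memb (inj₁ refl)) Xz′)
    only e ce | z , z′ , j , Xz , Xz′ | inj₂ (inj₂ refl) with hub-edge hub-d j
    ...   | inj₁ (eq , _)          = inj₂ (inj₂ eq)
    ...   | inj₂ (inj₁ (_ , refl)) = ⊥-elim (true≢false (⇒memb (inj₁ refl)) Xz′)
    ...   | inj₂ (inj₂ (_ , refl)) = ⊥-elim (true≢false (⇒memb (inj₂ (inj₁ refl))) Xz′)
    cross : ∀ {M} → PM G M → OneCross G X M
    cross {M} pm = one⇒unique-among {G} {M} {Cut G X} (≢⇒cut (⇒memb (inj₁ refl)) a-out (Hub.jp hub-u)) (≢⇒cut (⇒memb (inj₂ (inj₁ refl))) a-out (Hub.jp hub-b))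
      (≢⇒cut (⇒memb (inj₂ (inj₂ refl))) (¬memb wd≢u wd≢b (≢-sym (irrefl (Hub.js hub-d)))) (Hub.js hub-d)) only
      (mp (mp (mp (mp (tautology (λ { (sa ∷ p ∷ q ∷ k ∷ p′ ∷ q′ ∷ sd ∷ []) →
          one sa p q ⇒ one p′ p k ⇒ one q′ q k ⇒ one sd p′ q′ ⇒ one p q sd }) refl
        (M sa ∷ M p ∷ M q ∷ M k ∷ M p′ ∷ M q′ ∷ M sd ∷ [])) (PM⇒one (Hub.star hub-a) pm)) (PM⇒one (Hub.star hub-u) pm))
        (PM⇒one (Hub.star hub-b) pm)) (PM⇒one (Hub.star hub-d) pm))

  all-clean : (∀ v → ∃₂ λ x y → Clean G v x y) ⊎ (Bipartite G ⊎ IsK4 G)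
  all-clean with decide-all sort
    where
    sort : ∀ v → (∃₂ λ x y → Clean G v x y) ⊎ (Bipartite G ⊎ IsK4 G)
    sort v with unit⊎small v
    ... | inj₁ (digon d)                    = inj₂ (inj₁ (digon⇒bipartite d))
    ... | inj₁ (clean c)                    = inj₁ (_ , _ , c)
    ... | inj₁ (tip D)                      = ⊥-elim (¬diamond D)
    ... | inj₁ (mid D)                      = ⊥-elim (¬diamond D)
    ... | inj₂ (theta all)                  = inj₂ (inj₁ (theta⇒bipartite all))
    ... | inj₂ (k4 t eq eq′ eq″ all)        = inj₂ (inj₂ (small⇒K4 t eq eq′ eq″ all))
  ... | inj₁ h       = inj₁ h
  ... | inj₂ (_ , h) = inj₂ h

-- Parity of cuts

⨁ : ∀ {m} → (Fin m → Bool) → Bool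
⨁ {zero}  f = false
⨁ {suc m} f = f zero xor ⨁ (f ∘ suc)

⨁-cong : ∀ {m} {f g : Fin m → Bool} → (∀ i → f i ≡ g i) → ⨁ f ≡ ⨁ g
⨁-cong {zero}  h = refl
⨁-cong {suc m} h = cong₂ _xor_ (h zero) (⨁-cong (h ∘ suc))

⨁-false : ∀ {m} {f : Fin m → Bool} → (∀ i → f i ≡ false) → ⨁ f ≡ false
⨁-false {zero}  h = refl
⨁-false {suc m} h = cong₂ _xor_ (h zero) (⨁-false (h ∘ suc))

⨁-xor : ∀ {m} (f g : Fin m → Bool) → ⨁ (λ i → f i xor g i) ≡ ⨁ f xor ⨁ g
⨁-xor {zero}  f g = refl
⨁-xor {suc m} f g = ≡-trans (cong ((f zero xor g zero) xor_) (⨁-xor (f ∘ suc) (g ∘ suc)))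
  (==-sound (tautology (λ { (a ∷ b ∷ c ∷ d ∷ []) → ((a xor b) xor (c xor d)) == ((a xor c) xor (b xor d)) }) refl
    (f zero ∷ g zero ∷ ⨁ (f ∘ suc) ∷ ⨁ (g ∘ suc) ∷ [])))

⨁-∧ : ∀ {m} a (f : Fin m → Bool) → ⨁ (λ i → a ∧ f i) ≡ a ∧ ⨁ f
⨁-∧ true  f = refl
⨁-∧ {m} false f = ⨁-false {m} λ _ → refl

⨁-swap : ∀ {m k} (f : Fin m → Fin k → Bool) → ⨁ (λ i → ⨁ (f i)) ≡ ⨁ (λ j → ⨁ (λ i → f i j))
⨁-swap {zero}  {k} f = sym (⨁-false {k} λ _ → refl)
⨁-swap {suc m} f = ≡-trans (cong (⨁ (f zero) xor_) (⨁-swap (f ∘ suc))) (sym (⨁-xor (f zero) (λ j → ⨁ (λ i → f (suc i) j))))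

⨁-single : ∀ {m} {f : Fin m → Bool} i → (∀ j → j ≢ i → f j ≡ false) → ⨁ f ≡ f i
⨁-single {suc m} {f} zero h = ≡-trans (cong (f zero xor_) (⨁-false λ j → h (suc j) λ ())) (xor-false (f zero))
  where xor-false : ∀ b → b xor false ≡ b
        xor-false true  = refl
        xor-false false = refl
⨁-single {suc m} {f} (suc i) h = ≡-trans (cong (_xor ⨁ (f ∘ suc)) (h zero λ ()))
  (⨁-single i λ j j≢i → h (suc j) (j≢i ∘ suc-injective))

⨁-unique : ∀ {m} {f : Fin m → Bool} → Unique (λ i → f i ≡ true) → ⨁ f ≡ true
⨁-unique (i , fi , uniq) = ≡-trans (⨁-single i λ j j≢i → ¬true (j≢i ∘ uniq j)) fi

-- Let every matching edge contribute its ends in `X`: modulo 2 only the cut edges remain, while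
-- every vertex of `X` is counted once.
cut-parity : ∀ {G M} (X : V G → Bool) → Loopless G → PM G M → ⨁ (λ e → M e ∧ inCutᵇ G X e) ≡ ⨁ X
cut-parity {G} {M} X loopless pm =
  ≡-trans (⨁-cong edge-sum) (≡-trans (⨁-swap (λ e v → M e ∧ (inc e v ∧ X v))) (⨁-cong vertex-sum))
  where
  -- Exclusive or, to make the sum over the ends linear; without loops this is ordinary incidence.
  inc : Edge G → V G → Bool
  inc e v = ⌊ src G e ≟ v ⌋ xor ⌊ tgt G e ≟ v ⌋
  select : ∀ u → X u ≡ ⨁ (λ v → ⌊ u ≟ v ⌋ ∧ X v)
  select u = sym (≡-trans (⨁-single u λ v v≢u → cong (_∧ X v) (⌊⌋-reject (u ≟ v) (≢-sym v≢u)))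
                          (cong (_∧ X u) (⌊⌋-intro (u ≟ u) refl)))
  edge-sum : ∀ e → M e ∧ inCutᵇ G X e ≡ ⨁ (λ v → M e ∧ (inc e v ∧ X v))
  edge-sum e = ≡-trans (cong (M e ∧_) (≡-trans (cong₂ _xor_ (select (src G e)) (select (tgt G e)))
      (≡-trans (sym (⨁-xor (λ v → ⌊ src G e ≟ v ⌋ ∧ X v) (λ v → ⌊ tgt G e ≟ v ⌋ ∧ X v)))
               (⨁-cong λ v → distrib ⌊ src G e ≟ v ⌋ ⌊ tgt G e ≟ v ⌋ (X v)))))
    (sym (⨁-∧ (M e) (λ v → inc e v ∧ X v)))
    where
    distrib : ∀ a b c → (a ∧ c) xor (b ∧ c) ≡ (a xor b) ∧ c
    distrib a b c = ==-sound (tautology (λ { (a ∷ b ∷ c ∷ []) → ((a ∧ c) xor (b ∧ c)) == ((a xor b) ∧ c) }) refl (a ∷ b ∷ c ∷ []))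
  inc⇒in : ∀ {e v} → inc e v ≡ true → In G e v
  inc⇒in {e} {v} h with src G e ≟ v | tgt G e ≟ v
  ... | yes k | _     = at-src k
  ... | no _  | yes k = at-tgt k
  in⇒inc : ∀ {e v} → In G e v → inc e v ≡ true
  in⇒inc {e} (at-src refl) = cong₂ _xor_ (⌊⌋-intro (src G e ≟ src G e) refl) (⌊⌋-reject (tgt G e ≟ src G e) (≢-sym (loopless e)))
  in⇒inc {e} (at-tgt refl) = cong₂ _xor_ (⌊⌋-reject (src G e ≟ tgt G e) (loopless e)) (⌊⌋-intro (tgt G e ≟ tgt G e) refl)
  vertex-sum : ∀ v → ⨁ (λ e → M e ∧ (inc e v ∧ X v)) ≡ X v
  vertex-sum v with PM.matched pm v
  ... | e , (Me , e-in) , uniq = ≡-trans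
    (⨁-single e λ f f≢e → ¬true λ h → f≢e (uniq f (proj₁ (∧-true h) , inc⇒in (proj₁ (∧-true {inc f v} (proj₂ (∧-true {M f} h)))))))
    (cong₂ (λ a b → a ∧ (b ∧ X v)) Me (in⇒inc e-in))

-- Graphs all of whose vertices lie in clean triangles

module Truncated (G : Graph) (cg : Cornered G) (cov : Covered G) (prime : NoNTC G)
                 (clean-at : ∀ v → ∃₂ λ x y → Clean G v x y) where

  open Cornered cg
  open Covered cov
  open Local G loopless cov
  open Units G cg cov

  x y : V G → V G
  x v = proj₁ (clean-at v)
  y v = proj₁ (proj₂ (clean-at v))

  cl : ∀ v → Clean G v (x v) (y v)
  cl v = proj₂ (proj₂ (clean-at v))

  open Spine G cg cov (λ v → clean (cl v))

  SameTri : V G → V G → Set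
  SameTri v u = u ≡ v ⊎ ∃ λ e → Joins G e v u × spinal G e ≡ false

  sameTri? : ∀ v u → Dec (SameTri v u)
  sameTri? v u = (u ≟ v) ⊎-dec any? (λ e → joins? G e v u ×-dec (spinal G e ≟ᵇ false))

  module _ {v x y : V G} (c : Clean G v x y) where

    open Clean c

    tri-members : ∀ {u} → SameTri v u → u ≡ v ⊎ u ≡ x ⊎ u ≡ y
    tri-members (inj₁ eq) = inj₁ eq
    tri-members (inj₂ (e , j , rib)) with hub-edge hub-v j
    ... | inj₁ (refl , _) = ⊥-elim (true≢false (clean-spinal c) rib)
    ... | inj₂ (inj₁ (_ , eq)) = inj₂ (inj₁ eq)
    ... | inj₂ (inj₂ (_ , eq)) = inj₂ (inj₂ eq)

    same-x : SameTri v x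
    same-x = inj₂ (_ , Hub.jp hub-v , clean-ribbed c)

    same-y : SameTri v y
    same-y = inj₂ (_ , Hub.jq hub-v , clean-ribbed (clean-flip c))

    members-same : ∀ {u} → u ≡ v ⊎ u ≡ x ⊎ u ≡ y → SameTri v u
    members-same (inj₁ eq)          = inj₁ eq
    members-same (inj₂ (inj₁ refl)) = same-x
    members-same (inj₂ (inj₂ refl)) = same-y

    v≢x : v ≢ x
    v≢x = irrefl (Hub.jp hub-v)

    v≢y : v ≢ y
    v≢y = irrefl (Hub.jq hub-v)

    x≢y : x ≢ y
    x≢y = irrefl (Hub.jq hub-x)

    stem-v : stem v ≡ s
    stem-v = spinal-unique (Star.a-in (Hub.star hub-v)) (clean-spinal c)

    stem-x : stem x ≡ sx
    stem-x = spinal-unique (Star.a-in (Hub.star hub-x)) (clean-spinal (clean-rotate c))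

    stem-y : stem y ≡ sy
    stem-y = spinal-unique (Star.a-in (Hub.star hub-y)) (clean-spinal (clean-rotate (clean-rotate c)))

    rib-unique : ∀ {e} → Joins G e v x → e ≡ p
    rib-unique j with hub-edge hub-v j
    ... | inj₁ (_ , eq)        = contradiction (sym eq) (tri-w≢x tri)
    ... | inj₂ (inj₁ (eq , _)) = eq
    ... | inj₂ (inj₂ (_ , eq)) = contradiction eq x≢y

    stem-parity : ∀ {M} → PM G M → M (stem v) ≡ M (stem x) == M (stem y)
    stem-parity {M} pm rewrite stem-v | stem-x | stem-y = ==-sound
      (mp (mp (mp (tautology (λ { (s ∷ x ∷ y ∷ p ∷ q ∷ r ∷ []) → one s p q ⇒ one x p r ⇒ one y q r ⇒ s == (x == y) }) refl
        (M s ∷ M sx ∷ M sy ∷ M p ∷ M q ∷ M r ∷ []))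
        (PM⇒one (Hub.star hub-v) pm)) (PM⇒one (Hub.star hub-x) pm)) (PM⇒one (Hub.star hub-y) pm))

    opposite : ∀ {M} → PM G M → M r ≡ true → M (stem x) ≡ false × M (stem y) ≡ false
    opposite {M} pm Mr rewrite stem-x | stem-y =
      PM-reject pm Mr (Star.c-in (Hub.star hub-x)) (Star.a-in (Hub.star hub-x)) (Star.a≢c (Hub.star hub-x)) ,
      PM-reject pm Mr (Star.c-in (Hub.star hub-y)) (Star.a-in (Hub.star hub-y)) (Star.a≢c (Hub.star hub-y))

    r-joins : Joins G r x y
    r-joins = Hub.jq hub-x

    r∌v : ¬ In G r v
    r∌v r-in = [ v≢x , v≢y ]′ (joins-ends r-joins r-in)

  same-sym : ∀ {v u} → SameTri v u → SameTri u v
  same-sym (inj₁ eq)           = inj₁ (sym eq)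
  same-sym (inj₂ (e , j , rib)) = inj₂ (e , joins-sym j , rib)

  same-trans : ∀ {v u t} → SameTri v u → SameTri u t → SameTri v t
  same-trans {v} vu ut with tri-members (cl v) vu
  ... | inj₁ refl = ut
  ... | inj₂ (inj₁ refl) = members-same (cl v) (case tri-members (clean-rotate (cl v)) ut of λ
    { (inj₁ eq) → inj₂ (inj₁ eq) ; (inj₂ (inj₁ eq)) → inj₂ (inj₂ eq) ; (inj₂ (inj₂ eq)) → inj₁ eq })
  ... | inj₂ (inj₂ refl) = members-same (cl v) (case tri-members (clean-rotate (clean-rotate (cl v))) ut of λ
    { (inj₁ eq) → inj₂ (inj₂ eq) ; (inj₂ (inj₁ eq)) → inj₁ eq ; (inj₂ (inj₂ eq)) → inj₂ (inj₁ eq) })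

  Spined : V G → V G → Set
  Spined v u = ∃ λ e → spinal G e ≡ true × Joins G e v u

  stem-in : ∀ v → In G (stem v) v
  stem-in v = Star.a-in (Hub.star (Clean.hub-v (cl v)))

  stem-spine : ∀ v → spinal G (stem v) ≡ true
  stem-spine v = clean-spinal (cl v)

  partner : V G → V G
  partner v = Clean.w (cl v)

  stem-joins : ∀ v → Joins G (stem v) v (partner v)
  stem-joins v = Hub.js (Clean.hub-v (cl v))

  ¬same-partner : ∀ {v} → ¬ SameTri v (partner v)
  ¬same-partner {v} h with tri-members (cl v) h
  ... | inj₁ eq        = irrefl (stem-joins v) (sym eq)
  ... | inj₂ (inj₁ eq) = tri-w≢x (Clean.tri (cl v)) eq
  ... | inj₂ (inj₂ eq) = tri-w≢y (Clean.tri (cl v)) eq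

  equal-stems : ∀ {v u} → stem v ≡ stem u → v ≢ u → partner v ≡ u
  equal-stems {v} {u} eq v≢u with joins-ends (stem-joins v) (subst (λ e → In G e u) (sym eq) (stem-in u))
  ... | inj₁ h = contradiction (sym h) v≢u
  ... | inj₂ h = sym h

  spined-stem : ∀ {v u} → Spined v u → stem v ≡ stem u
  spined-stem (e , h , j) = ≡-trans (spinal-unique (joins-inˡ j) h) (sym (spinal-unique (joins-inʳ j) h))

  spined-partner : ∀ {v u} → Spined v u → partner v ≡ u
  spined-partner {v} (e , h , j) = joins-unique (subst (λ e → Joins G e v (partner v)) (spinal-unique (joins-inˡ j) h) (stem-joins v)) j

  -- Perfect matchings correspond to the vectors z on spinal edges with even sum at every
  -- triangle, i.e. to the cycle space of the cubic graph obtained by shrinking the triangles.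
  boundary : (Edge G → Bool) → V G → Bool
  boundary z v = z (stem v) xor (z (stem (x v)) xor z (stem (y v)))

  module OfCycle (z : Edge G → Bool) (even : ∀ v → boundary z v ≡ false) where

    -- The support of `z` contains none or exactly two of the three stems of a triangle; in the
    -- second case the rib between these two is used.
    matching : Edge G → Bool
    matching e = if spinal G e then not (z e) else z (stem (src G e)) ∧ z (stem (tgt G e))

    matching-spine : ∀ {e} → spinal G e ≡ true → matching e ≡ not (z e)
    matching-spine h rewrite h = refl

    matching-rib : ∀ {e u v} → spinal G e ≡ false → Joins G e u v → matching e ≡ z (stem u) ∧ z (stem v)
    matching-rib h (fwd refl refl) rewrite h = refl
    matching-rib {e} h (bwd refl refl) rewrite h = ∧-comm (z (stem (src G e))) (z (stem (tgt G e)))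

    matching-PM : PM G matching
    matching-PM .PM.matched v = one⇒unique (Hub.star hub-v) (one-subst
      (matching-spine (clean-spinal (cl v)))
      (matching-rib (clean-ribbed (cl v)) (Hub.jp hub-v)) (matching-rib (clean-ribbed (clean-flip (cl v))) (Hub.jq hub-v))
      (mp (tautology (λ { (a ∷ b ∷ c ∷ []) → not (a xor (b xor c)) ⇒ one (not a) (a ∧ b) (a ∧ c) }) refl
        (z (stem v) ∷ z (stem (x v)) ∷ z (stem (y v)) ∷ [])) (not-false (even v))))
      where open Clean (cl v)

  -- The indicator of the triangle of `v`, written as a sum over its vertices. In this form the
  -- effect of `toggle` on `boundary` is an identity of sums over 𝔽₂.
  belongs : V G → V G → Bool
  belongs v u = ⌊ v ≟ u ⌋ xor (⌊ x v ≟ u ⌋ xor ⌊ y v ≟ u ⌋)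

  belongs⇒ : ∀ {v u} → belongs v u ≡ true → SameTri v u
  belongs⇒ {v} {u} h with v ≟ u | x v ≟ u | y v ≟ u
  ... | yes k | _     | _     = inj₁ (sym k)
  ... | no _  | yes k | _     = members-same (cl v) (inj₂ (inj₁ (sym k)))
  ... | no _  | no _  | yes k = members-same (cl v) (inj₂ (inj₂ (sym k)))

  ⇒belongs : ∀ {v u} → SameTri v u → belongs v u ≡ true
  ⇒belongs {v} {u} h with tri-members (cl v) h
  ... | inj₁ refl = cong₂ _xor_ (⌊⌋-intro (v ≟ v) refl)
        (cong₂ _xor_ (⌊⌋-reject (x v ≟ v) (≢-sym (v≢x (cl v)))) (⌊⌋-reject (y v ≟ v) (≢-sym (v≢y (cl v)))))
  ... | inj₂ (inj₁ refl) = cong₂ _xor_ (⌊⌋-reject (v ≟ x v) (v≢x (cl v)))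
        (cong₂ _xor_ (⌊⌋-intro (x v ≟ x v) refl) (⌊⌋-reject (y v ≟ x v) (≢-sym (x≢y (cl v)))))
  ... | inj₂ (inj₂ refl) = cong₂ _xor_ (⌊⌋-reject (v ≟ y v) (v≢y (cl v)))
        (cong₂ _xor_ (⌊⌋-reject (x v ≟ y v) (x≢y (cl v))) (⌊⌋-intro (y v ≟ y v) refl))

  belongs-cong : ∀ {v u u′} → SameTri u u′ → belongs v u ≡ belongs v u′
  belongs-cong {v} h = bool-ext (λ k → ⇒belongs (same-trans (belongs⇒ {v} k) h))
                                (λ k → ⇒belongs (same-trans (belongs⇒ {v} k) (same-sym h)))

  toggle : Edge G → (Edge G → Bool) → Edge G → Bool
  toggle e z f = z f xor ⌊ f ≟ e ⌋

  boundary-toggle : ∀ {e u u′} z → spinal G e ≡ true → Joins G e u u′ → ∀ v →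
                    boundary (toggle e z) v ≡ boundary z v xor (belongs v u xor belongs v u′)
  boundary-toggle {e} {u} {u′} z h j v =
    ≡-trans (cong₂ _xor_ (cong (z (stem v) xor_) (at v)) (cong₂ _xor_ (cong (z (stem (x v)) xor_) (at (x v))) (cong (z (stem (y v)) xor_) (at (y v)))))
    (==-sound (tautology (λ { (a ∷ b ∷ c ∷ a₁ ∷ b₁ ∷ c₁ ∷ a₂ ∷ b₂ ∷ c₂ ∷ []) →
        ((a xor (a₁ xor a₂)) xor ((b xor (b₁ xor b₂)) xor (c xor (c₁ xor c₂)))) ==
        ((a xor (b xor c)) xor ((a₁ xor (b₁ xor c₁)) xor (a₂ xor (b₂ xor c₂)))) }) refl
      (z (stem v) ∷ z (stem (x v)) ∷ z (stem (y v)) ∷ ⌊ v ≟ u ⌋ ∷ ⌊ x v ≟ u ⌋ ∷ ⌊ y v ≟ u ⌋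
       ∷ ⌊ v ≟ u′ ⌋ ∷ ⌊ x v ≟ u′ ⌋ ∷ ⌊ y v ≟ u′ ⌋ ∷ [])))
    where
    at : ∀ t → ⌊ stem t ≟ e ⌋ ≡ ⌊ t ≟ u ⌋ xor ⌊ t ≟ u′ ⌋
    at t with t ≟ u | t ≟ u′
    ... | yes refl | yes refl = contradiction refl (irrefl j)
    ... | yes refl | no _     = ⌊⌋-intro (stem t ≟ e) (spinal-unique (joins-inˡ j) h)
    ... | no _     | yes refl = ⌊⌋-intro (stem t ≟ e) (spinal-unique (joins-inʳ j) h)
    ... | no t≢u   | no t≢u′  = ⌊⌋-reject (stem t ≟ e) λ { refl → [ t≢u , t≢u′ ]′ (joins-ends j (stem-in t)) }

-- Otherwise both vertices whose stems are missing would be matched to the third vertex of the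
-- triangle.
triangle-third : ∀ sx sy p q r s → sx ≡ false → sy ≡ false → one s p q ≡ true → one sx p r ≡ true → one sy q r ≡ true → r ≡ true
triangle-third false false true  true  r     true  _ _ () _ _
triangle-third false false true  true  r     false _ _ () _ _
triangle-third false false p     q     true  s     _ _ _ _ _ = refl
triangle-third false false false _     false _     _ _ _ () _
triangle-third false false true  false false _     _ _ _ _ ()

-- Equivalent stems are equal, and implications between ribs

module Stems (G : Graph) (cg : Cornered G) (cov : Covered G) (prime : NoNTC G)
             (clean-at : ∀ v → ∃₂ λ x y → Clean G v x y) where

  open Cornered cg
  open Covered cov
  open Local G loopless cov
  open Units G cg cov
  open Truncated G cg cov prime clean-at
  open Spine G cg cov (λ v → clean (cl v))

  -- If two stems lie in the same perfect matchings but differ, let X be the set of vertices reachable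
  -- from the partner a′ of a without using them (reachability is expressed over 𝔽₂, by a set z of
  -- spinal edges whose boundary is a′ + u).  Then X ∪ {a} has a tight cut.
  module Separated (a b : V G) (same : ∀ {M} → PM G M → M (stem a) ≡ M (stem b)) (a≢b : stem a ≢ stem b) where

    a′ : V G
    a′ = partner a

    Path : V G → (Edge G → Bool) → Set
    Path u z = z (stem a) ≡ false × z (stem b) ≡ false × (∀ v → boundary z v ≡ belongs v a′ xor belongs v u)

    Reachable : V G → Set
    Reachable u = ∃ (Path u)

    reachable? : ∀ u → Dec (Reachable u)
    reachable? u = map′ (λ (s , h) → lookupᵛ s , h)
      (λ (z , ha , hb , bd) → tabulate z , ≡-trans (lookup∘tabulate z _) ha , ≡-trans (lookup∘tabulate z _) hb
        , λ v → ≡-trans (cong₂ _xor_ (lookup∘tabulate z _) (cong₂ _xor_ (lookup∘tabulate z _) (lookup∘tabulate z _))) (bd v))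
      (anySubset? λ s → (lookupᵛ s (stem a) ≟ᵇ false) ×-dec ((lookupᵛ s (stem b) ≟ᵇ false) ×-dec
        all? λ v → boundary (lookupᵛ s) v ≟ᵇ (belongs v a′ xor belongs v u)))

    opaque
      X : V G → Bool
      X u = ⌊ reachable? u ⌋

      X⇒ : ∀ {u} → X u ≡ true → Reachable u
      X⇒ = ⌊⌋-true

      ⇒X : ∀ {u} → Reachable u → X u ≡ true
      ⇒X {u} = ⌊⌋-intro (reachable? u)

    X-a′ : X a′ ≡ true
    X-a′ = ⇒X ((λ _ → false) , refl , refl , λ v → sym (xor-same (belongs v a′)))

    X-rib : ∀ {u u′} → SameTri u u′ → X u ≡ true → X u′ ≡ true
    X-rib h Xu with X⇒ Xu
    ... | z , ha , hb , bd = ⇒X (z , ha , hb , λ v → ≡-trans (bd v) (cong (belongs v a′ xor_) (belongs-cong {v} h)))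

    X-stem : ∀ {e u u′} → spinal G e ≡ true → e ≢ stem a → e ≢ stem b → Joins G e u u′ → X u ≡ true → X u′ ≡ true
    X-stem {e} {u} {u′} h e≢a e≢b j Xu with X⇒ Xu
    ... | z , ha , hb , bd = ⇒X (toggle e z , off ha e≢a , off hb e≢b , λ v → ≡-trans (boundary-toggle z h j v)
      (≡-trans (cong (_xor (belongs v u xor belongs v u′)) (bd v))
        (==-sound (tautology (λ { (p ∷ q ∷ r ∷ []) → ((p xor q) xor (q xor r)) == (p xor r) }) refl
          (belongs v a′ ∷ belongs v u ∷ belongs v u′ ∷ [])))))
      where off : ∀ {s} → z s ≡ false → e ≢ s → toggle e z s ≡ false
            off {s} hz e≢s = cong₂ _xor_ hz (⌊⌋-reject (s ≟ e) (≢-sym e≢s))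

    -- A path from `a′` to `a` closes up with the stem of `a` to a cycle that misses the stem of
    -- `b`. The corresponding perfect matching contains the stem of `b` but not that of `a`.
    X-a : X a ≡ false
    X-a = ¬true λ Xa → case X⇒ Xa of λ (z , ha , hb , bd) →
      let module Z = OfCycle (toggle (stem a) z) (λ v → ≡-trans (boundary-toggle z (stem-spine a) (stem-joins a) v)
            (≡-trans (cong (_xor (belongs v a xor belongs v a′)) (bd v))
              (==-sound (tautology (λ { (p ∷ q ∷ []) → ((p xor q) xor (q xor p)) == false }) refl (belongs v a′ ∷ belongs v a ∷ [])))))
      in true≢false
        (≡-trans (same Z.matching-PM) (≡-trans (Z.matching-spine (stem-spine b))
          (cong not (cong₂ _xor_ hb (⌊⌋-reject (stem b ≟ stem a) (≢-sym a≢b))))))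
        (≡-trans (Z.matching-spine (stem-spine a)) (cong not (cong₂ _xor_ ha (⌊⌋-intro (stem a ≟ stem a) refl))))

    opaque
      -- Only the stems of `a` and `b` can leave `X`. Adding `a` replaces its stem in the cut by its
      -- two ribs; since the stem of `b` occurs in the same matchings as that of `a`, the new cut is
      -- crossed as often as the star of `a`.
      Y : V G → Bool
      Y u = X u ∨ ⌊ u ≟ a ⌋

      Y-a : Y a ≡ true
      Y-a = ∨-introʳ (X a) (⌊⌋-intro (a ≟ a) refl)

      Y-X : ∀ {u} → X u ≡ true → Y u ≡ true
      Y-X = ∨-introˡ _

      Y-mate : ∀ {u} → SameTri a u → u ≢ a → Y u ≡ false
      Y-mate {u} h u≢a = cong₂ _∨_ (¬true λ Xu → true≢false (X-rib (same-sym h) Xu) X-a) (⌊⌋-reject (u ≟ a) u≢a)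

      Y⇒X : ∀ {u} → Y u ≡ true → u ≢ a → X u ≡ true
      Y⇒X {u} h u≢a with ∨-true {X u} h
      ... | inj₁ Xu = Xu
      ... | inj₂ k  = contradiction (⌊⌋-true {d = u ≟ a} k) u≢a

    c : Clean G a (x a) (y a)
    c = cl a

    open Clean c using (p; q)

    cut-p : Cut G Y p
    cut-p = ≢⇒cut Y-a (Y-mate (same-x c) (≢-sym (v≢x c))) (Hub.jp (Clean.hub-v c))

    cut-q : Cut G Y q
    cut-q = ≢⇒cut Y-a (Y-mate (same-y c) (≢-sym (v≢y c))) (Hub.jq (Clean.hub-v c))

    only : ∀ e → Cut G Y e → e ≡ p ⊎ e ≡ q ⊎ e ≡ stem b
    only e ce with cut-oriented ce
    ... | u , w , j , Yu , Yw with u ≟ a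
    ...   | yes refl with hub-edge (Clean.hub-v c) j
    ...     | inj₁ (_ , refl)      = ⊥-elim (true≢false (Y-X X-a′) Yw)
    ...     | inj₂ (inj₁ (eq , _)) = inj₁ eq
    ...     | inj₂ (inj₂ (eq , _)) = inj₂ (inj₁ eq)
    only e ce | u , w , j , Yu , Yw | no u≢a with spinal G e in h | e ≟ stem a | e ≟ stem b
    ... | _ | _ | yes eq = inj₂ (inj₂ eq)
    ... | false | _ | no _ = ⊥-elim (true≢false (Y-X (X-rib (inj₂ (e , j , h)) (Y⇒X Yu u≢a))) Yw)
    ... | true | no e≢a | no e≢b = ⊥-elim (true≢false (Y-X (X-stem h e≢a e≢b j (Y⇒X Yu u≢a))) Yw)
    ... | true | yes refl | no _ with joins-ends j (stem-in a)
    ...   | inj₁ eq   = contradiction (sym eq) u≢a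
    ...   | inj₂ refl = ⊥-elim (true≢false Y-a Yw)

    off-stem : ∀ {M} → PM G M → M (stem a) ≡ true → M p ≡ false × M q ≡ false
    off-stem pm Ma = PM-reject pm Ma (stem-in a) (Star.b-in st) (≢-sym (Star.a≢b st)) ,
                     PM-reject pm Ma (stem-in a) (Star.c-in st) (≢-sym (Star.a≢c st))
      where st = Hub.star (Clean.hub-v c)

    -- By parity: if the stem of `b` were not in the cut, a matching through the stem of `a` would
    -- cross it never, and one through `p` exactly once.
    cut-b : Cut G Y (stem b)
    cut-b with inCutᵇ G Y (stem b) ≟ᵇ true
    ... | yes h = mkCut h
    ... | no ¬h with through (stem a) | through p
    ...   | M , pm , Ma | N , pn , Np = ⊥-elim (true≢false odd
      (≡-trans (cut-parity Y loopless pn) (≡-trans (sym (cut-parity Y loopless pm)) even)))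
      where
      st = Hub.star (Clean.hub-v c)
      even : ⨁ (λ e → M e ∧ inCutᵇ G Y e) ≡ false
      even = ⨁-false λ e → ¬true λ h → case only e (mkCut (proj₂ (∧-true {M e} h))) of λ
        { (inj₁ refl) → true≢false (proj₁ (∧-true h)) (proj₁ (off-stem pm Ma))
        ; (inj₂ (inj₁ refl)) → true≢false (proj₁ (∧-true h)) (proj₂ (off-stem pm Ma))
        ; (inj₂ (inj₂ refl)) → ¬h (proj₂ (∧-true {M e} h)) }
      odd : ⨁ (λ e → N e ∧ inCutᵇ G Y e) ≡ true
      odd = ⨁-unique (p , ∧-intro Np (crosses cut-p) , λ e h → case only e (mkCut (proj₂ (∧-true {N e} h))) of λ
        { (inj₁ eq) → eq
        ; (inj₂ (inj₁ refl)) → PM-unique pn (proj₁ (∧-true h)) (Star.c-in st) Np (Star.b-in st)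
        ; (inj₂ (inj₂ refl)) → ⊥-elim (¬h (proj₂ (∧-true {N e} h))) })

    impossible : ⊥
    impossible = prime Y (irrefl (stem-joins a)) Y-a (Y-X X-a′) (x≢y c)
      (Y-mate (same-x c) (≢-sym (v≢x c))) (Y-mate (same-y c) (≢-sym (v≢y c)))
      λ {M} pm → one⇒unique-among {G} {M} {Cut G Y} cut-p cut-q cut-b only
        (subst (λ m → one (M p) (M q) m ≡ true) (same pm) (PM⇒one (rotate (Hub.star (Clean.hub-v c))) pm))

  equivalent⇒equal : ∀ a b → (∀ {M} → PM G M → M (stem a) ≡ M (stem b)) → stem a ≡ stem b
  equivalent⇒equal a b same with stem a ≟ stem b
  ... | yes eq = eq
  ... | no neq = ⊥-elim (Separated.impossible a b same neq)

  DoublyLinked : Set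
  DoublyLinked = ∃ λ v → ∃ λ u → ∃ λ v′ → ∃ λ u′ → v ≢ u × SameTri v u × SameTri v′ u′ × Spined v v′ × Spined u u′

  spined? : ∀ v u → Dec (Spined v u)
  spined? v u = any? λ e → (spinal G e ≟ᵇ true) ×-dec joins? G e v u

  doublyLinked? : Dec DoublyLinked
  doublyLinked? = any? λ v → any? λ u → any? λ v′ → any? λ u′ →
    ¬? (v ≟ u) ×-dec (sameTri? v u ×-dec (sameTri? v′ u′ ×-dec (spined? v v′ ×-dec spined? u u′)))

  equal⇒spined : ∀ {v u} → stem v ≡ stem u → v ≢ u → Spined v u
  equal⇒spined {v} {u} eq v≢u = stem v , stem-spine v , subst (Joins G (stem v) v) (equal-stems eq v≢u) (stem-joins v)

  -- If every perfect matching through f contains e, then f is the edge opposite to v₂, e the edge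
  -- opposite to v, and adding suitable perfect matchings identifies the stems of the two triangles.
  implied⇒linked : ∀ {v x y v₂ x₂ y₂} (c : Clean G v x y) (c₂ : Clean G v₂ x₂ y₂) → ¬ SameTri v v₂ →
                      (∀ {M} → PM G M → M (Clean.r c₂) ≡ true → M (Clean.r c) ≡ true) → DoublyLinked
  implied⇒linked {v} {x} {y} {v₂} {x₂} {y₂} c c₂ apart implied
    with through (Clean.r c₂) | through (Clean.q c₂) | through (Clean.p c)
  ... | M₁ , pm₁ , M₁r | A , pa , Aq | B , pb , Bp = conclude (A (stem x)) refl (A (stem y)) refl
    where
    r₂-present : ∀ {M} → PM G M → M (stem x₂) ≡ false → M (stem y₂) ≡ false → M (Clean.r c₂) ≡ true
    r₂-present {M} pm hx hy = triangle-third (M (Clean.sx c₂)) (M (Clean.sy c₂)) (M (Clean.p c₂)) (M (Clean.q c₂)) (M (Clean.r c₂)) (M (Clean.s c₂))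
      (subst (λ e → M e ≡ false) (stem-x c₂) hx) (subst (λ e → M e ≡ false) (stem-y c₂) hy)
      (PM⇒one (Hub.star (Clean.hub-v c₂)) pm) (PM⇒one (Hub.star (Clean.hub-x c₂)) pm) (PM⇒one (Hub.star (Clean.hub-y c₂)) pm)
    -- The implication from `r` of `c₂` to `r` of `c`, read off the stems: a rib is used exactly
    -- when the stems at both its ends are missing.
    H : Bool → Bool → Bool → Bool → Bool
    H x₂ y₂ x y = not x₂ ∧ not y₂ ⇒ not x ∧ not y
    row : ∀ {M} → PM G M → H (M (stem x₂)) (M (stem y₂)) (M (stem x)) (M (stem y)) ≡ true
    row {M} pm with M (stem x₂) in hx | M (stem y₂) in hy
    ... | true  | _     = refl
    ... | false | true  = refl
    ... | false | false with opposite c pm (implied pm (r₂-present pm hx hy))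
    ...   | h , k = cong₂ _∧_ (not-false h) (not-false k)
    sum-at : ∀ {M N} (pm : PM G M) (pn : PM G N) u → Sum.total pm pn (stem u) ≡ M (stem u) == N (stem u)
    sum-at pm pn u = Sum.total-spine pm pn (stem-spine u)
    A-pattern : A (stem x₂) ≡ true × A (stem y₂) ≡ false
    A-pattern with opposite (clean-rotate c₂) pa Aq
    ... | hy , hv = ==-true (≡-trans (sym hv) (stem-parity c₂ pa)) hy , hy
      where ==-true : ∀ {a b} → false ≡ a == b → b ≡ false → a ≡ true
            ==-true {true} _ _ = refl
            ==-true {false} () refl
    parallel crossed level : (Edge G → Bool) → Bool
    parallel N = A (stem x) ∧ not (A (stem y)) ⇒ N (stem x) == N (stem x₂) ∧ N (stem y) == N (stem y₂)
    crossed N  = not (A (stem x)) ∧ A (stem y) ⇒ N (stem x) == N (stem y₂) ∧ N (stem y) == N (stem x₂)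
    level N    = A (stem x) == A (stem y) ⇒ N (stem x) == N (stem y)
    -- In z-coordinates at x₂, y₂ the matchings `M₁` and `A` are (1,1) and (0,1), a basis of 𝔽₂². So
    -- one of N, N + M₁, N + A, N + A + M₁ contains the rib x₂y₂ and therefore xy. Hence the values
    -- of `N` at `x₂`, `y₂` determine those at `x`, `y`, and the values of `A` at `x`, `y` tell
    -- which linear map this is.
    table : ∀ {N} → PM G N → parallel N ∧ (crossed N ∧ level N) ≡ true
    table {N} pn = mp (mp (mp (mp (mp (tautology (λ { (x ∷ y ∷ x₂ ∷ y₂ ∷ mx ∷ my ∷ ax ∷ ay ∷ []) →
        H false false mx my ⇒ H x₂ y₂ x y ⇒ H (x₂ == false) (y₂ == false) (x == mx) (y == my) ⇒
        H (x₂ == true) (y₂ == false) (x == ax) (y == ay) ⇒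
        H ((x₂ == true) == false) ((y₂ == false) == false) ((x == ax) == mx) ((y == ay) == my) ⇒
        (ax ∧ not ay ⇒ (x == x₂) ∧ (y == y₂)) ∧ (not ax ∧ ay ⇒ (x == y₂) ∧ (y == x₂)) ∧ (ax == ay ⇒ x == y) }) refl
      (N (stem x) ∷ N (stem y) ∷ N (stem x₂) ∷ N (stem y₂) ∷ M₁ (stem x) ∷ M₁ (stem y) ∷ A (stem x) ∷ A (stem y) ∷ []))
      (with-M₁ (row pm₁))) (row pn)) (with-N+M₁ (row n+m))) (with-N+A (row n+a))) (with-N+A+M₁ (row n+a+m))
      where
      n+m = Sum.total-PM pn pm₁
      n+a = Sum.total-PM pn pa
      n+a+m = Sum.total-PM n+a pm₁
      H-cong : ∀ {a a′ b b′ c c′ d d′} → a ≡ a′ → b ≡ b′ → c ≡ c′ → d ≡ d′ → H a b c d ≡ true → H a′ b′ c′ d′ ≡ true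
      H-cong refl refl refl refl h = h
      m-x₂ : M₁ (stem x₂) ≡ false
      m-x₂ = proj₁ (opposite c₂ pm₁ M₁r)
      m-y₂ : M₁ (stem y₂) ≡ false
      m-y₂ = proj₂ (opposite c₂ pm₁ M₁r)
      with-M₁ = H-cong {c = M₁ (stem x)} {d = M₁ (stem y)} m-x₂ m-y₂ refl refl
      with-N+M₁ = H-cong (≡-trans (sum-at pn pm₁ x₂) (cong (N (stem x₂) ==_) m-x₂)) (≡-trans (sum-at pn pm₁ y₂) (cong (N (stem y₂) ==_) m-y₂))
        (sum-at pn pm₁ x) (sum-at pn pm₁ y)
      a-x₂ : Sum.total pn pa (stem x₂) ≡ N (stem x₂) == true
      a-x₂ = ≡-trans (sum-at pn pa x₂) (cong (N (stem x₂) ==_) (proj₁ A-pattern))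
      a-y₂ : Sum.total pn pa (stem y₂) ≡ N (stem y₂) == false
      a-y₂ = ≡-trans (sum-at pn pa y₂) (cong (N (stem y₂) ==_) (proj₂ A-pattern))
      with-N+A = H-cong a-x₂ a-y₂ (sum-at pn pa x) (sum-at pn pa y)
      with-N+A+M₁ = H-cong (≡-trans (sum-at n+a pm₁ x₂) (cong₂ _==_ a-x₂ m-x₂)) (≡-trans (sum-at n+a pm₁ y₂) (cong₂ _==_ a-y₂ m-y₂))
        (≡-trans (sum-at n+a pm₁ x) (cong (_== M₁ (stem x)) (sum-at pn pa x)))
        (≡-trans (sum-at n+a pm₁ y) (cong (_== M₁ (stem y)) (sum-at pn pa y)))
    B-pattern : B (stem x) ≡ false × B (stem y) ≡ true
    B-pattern with opposite (clean-rotate (clean-rotate c)) pb Bp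
    ... | hv , hx = hx , other (≡-trans (sym hv) (stem-parity c pb)) hx
      where other : ∀ {a b} → false ≡ a == b → a ≡ false → b ≡ true
            other {b = true} _ _ = refl
            other {b = false} () refl
    distinct : ∀ {u u₂} → SameTri v u → SameTri v₂ u₂ → u ≢ u₂
    distinct h h₂ refl = apart (same-trans h (same-sym h₂))
    spine : ∀ {u u₂} → SameTri v u → SameTri v₂ u₂ → (∀ {N} → PM G N → N (stem u) ≡ N (stem u₂)) → Spined u u₂
    spine h h₂ eq = equal⇒spined (equivalent⇒equal _ _ eq) (distinct h h₂)
    x~y : ∀ {v x y} → Clean G v x y → SameTri x y
    x~y c = same-trans (same-sym (same-x c)) (same-y c)
    -- Then every perfect matching would take equal values at `x` and `y`; but `B`, which contains
    -- the rib from `v` to `x`, does not.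
    never : A (stem x) ≡ A (stem y) → ⊥
    never eq = true≢false (proj₂ B-pattern) (≡-trans (sym (==-sound (mp (proj₂ (∧-true {crossed B}
      (proj₂ (∧-true {parallel B} (table pb))))) (==-intro eq)))) (proj₁ B-pattern))
    conclude : ∀ ax → A (stem x) ≡ ax → ∀ ay → A (stem y) ≡ ay → DoublyLinked
    conclude true hx false hy = x , y , x₂ , y₂ , x≢y c , x~y c , x~y c₂ ,
      spine (same-x c) (same-x c₂) (λ {N} pn → ==-sound (proj₁ (both pn))) ,
      spine (same-y c) (same-y c₂) (λ {N} pn → ==-sound (proj₂ (both pn)))
      where both : ∀ {N} → PM G N → N (stem x) == N (stem x₂) ≡ true × N (stem y) == N (stem y₂) ≡ true
            both {N} pn = ∧-true {N (stem x) == N (stem x₂)} (mp (proj₁ (∧-true {parallel N} (table pn)))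
              (cong₂ (λ a b → a ∧ not b) hx hy))
    conclude false hx true hy = x , y , y₂ , x₂ , x≢y c , x~y c , same-sym (x~y c₂) ,
      spine (same-x c) (same-y c₂) (λ {N} pn → ==-sound (proj₁ (both pn))) ,
      spine (same-y c) (same-x c₂) (λ {N} pn → ==-sound (proj₂ (both pn)))
      where both : ∀ {N} → PM G N → N (stem x) == N (stem y₂) ≡ true × N (stem y) == N (stem x₂) ≡ true
            both {N} pn = ∧-true {N (stem x) == N (stem y₂)} (mp (proj₁ (∧-true {crossed N}
              (proj₂ (∧-true {parallel N} (table pn))))) (cong₂ (λ a b → not a ∧ b) hx hy))
    conclude true hx true hy   = ⊥-elim (never (≡-trans hx (sym hy)))
    conclude false hx false hy = ⊥-elim (never (≡-trans hx (sym hy)))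

-- Recognition of the prism, and the removable edges of the other bricks

module Bricks (G : Graph) (cg : Cornered G) (cov : Covered G) (prime : NoNTC G)
              (clean-at : ∀ v → ∃₂ λ x y → Clean G v x y) where

  open Cornered cg
  open Covered cov
  open Local G loopless cov
  open Truncated G cg cov prime clean-at
  open Spine G cg cov (λ v → clean (cl v))
  open Stems G cg cov prime clean-at

  corners : ∀ {v x y} → Clean G v x y → Fin 3 → V G
  corners {v} {x} {y} c zero             = v
  corners {v} {x} {y} c (suc zero)       = x
  corners {v} {x} {y} c (suc (suc zero)) = y

  corners-same : ∀ {v x y} (c : Clean G v x y) i → SameTri v (corners c i)
  corners-same c zero             = inj₁ refl
  corners-same c (suc zero)       = same-x c
  corners-same c (suc (suc zero)) = same-y c

  corners-onto : ∀ {v x y} (c : Clean G v x y) {u} → SameTri v u → ∃ λ i → corners c i ≡ u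
  corners-onto c h with tri-members c h
  ... | inj₁ refl        = zero , refl
  ... | inj₂ (inj₁ refl) = suc zero , refl
  ... | inj₂ (inj₂ refl) = suc (suc zero) , refl

  corners-injective : ∀ {v x y} (c : Clean G v x y) {i j} → corners c i ≡ corners c j → i ≡ j
  corners-injective c {zero} {zero} _ = refl
  corners-injective c {suc zero} {suc zero} _ = refl
  corners-injective c {suc (suc zero)} {suc (suc zero)} _ = refl
  corners-injective c {zero} {suc zero} h = contradiction h (v≢x c)
  corners-injective c {zero} {suc (suc zero)} h = contradiction h (v≢y c)
  corners-injective c {suc zero} {zero} h = contradiction (sym h) (v≢x c)
  corners-injective c {suc zero} {suc (suc zero)} h = contradiction h (x≢y c)
  corners-injective c {suc (suc zero)} {zero} h = contradiction (sym h) (v≢y c)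
  corners-injective c {suc (suc zero)} {suc zero} h = contradiction (sym h) (x≢y c)

  same⇒clean : ∀ {v u} → SameTri v u → v ≢ u → ∃ λ t → Clean G v u t
  same⇒clean {v} h v≢u with tri-members (cl v) h
  ... | inj₁ eq          = contradiction (sym eq) v≢u
  ... | inj₂ (inj₁ refl) = _ , cl v
  ... | inj₂ (inj₂ refl) = _ , clean-flip (cl v)

  spined-apart : ∀ {v u} → Spined v u → ¬ SameTri v u
  spined-apart h same = ¬same-partner (subst (SameTri _) (sym (spined-partner h)) same)

  spined-sym : ∀ {v u} → Spined v u → Spined u v
  spined-sym (e , h , j) = e , h , joins-sym j

  clean-partner : ∀ {v x y} (c : Clean G v x y) → Spined v (Clean.w c)
  clean-partner c = _ , clean-spinal c , Hub.js (Clean.hub-v c)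

  spined-unique : ∀ {v u t} → Spined v u → Spined v t → u ≡ t
  spined-unique h k = ≡-trans (sym (spined-partner h)) (spined-partner k)

  module Prism {v u t v′ u′ t′} (c : Clean G v u t) (c′ : Clean G v′ u′ t′)
               (vv′ : Spined v v′) (uu′ : Spined u u′) where

    apart : ¬ SameTri v v′
    apart = spined-apart vv′

    -- In each triangle the stems at two vertices determine the value of the third stem. So two
    -- rungs make the remaining stems equivalent, hence equal.
    tt′ : Spined t t′
    tt′ = equal⇒spined (equivalent⇒equal t t′ λ {M} pm → ==-cancel (≡-trans (sym (stem-parity (clean-rotate c) pm))
        (≡-trans (cong M (spined-stem uu′)) (stem-parity (clean-rotate c′) pm))) (cong M (spined-stem vv′)))
      λ { refl → apart (same-trans (same-y c) (same-sym (same-y c′))) }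

    vertex : Bool → Fin 3 → V G
    vertex true  = corners c
    vertex false = corners c′

    base : Bool → V G
    base true  = v
    base false = v′

    in-base : ∀ b i → SameTri (base b) (vertex b i)
    in-base true  = corners-same c
    in-base false = corners-same c′

    base-unique : ∀ {b b′ u} → SameTri (base b) u → SameTri (base b′) u → b ≡ b′
    base-unique {true}  {true}  _ _ = refl
    base-unique {false} {false} _ _ = refl
    base-unique {true}  {false} h k = contradiction (same-trans h (same-sym k)) apart
    base-unique {false} {true}  h k = contradiction (same-trans k (same-sym h)) apart

    vertex-injective : ∀ b {i j} → vertex b i ≡ vertex b j → i ≡ j
    vertex-injective true  = corners-injective c
    vertex-injective false = corners-injective c′

    rung : ∀ i → Spined (vertex true i) (vertex false i)
    rung 0F = vv′
    rung 1F = uu′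
    rung 2F = tt′

    side : Fin 6 → Bool
    side i = ⌊ toℕ i % 2 ℕ.≟ 0 ⌋

    -- In the complement of the 6-cycle the parity of i names the triangle, and i and i + 3 are the
    -- ends of a rung; so the place depends on i modulo 3.
    place : Fin 6 → Fin 3
    place 0F = 0F
    place 1F = 2F
    place 2F = 1F
    place 3F = 0F
    place 4F = 2F
    place 5F = 1F

    g : Fin 6 → V G
    g i = vertex (side i) (place i)

    code-injective : ∀ i j → side i ≡ side j → place i ≡ place j → i ≡ j
    code-injective = toWitness {a? = all? λ i → all? λ j → (side i ≟ᵇ side j) →-dec ((place i ≟ place j) →-dec (i ≟ j))} _

    code-onto : ∀ b p → ∃ λ i → side i ≡ b × place i ≡ p
    code-onto true  = toWitness {a? = all? λ p → any? λ i → (side i ≟ᵇ true) ×-dec (place i ≟ p)} _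
    code-onto false = toWitness {a? = all? λ p → any? λ i → (side i ≟ᵇ false) ×-dec (place i ≟ p)} _

    Beside : Fin 6 → Fin 6 → Set
    Beside i j = (side i ≡ side j × place i ≢ place j) ⊎ (side i ≢ side j × place i ≡ place j)

    beside? : ∀ i j → Dec (Beside i j)
    beside? i j = ((side i ≟ᵇ side j) ×-dec ¬? (place i ≟ place j)) ⊎-dec (¬? (side i ≟ᵇ side j) ×-dec (place i ≟ place j))

    opaque
      beside⇒c6bar : ∀ i j → Beside i j → C6barAdj i j
      beside⇒c6bar = toWitness {a? = all? λ i → all? λ j → beside? i j →-dec c6barAdj? i j} _

      c6bar⇒beside : ∀ i j → C6barAdj i j → Beside i j
      c6bar⇒beside = toWitness {a? = all? λ i → all? λ j → c6barAdj? i j →-dec beside? i j} _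

    g-injective : ∀ {i j} → g i ≡ g j → i ≡ j
    g-injective {i} {j} eq with base-unique {side i} {side j} (in-base (side i) (place i)) (subst (SameTri (base (side j))) (sym eq) (in-base (side j) (place j)))
    ... | h = code-injective i j h (vertex-injective (side j) (subst (λ b → vertex b (place i) ≡ g j) h eq))

    rung-from : ∀ b i → ∃ λ b′ → b′ ≢ b × Spined (vertex b i) (vertex b′ i)
    rung-from true  i = false , (λ ()) , rung i
    rung-from false i = true , (λ ()) , spined-sym (rung i)

    vertex-onto : ∀ b {u} → SameTri (base b) u → ∃ λ i → vertex b i ≡ u
    vertex-onto true  = corners-onto c
    vertex-onto false = corners-onto c′

    closed : ∀ {e u w} → Joins G e u w → (∃ λ b → SameTri (base b) u) → ∃ λ b → SameTri (base b) w
    closed {e} j (b , h) with spinal G e in eq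
    ... | false = b , same-trans h (inj₂ (e , j , eq))
    ... | true with vertex-onto b h
    ...   | i , refl with rung-from b i
    ...     | b′ , _ , sp = b′ , subst (SameTri (base b′)) (spined-unique sp (e , eq , j)) (in-base b′ i)

    g-onto : ∀ u → ∃ λ i → g i ≡ u
    g-onto u with spanning
      (λ u → map′ [ (true ,_) , (false ,_) ]′ (λ { (true , h) → inj₁ h ; (false , h) → inj₂ h }) (sameTri? v u ⊎-dec sameTri? v′ u))
      closed {v} (true , inj₁ refl) u
    ... | b , h with vertex-onto b h
    ...   | p , refl with code-onto b p
    ...     | i , refl , refl = i , refl

    nbr⇒beside : ∀ i j → Nbr G (g i) (g j) → Beside i j
    nbr⇒beside i j (e , k) with spinal G e in eq | side i ≟ᵇ side j
    ... | false | yes h = inj₁ (h , λ h′ → irrefl k (cong₂ vertex h h′))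
    ... | false | no h  = contradiction (base-unique {side i} {side j}
          (same-trans (in-base (side i) (place i)) (inj₂ (e , k , eq))) (in-base (side j) (place j))) h
    ... | true | yes h = contradiction (same-trans (same-sym (in-base (side i) (place i)))
          (subst (λ b → SameTri (base b) (g j)) (sym h) (in-base (side j) (place j)))) (spined-apart (e , eq , k))
    ... | true | no h with rung-from (side i) (place i)
    ...   | b , b≢ , sp = inj₂ (h , vertex-injective (side j) (subst (λ b → vertex b (place i) ≡ g j) (two-values b≢ h) (spined-unique sp (e , eq , k))))
      where two-values : ∀ {a b c : Bool} → b ≢ a → a ≢ c → b ≡ c
            two-values {true}  {true}  h _ = contradiction refl h
            two-values {true}  {false} {true}  _ h = contradiction refl h
            two-values {true}  {false} {false} _ _ = refl
            two-values {false} {false} h _ = contradiction refl h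
            two-values {false} {true}  {false} _ h = contradiction refl h
            two-values {false} {true}  {true}  _ _ = refl

    same⇒nbr : ∀ {u w} → SameTri u w → u ≢ w → Nbr G u w
    same⇒nbr (inj₁ eq) u≢w          = contradiction (sym eq) u≢w
    same⇒nbr (inj₂ (e , j , _)) u≢w = e , j

    beside⇒nbr : ∀ i j → Beside i j → Nbr G (g i) (g j)
    beside⇒nbr i j (inj₁ (h , h′)) = same⇒nbr (same-trans (same-sym (in-base (side i) (place i)))
      (subst (λ b → SameTri (base b) (g j)) (sym h) (in-base (side j) (place j))))
      λ eq → h′ (cong place (g-injective {i} {j} eq))
    beside⇒nbr i j (inj₂ (h , h′)) rewrite h′ with side i | side j
    ... | true  | true  = contradiction refl h
    ... | false | false = contradiction refl h
    ... | true  | false = let e , _ , k = rung (place j) in e , k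
    ... | false | true  = let e , _ , k = spined-sym (rung (place j)) in e , k

    is-c6bar : IsC6bar G
    is-c6bar = enumeration⇒iso loopless g (λ {i} {j} → g-injective {i} {j}) g-onto
      (λ i j h → beside⇒c6bar i j (nbr⇒beside i j h)) (λ i j h → beside⇒nbr i j (c6bar⇒beside i j h))

  linked⇒c6bar : DoublyLinked → IsC6bar G
  linked⇒c6bar (v , u , v′ , u′ , v≢u , vu , v′u′ , vv′ , uu′)
    with same⇒clean vu v≢u | same⇒clean v′u′ (λ { refl → v≢u (spined-unique (spined-sym vv′) (spined-sym uu′)) })
  ... | _ , c | _ , c′ = Prism.is-c6bar c c′ vv′ uu′

  opposite-edge : ∀ {v x y} (c : Clean G v x y) → Clean.r (cl v) ≡ Clean.r c
  opposite-edge {v} {x} {y} c = sym (go (tri-members (cl v) (same-x c)) (tri-members (cl v) (same-y c)))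
    where
    d = cl v
    r-unique : ∀ {e} → Joins G e (Truncated.x G cg cov prime clean-at v) (Truncated.y G cg cov prime clean-at v) → e ≡ Clean.r d
    r-unique = rib-unique (clean-rotate d)
    go : x ≡ v ⊎ x ≡ _ ⊎ x ≡ _ → y ≡ v ⊎ y ≡ _ ⊎ y ≡ _ → Clean.r c ≡ Clean.r d
    go (inj₁ eq) _ = contradiction (sym eq) (v≢x c)
    go _ (inj₁ eq) = contradiction (sym eq) (v≢y c)
    go (inj₂ (inj₁ h)) (inj₂ (inj₁ k)) = contradiction (≡-trans h (sym k)) (x≢y c)
    go (inj₂ (inj₂ h)) (inj₂ (inj₂ k)) = contradiction (≡-trans h (sym k)) (x≢y c)
    go (inj₂ (inj₁ refl)) (inj₂ (inj₂ refl)) = r-unique (r-joins c)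
    go (inj₂ (inj₂ refl)) (inj₂ (inj₁ refl)) = r-unique (joins-sym (r-joins c))

  apex : ∀ {e} → spinal G e ≡ false → ∃ λ v → Clean.r (cl v) ≡ e
  apex {e} rib with Star.cover (Hub.star (Clean.hub-v (cl (src G e)))) e (at-src refl)
  ... | inj₁ eq        = ⊥-elim (true≢false (subst (λ e → spinal G e ≡ true) (sym eq) (clean-spinal (cl (src G e)))) rib)
  ... | inj₂ (inj₁ eq) = _ , ≡-trans (opposite-edge (clean-rotate (clean-rotate (cl (src G e))))) (sym eq)
  ... | inj₂ (inj₂ eq) = _ , ≡-trans (opposite-edge (clean-rotate (cl (src G e)))) (sym eq)

  r-rib : ∀ v → spinal G (Clean.r (cl v)) ≡ false
  r-rib v = clean-ribbed (clean-rotate (cl v))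

  meet : ∀ v v₂ → SameTri v v₂ → ∃ λ u → In G (Clean.r (cl v)) u × In G (Clean.r (cl v₂)) u
  meet v v₂ h with tri-members (cl v) (same-trans h (same-x (cl v₂))) | tri-members (cl v) (same-trans h (same-y (cl v₂)))
  ... | inj₂ (inj₁ eq) | _ = _ , joins-inˡ (r-joins (cl v)) , subst (In G _) eq (joins-inˡ (r-joins (cl v₂)))
  ... | inj₂ (inj₂ eq) | _ = _ , joins-inʳ (r-joins (cl v)) , subst (In G _) eq (joins-inˡ (r-joins (cl v₂)))
  ... | inj₁ _ | inj₂ (inj₁ eq) = _ , joins-inˡ (r-joins (cl v)) , subst (In G _) eq (joins-inʳ (r-joins (cl v₂)))
  ... | inj₁ _ | inj₂ (inj₂ eq) = _ , joins-inʳ (r-joins (cl v)) , subst (In G _) eq (joins-inʳ (r-joins (cl v₂)))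
  ... | inj₁ h₁ | inj₁ h₂ = contradiction (≡-trans h₁ (sym h₂)) (x≢y (cl v₂))

  module _ (¬linked : ¬ DoublyLinked) where

    -- For spinal `f` the matching of all spinal edges avoids the rib. For a rib `f` of another
    -- triangle, failure would give two linked triangles. A rib of the same triangle shares an end
    -- with `e`, so every matching through it avoids `e`.
    rib-removable : ∀ v → StrictlyRemovable G (Clean.r (cl v))
    rib-removable v = mkSR avoid λ f par →
      Parallel.f≢e par (rib-unique (clean-rotate (cl v)) (of-parallel (r-joins (cl v)) par))
      where
      e = Clean.r (cl v)
      avoid : ∀ f → f ≢ e → Avoid G f e
      avoid f f≢e with avoid? G f e
      ... | yes a = a
      ... | no ¬a with spinal G f in eq
      ...   | true  = contradiction (mkAvoid spinal-PM eq (r-rib v)) ¬a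
      ...   | false with apex eq
      ...     | v₂ , refl with sameTri? v v₂
      ...       | no apart = ⊥-elim (¬linked (implied⇒linked (cl v) (cl v₂) apart
                    λ pm Mf → ¬false λ Me → ¬a (mkAvoid pm Mf Me)))
      ...       | yes same with meet v v₂ same | through f
      ...         | u , e-in , f-in | M , pm , Mf = mkAvoid pm Mf (PM-reject pm Mf f-in e-in (≢-sym f≢e))

    -- Sending a vertex to the opposite edge of its triangle is a bijection from the vertices to the
    -- ribs.
    weight≡n : weight G ≡ n G
    weight≡n = ≡-trans (sym (count-bij {p = λ _ → true} {q = removableᵇ G} (λ v → Clean.r (cl v)) (λ v _ → ⇒removableᵇ (rib-removable v))
      (λ v v′ _ _ → r-injective v v′) onto)) (count-all (n G))
      where
      r-injective : ∀ v v′ → Clean.r (cl v) ≡ Clean.r (cl v′) → v ≡ v′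
      r-injective v v′ eq with joins-ends (r-joins (cl v′)) (subst (λ e → In G e (x v)) eq (joins-inˡ (r-joins (cl v))))
      ... | h with tri-members (cl v) (same-trans (same-x (cl v)) (same-sym (members-same (cl v′) (inj₂ h))))
      ...   | inj₁ k = sym k
      ...   | inj₂ k = contradiction (subst (λ e → In G e v′) eq ([ (λ { refl → joins-inˡ (r-joins (cl v)) }) , (λ { refl → joins-inʳ (r-joins (cl v)) }) ]′ k)) (r∌v (cl v′))
      onto : ∀ e → removableᵇ G e ≡ true → ∃ λ v → true ≡ true × Clean.r (cl v) ≡ e
      onto e h with spinal G e in eq
      ... | false = let v , r≡e = apex eq in v , refl , r≡e
      ... | true  = ⊥-elim (stem-not-removable cg (Hub.star hub-v) (Hub.jp hub-v) (Hub.jq hub-v) (inj₂ (_ , Hub.jq hub-x))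
        (subst (StrictlyRemovable G) (sym (spinal-unique {e} (at-src refl) eq)) (removableᵇ⇒ h)))
        where open Clean (cl (src G e))

    -- The four triangles are distinct: a stem leaves its triangle, and two stems of one triangle
    -- ending in the same triangle would link them doubly.
    twelve≤n : 12 ≤ n G
    twelve≤n = injective⇒≤ {f = λ k → point (remQuot {4} 3 k)} λ {i} {j} eq →
      ≡-trans (sym (combine-remQuot {4} 3 i)) (≡-trans (cong (uncurry combine) (point-injective {remQuot {4} 3 i} {remQuot {4} 3 j} eq)) (combine-remQuot {4} 3 j))
      where
      v₀ : V G
      v₀ = fromℕ< two≤
      c = cl v₀
      c₁ = clean-rotate c
      c₂ = clean-rotate c₁
      heads : Fin 4 → V G
      heads 0F = v₀
      heads 1F = Clean.w c
      heads 2F = Clean.w c₁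
      heads 3F = Clean.w c₂
      point : Fin 4 × Fin 3 → V G
      point (i , j) = corners (cl (heads i)) j
      out : ∀ {u} → SameTri v₀ u → ∀ {w} → Spined u w → ¬ SameTri v₀ w
      out h sp k = spined-apart sp (same-trans (same-sym h) k)
      two-out : ∀ {u u′ w w′} → u ≢ u′ → SameTri u u′ → Spined u w → Spined u′ w′ → ¬ SameTri w w′
      two-out u≢u′ uu′ sp sp′ k = ¬linked (_ , _ , _ , _ , u≢u′ , uu′ , k , sp , sp′)
      heads-apart : ∀ i j → i ≢ j → ¬ SameTri (heads i) (heads j)
      heads-apart 0F 1F _ = out (inj₁ refl) (clean-partner c)
      heads-apart 0F 2F _ = out (same-x c) (clean-partner c₁)
      heads-apart 0F 3F _ = out (same-y c) (clean-partner c₂)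
      heads-apart 1F 2F _ = two-out (v≢x c) (same-x c) (clean-partner c) (clean-partner c₁)
      heads-apart 1F 3F _ = two-out (v≢y c) (same-y c) (clean-partner c) (clean-partner c₂)
      heads-apart 2F 3F _ = two-out (v≢x c₁) (same-x c₁) (clean-partner c₁) (clean-partner c₂)
      heads-apart 1F 0F _ = heads-apart 0F 1F (λ ()) ∘ same-sym
      heads-apart 2F 0F _ = heads-apart 0F 2F (λ ()) ∘ same-sym
      heads-apart 3F 0F _ = heads-apart 0F 3F (λ ()) ∘ same-sym
      heads-apart 2F 1F _ = heads-apart 1F 2F (λ ()) ∘ same-sym
      heads-apart 3F 1F _ = heads-apart 1F 3F (λ ()) ∘ same-sym
      heads-apart 3F 2F _ = heads-apart 2F 3F (λ ()) ∘ same-sym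
      heads-apart 0F 0F h = contradiction refl h
      heads-apart 1F 1F h = contradiction refl h
      heads-apart 2F 2F h = contradiction refl h
      heads-apart 3F 3F h = contradiction refl h
      point-injective : ∀ {p q} → point p ≡ point q → p ≡ q
      point-injective {i , k} {j , l} eq with i ≟ j
      ... | yes refl = cong (i ,_) (corners-injective (cl (heads i)) eq)
      ... | no i≢j   = contradiction (same-trans (corners-same (cl (heads i)) k)
          (same-sym (subst (SameTri (heads j)) (sym eq) (corners-same (cl (heads j)) l)))) (heads-apart i j i≢j)

data Brick (G : Graph) : Set where
  ordinary : Bipartite G ⊎ IsK4 G ⊎ IsC6bar G → Brick G
  special  : weight G ≡ n G → 12 ≤ n G → Brick G

opaque
  brick : ∀ {G} → Cornered G → Covered G → NoNTC G → Brick G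
  brick {G} cg cov prime with Prime.all-clean G cg cov prime
  ... | inj₂ (inj₁ h) = ordinary (inj₁ h)
  ... | inj₂ (inj₂ h) = ordinary (inj₂ (inj₁ h))
  ... | inj₁ clean-at with Stems.doublyLinked? G cg cov prime clean-at
  ...   | yes h = ordinary (inj₂ (inj₂ (Bricks.linked⇒c6bar G cg cov prime clean-at h)))
  ...   | no h  = special (Bricks.weight≡n G cg cov prime clean-at h) (Bricks.twelve≤n G cg cov prime clean-at h)

ordinary⇒0 : ∀ {G} → Cornered G → Bipartite G ⊎ IsK4 G ⊎ IsC6bar G → weight G ≡ 0
ordinary⇒0 cg (inj₁ h)        = bipartite⇒0 cg h
ordinary⇒0 cg (inj₂ (inj₁ h)) = k4⇒0 (Cornered.loopless cg) h
ordinary⇒0 cg (inj₂ (inj₂ h)) = c6bar⇒0 (Cornered.loopless cg) h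

-- The weight as a sum over a tight cut decomposition

tcd⇒covered : ∀ {G L} → TCD G L → Covered G
tcd⇒covered (leaf mc _)            = mc⇒covered mc
tcd⇒covered (split _ mc _ _ _ _ _) = mc⇒covered mc

contractions⇒halves : ∀ {G H₁ H₂ X} → NontrivialTightCut G X → Contraction G X H₁ → Contraction G (λ v → not (X v)) H₂ →
                      Covered G → Covered H₁ → Covered H₂ → Halves G H₁ H₂ X (λ v → not (X v))
contractions⇒halves {G} {X = X} ntc C₁ C₂ cov cov₁ cov₂ = record
  { left = contraction⇒side (λ _ → refl) C₁ ; right = contraction⇒side (λ _ → refl) C₂ ; Q≡¬P = λ _ → refl
  ; cov = cov ; cov₁ = cov₁ ; cov₂ = cov₂ ; ntc = ntc⇒NTC {G} {X} ntc }

special-++ : ∀ L₁ {L₂ ns} → SpecialBricks (L₁ ++ L₂) ns →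
             ∃₂ λ ns₁ ns₂ → SpecialBricks L₁ ns₁ × SpecialBricks L₂ ns₂ × ns ≡ ns₁ ++ ns₂
special-++ []       sb = [] , _ , [] , sb , refl
special-++ (H ∷ L₁) (keep h₁ h₂ h₃ sb) with special-++ L₁ sb
... | ns₁ , ns₂ , sb₁ , sb₂ , refl = n H ∷ ns₁ , ns₂ , keep h₁ h₂ h₃ sb₁ , sb₂ , refl
special-++ (H ∷ L₁) (skip h sb) with special-++ L₁ sb
... | ns₁ , ns₂ , sb₁ , sb₂ , refl = ns₁ , ns₂ , skip h sb₁ , sb₂ , refl

weight-sum : ∀ {G L ns} → TCD G L → Cornered G → SpecialBricks L ns → weight G ≡ sum ns
weight-sum (leaf mc none) cg (keep ¬bip ¬k4 ¬c6 []) with brick cg (mc⇒covered mc) (brick⇒NoNTC none)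
... | ordinary h  = ⊥-elim ([ ¬bip , [ ¬k4 , ¬c6 ]′ ]′ h)
... | special h _ = ≡-trans h (sym (+-identityʳ _))
weight-sum (leaf mc none) cg (skip h []) = ordinary⇒0 cg h
weight-sum {G} (split {H₁ = H₁} {H₂} {L₁} X mc ntc C₁ C₂ t₁ t₂) cg sb with special-++ L₁ sb
... | ns₁ , ns₂ , sb₁ , sb₂ , refl =
  ≡-trans weight-+ (≡-trans (cong₂ _+_ (weight-sum t₁ cornered₁ sb₁) (weight-sum t₂ cornered₂ sb₂)) (sym (sum-++ ns₁ ns₂)))
  where
  parts : Split G H₁ H₂
  parts = halves⇒split (contractions⇒halves ntc C₁ C₂ (mc⇒covered mc) (tcd⇒covered t₁) (tcd⇒covered t₂)) cg
  open Split parts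

-- A positive weight is at least twelve

count-not : ∀ {m} (p : Fin m → Bool) → count p + count (λ i → not (p i)) ≡ m
count-not {zero}  p = refl
count-not {suc m} p with p zero
... | true  = cong suc (count-not (p ∘ suc))
... | false = ≡-trans (+-suc _ _) (cong suc (count-not (p ∘ suc)))

-- The lower bound is about the graph alone, with no decomposition given, so the contractions are
-- constructed here. Vertex `zero` is the shrunk one, the others are numbered by `rank`.
module Shrink (G : Graph) (P : V G → Bool) where

  image : ∀ v b → P v ≡ b → Fin (suc (count P))
  image v true  h = suc (rank P v h)
  image v false _ = zero

  φ : V G → Fin (suc (count P))
  φ v = image v (P v) refl

  shrink : Graph
  shrink = mkGraph (suc (count P)) (mapL (λ e → φ (proj₁ e) , φ (proj₂ e)) (filterᵇ (λ e → P (proj₁ e) ∨ P (proj₂ e)) (edges G)))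

  φ-true : ∀ {v} → P v ≡ true → ∃ λ h → φ v ≡ suc (rank P v h)
  φ-true {v} h = go (P v) refl h
    where go : ∀ b (eq : P v ≡ b) → b ≡ true → ∃ λ h → image v b eq ≡ suc (rank P v h)
          go true eq _ = eq , refl

  φ-false : ∀ {v} → P v ≡ false → φ v ≡ zero
  φ-false {v} h = go (P v) refl h
    where go : ∀ b (eq : P v ≡ b) → b ≡ false → image v b eq ≡ zero
          go false _ _ = refl

  contraction : ∀ {u} → P u ≡ false → Contraction G P shrink
  contraction {u} Pu = φ , zero , φ-inj , (λ _ → φ-false) , φ-in , φ-onto , refl
    where
    φ-inj : ∀ u v → P u ≡ true → P v ≡ true → φ u ≡ φ v → u ≡ v
    φ-inj u v hu hv eq with φ-true hu | φ-true hv
    ... | h , k | h′ , k′ = rank-injective P h h′ (suc-injective (≡-trans (sym k) (≡-trans eq k′)))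
    φ-in : ∀ v → P v ≡ true → φ v ≢ zero
    φ-in v hv eq with φ-true hv
    ... | _ , k with ≡-trans (sym k) eq
    ... | ()
    φ-onto : ∀ w → ∃ λ v → φ v ≡ w
    φ-onto zero    = u , φ-false Pu
    φ-onto (suc j) with φ-true (pick-true P j)
    ... | h , k = pick P j , ≡-trans k (cong suc (pick-injective P (pick-rank P (pick P j) h)))

  shrink-covered : Covered G → (∀ {M} → PM G M → OneCross G P M) → 2 ≤ count P → ∀ {u} → P u ≡ false → Covered shrink
  shrink-covered cov tight two Pu = record
    { connected = λ a b → let u , h = onto a ; v , k = onto b in subst₂ (Reach shrink) h k (walk (Covered.connected cov u v))
    ; two≤ = m≤n⇒m≤1+n two
    ; through = λ i → let M , pm , Mi = Covered.through cov (Side.σ S i) in M ∘ Side.σ S , SideLemmas.restrict S pm (tight pm) , Mi }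
    where
    C = contraction Pu
    S : Side G shrink P
    S = contraction⇒side (λ _ → refl) C
    onto : ∀ w → ∃ λ v → φ v ≡ w
    onto = proj₁ (proj₂ (proj₂ (proj₂ (proj₂ (proj₂ C)))))
    walk : ∀ {u v} → Reach G u v → Reach shrink (φ u) (φ v)
    walk here = here
    walk (step {u} {w} a r) with P u ≟ᵇ true | P w ≟ᵇ true | adj⇒joins G a
    ... | yes Pu | _ | e , j = let i , k = SideLemmas.joins-lift S Pu j in step (joins⇒adj shrink i k) (walk r)
    ... | no _ | yes Pw | e , j = let i , k = SideLemmas.joins-lift S Pw (joins-sym j) in step (joins⇒adj shrink i (joins-sym k)) (walk r)
    ... | no ¬Pu | no ¬Pw | _ = subst (λ z → Reach shrink z _) (≡-trans (φ-false (¬true ¬Pw)) (sym (φ-false (¬true ¬Pu)))) (walk r)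

opaque
  -- The failure of tightness is witnessed by one perfect matching, so it is the notion to search
  -- for; decidability of tightness follows.
  untight? : ∀ G X → Dec (∃ λ s → PerfectMatching G (lookupᵛ s) × count (λ e → lookupᵛ s e ∧ inCutᵇ G X e) ≢ 1)
  untight? G X = anySubset? λ s → all? (λ v → count (λ i → lookupᵛ s i ∧ incidentᵇ (ends G i) v) ℕ.≟ 1)
                                  ×-dec ¬? (count (λ e → lookupᵛ s e ∧ inCutᵇ G X e) ℕ.≟ 1)

  tight? : ∀ G X → Dec (Tight G X)
  tight? G X with untight? G X
  ... | yes (s , pm , neq) = no λ t → neq (t (lookupᵛ s) pm)
  ... | no none = yes λ M pm → decidable-stable (count (λ e → M e ∧ inCutᵇ G X e) ℕ.≟ 1) λ neq →
    none (tabulate M , PM⇒pm {G} (PM-cong (λ e → sym (lookup∘tabulate M e)) (pm⇒PM {G} pm))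
      , λ eq → neq (≡-trans (count-cong λ e → cong (_∧ inCutᵇ G X e) (sym (lookup∘tabulate M e))) eq))

  tight-cut? : ∀ G → (∃ λ X → NontrivialTightCut G X) ⊎ NoNTC G
  tight-cut? G with anySubset? (λ s → ((2 ℕ.≤? count (lookupᵛ s)) ×-dec (2 ℕ.≤? count (λ v → not (lookupᵛ s v)))) ×-dec tight? G (lookupᵛ s))
  ... | yes (s , h) = inj₁ (lookupᵛ s , h)
  ... | no none = inj₂ λ X u≢u′ Xu Xu′ w≢w′ Xw Xw′ cross → none (tabulate X ,
      (distinct⇒two≤ u≢u′ (≡-trans (lookup∘tabulate X _) Xu) (≡-trans (lookup∘tabulate X _) Xu′) ,
       distinct⇒two≤ w≢w′ (not-false (≡-trans (lookup∘tabulate X _) Xw)) (not-false (≡-trans (lookup∘tabulate X _) Xw′))) ,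
      ⇒tight {G} {lookupᵛ (tabulate X)} λ pm → let e , (Me , ce) , uniq = cross pm in
        e , (Me , mkCut (≡-trans (cut-eq X e) (crosses ce))) , λ f (Mf , cf) → uniq f (Mf , mkCut (≡-trans (sym (cut-eq X f)) (crosses cf))))
    where
    cut-eq : ∀ X e → inCutᵇ G (lookupᵛ (tabulate X)) e ≡ inCutᵇ G X e
    cut-eq X e = cong₂ _xor_ (lookup∘tabulate X _) (lookup∘tabulate X _)

module Cuts (G : Graph) (cg : Cornered G) (cov : Covered G) (X : V G → Bool) (ntc : NontrivialTightCut G X) where

  X′ : V G → Bool
  X′ v = not (X v)

  open NTC (ntc⇒NTC {G} {X} ntc)

  v₀ : V G
  v₀ = fromℕ< (Covered.two≤ cov)

  out : ∃ λ u → u ≢ v₀ × X u ≡ false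
  out = outside v₀

  out′ : ∃ λ u → u ≢ v₀ × X′ u ≡ false
  out′ = let u , u≢ , Xu = inside v₀ in u , u≢ , cong not Xu

  H₁ H₂ : Graph
  H₁ = Shrink.shrink G X
  H₂ = Shrink.shrink G X′

  cov₁ : Covered H₁
  cov₁ = Shrink.shrink-covered G X cov tight (proj₁ (proj₁ ntc)) (proj₂ (proj₂ out))

  cov₂ : Covered H₂
  cov₂ = Shrink.shrink-covered G X′ cov (λ pm → let e , (Me , ce) , uniq = tight pm in
      e , (Me , cut-flip (λ _ → refl) ce) , λ f (Mf , cf) → uniq f (Mf , cut-flip (λ v → sym (not-involutive (X v))) cf))
    (proj₂ (proj₁ ntc)) (proj₂ (proj₂ out′))

  parts : Split G H₁ H₂
  parts = halves⇒split (contractions⇒halves ntc (Shrink.contraction G X (proj₂ (proj₂ out)))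
    (Shrink.contraction G X′ (proj₂ (proj₂ out′))) cov cov₁ cov₂) cg

  -- At least two vertices are replaced by one.
  smaller₁ : suc (n H₁) ≤ n G
  smaller₁ = subst₂ _≤_ (+-comm (count X) 2) (count-not X) (+-monoʳ-≤ (count X) (proj₂ (proj₁ ntc)))

  smaller₂ : suc (n H₂) ≤ n G
  smaller₂ = subst (suc (n H₂) ≤_) (count-not X) (+-monoˡ-≤ (count X′) (proj₁ (proj₁ ntc)))

-- Induction on a bound `k` for the number of vertices. By additivity a nonzero weight is inherited
-- by one of the two contractions, until a graph without nontrivial tight cuts is reached.
twelve≤weight : ∀ k G → n G ≤ k → Cornered G → Covered G → weight G ≢ 0 → 12 ≤ weight G
twelve≤weight zero    G n≤0 cg cov w≢0 = contradiction (≤-trans (Covered.two≤ cov) n≤0) λ ()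
twelve≤weight (suc k) G n≤k cg cov w≢0 with tight-cut? G
... | inj₂ prime with brick cg cov prime
...   | ordinary h     = contradiction (ordinary⇒0 cg h) w≢0
...   | special h 12≤n = subst (12 ≤_) (sym h) 12≤n
twelve≤weight (suc k) G n≤k cg cov w≢0 | inj₁ (X , ntc) with weight (Cuts.H₁ G cg cov X ntc) ℕ.≟ 0
... | no w₁≢0 = subst (12 ≤_) (sym (Split.weight-+ parts)) (≤-trans
      (twelve≤weight k H₁ (ℕ.s≤s⁻¹ (≤-trans smaller₁ n≤k)) (Split.cornered₁ parts) cov₁ w₁≢0) (m≤m+n _ _))
  where open Cuts G cg cov X ntc
... | yes w₁≡0 = subst (12 ≤_) (sym w≡w₂)
      (twelve≤weight k H₂ (ℕ.s≤s⁻¹ (≤-trans smaller₂ n≤k)) (Split.cornered₂ parts) cov₂ λ w₂≡0 → w≢0 (≡-trans w≡w₂ w₂≡0))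
  where
  open Cuts G cg cov X ntc
  w≡w₂ : weight G ≡ weight H₂
  w≡w₂ = ≡-trans (Split.weight-+ parts) (cong (_+ weight H₂) w₁≡0)

-- The truncated tetrahedron

pattern I = true
pattern O = false

-- The extremal case of the count of four triangles: vertices 3t, 3t + 1, 3t + 2 replace the vertex
-- t of K₄. The first twelve edges are the ribs and the last six come from K₄, whence the
-- comparisons of edge numbers with 12.
truncatedK4 : Graph
truncatedK4 = mkGraph 12
  ( (# 0 , # 1) ∷ (# 0 , # 2) ∷ (# 1 , # 2) ∷ (# 3 , # 4) ∷ (# 3 , # 5) ∷ (# 4 , # 5)
  ∷ (# 6 , # 7) ∷ (# 6 , # 8) ∷ (# 7 , # 8) ∷ (# 9 , # 10) ∷ (# 9 , # 11) ∷ (# 10 , # 11)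
  ∷ (# 0 , # 3) ∷ (# 1 , # 6) ∷ (# 2 , # 9) ∷ (# 4 , # 7) ∷ (# 5 , # 10) ∷ (# 8 , # 11) ∷ [])

-- Its eight perfect matchings, one for each element of the cycle space of K₄.
matchings : Vec (Vec Bool 18) 8
matchings =
    (O ∷ O ∷ O ∷ O ∷ O ∷ O ∷ O ∷ O ∷ O ∷ O ∷ O ∷ O ∷ I ∷ I ∷ I ∷ I ∷ I ∷ I ∷ [])
  ∷ (O ∷ O ∷ O ∷ O ∷ O ∷ I ∷ O ∷ O ∷ I ∷ O ∷ O ∷ I ∷ I ∷ I ∷ I ∷ O ∷ O ∷ O ∷ [])
  ∷ (O ∷ O ∷ I ∷ O ∷ O ∷ O ∷ O ∷ I ∷ O ∷ O ∷ I ∷ O ∷ I ∷ O ∷ O ∷ I ∷ I ∷ O ∷ [])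
  ∷ (O ∷ O ∷ I ∷ O ∷ O ∷ I ∷ I ∷ O ∷ O ∷ I ∷ O ∷ O ∷ I ∷ O ∷ O ∷ O ∷ O ∷ I ∷ [])
  ∷ (O ∷ I ∷ O ∷ O ∷ I ∷ O ∷ O ∷ O ∷ O ∷ I ∷ O ∷ O ∷ O ∷ I ∷ O ∷ I ∷ O ∷ I ∷ [])
  ∷ (O ∷ I ∷ O ∷ I ∷ O ∷ O ∷ O ∷ O ∷ I ∷ O ∷ I ∷ O ∷ O ∷ I ∷ O ∷ O ∷ I ∷ O ∷ [])
  ∷ (I ∷ O ∷ O ∷ O ∷ I ∷ O ∷ O ∷ I ∷ O ∷ O ∷ O ∷ I ∷ O ∷ O ∷ I ∷ I ∷ O ∷ O ∷ [])
  ∷ (I ∷ O ∷ O ∷ I ∷ O ∷ O ∷ I ∷ O ∷ O ∷ O ∷ O ∷ O ∷ O ∷ O ∷ I ∷ O ∷ I ∷ I ∷ [])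
  ∷ []

matching : Fin 8 → Edge truncatedK4 → Bool
matching k = lookupᵛ (lookupᵛ matchings k)

-- The first two are the other vertices of the triangle, the third is the other end of the spinal
-- edge.
mate₁ mate₂ mate₃ : Fin 12 → Fin 12
mate₁ = lookupᵛ (# 1 ∷ # 0 ∷ # 0 ∷ # 4 ∷ # 3 ∷ # 3 ∷ # 7 ∷ # 6 ∷ # 6 ∷ # 10 ∷ # 9 ∷ # 9 ∷ [])
mate₂ = lookupᵛ (# 2 ∷ # 2 ∷ # 1 ∷ # 5 ∷ # 5 ∷ # 4 ∷ # 8 ∷ # 8 ∷ # 7 ∷ # 11 ∷ # 11 ∷ # 10 ∷ [])
mate₃ = lookupᵛ (# 3 ∷ # 6 ∷ # 9 ∷ # 0 ∷ # 7 ∷ # 10 ∷ # 1 ∷ # 4 ∷ # 11 ∷ # 2 ∷ # 5 ∷ # 8 ∷ [])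

module TruncatedK4 where

  G : Graph
  G = truncatedK4

  opaque
    simple : Simple G
    simple = toWitness {a? = all? λ i → ¬? (src G i ≟ tgt G i)} _ ,
      toWitness {a? = all? λ i → all? λ j → ¬? (i ≟ j) →-dec
        (¬? (≡-dec _≟_ _≟_ (ends G i) (ends G j)) ×-dec ¬? (≡-dec _≟_ _≟_ (ends G i) (tgt G j , src G j)))} _

    cubic : Cubic G
    cubic = toWitness {a? = all? λ v → degree G v ℕ.≟ 3} _

    mates-adjacent : ∀ v → Adj G (mate₁ v) (mate₂ v)
    mates-adjacent = toWitness {a? = all? λ v → adj? G (mate₁ v) (mate₂ v)} _

    neighbours : ∀ v e a → Joins G e v a → a ≡ mate₃ v ⊎ a ≡ mate₁ v ⊎ a ≡ mate₂ v
    neighbours = toWitness {a? = all? λ v → all? λ e → all? λ a → joins? G e v a →-dec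
      ((a ≟ mate₃ v) ⊎-dec ((a ≟ mate₁ v) ⊎-dec (a ≟ mate₂ v)))} _

    perfect : ∀ k → PerfectMatching G (matching k)
    perfect = toWitness {a? = all? λ k → all? λ v → count (λ i → matching k i ∧ incidentᵇ (ends G i) v) ℕ.≟ 1} _

    matched-somewhere : ∀ e → ∃ λ k → matching k e ≡ true
    matched-somewhere = toWitness {a? = all? λ e → any? λ k → matching k e ≟ᵇ true} _

    rib-avoided : ∀ e → toℕ e ℕ.< 12 → ∀ f → f ≢ e → ∃ λ k → matching k f ≡ true × matching k e ≡ false
    rib-avoided = toWitness {a? = all? λ e → (toℕ e ℕ.<? 12) →-dec all? λ f → ¬? (f ≟ e) →-dec
      any? λ k → (matching k f ≟ᵇ true) ×-dec (matching k e ≟ᵇ false)} _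

    stem-opposite : ∀ e → ¬ toℕ e ℕ.< 12 → mate₃ (src G e) ≡ tgt G e
    stem-opposite = toWitness {a? = all? λ e → ¬? (toℕ e ℕ.<? 12) →-dec (mate₃ (src G e) ≟ tgt G e)} _

    mates-distinct : ∀ v → mate₁ v ≢ v × mate₂ v ≢ v
    mates-distinct = toWitness {a? = all? λ v → ¬? (mate₁ v ≟ v) ×-dec ¬? (mate₂ v ≟ v)} _

  adj-sym : ∀ {u v} → Adj G u v → Adj G v u
  adj-sym (inj₁ h) = inj₂ h
  adj-sym (inj₂ h) = inj₁ h

  claw-free : ClawFree G
  claw-free v a b c va vb vc a≢b a≢c b≢c ¬ab ¬ac ¬bc = go (near va) (near vb) (near vc)
    where
    near : ∀ {u} → Adj G v u → u ≡ mate₃ v ⊎ u ≡ mate₁ v ⊎ u ≡ mate₂ v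
    near h = let e , j = adj⇒joins G h in neighbours v e _ j
    clash : ∀ {a b} → a ≢ b → ¬ Adj G a b → a ≡ mate₁ v ⊎ a ≡ mate₂ v → b ≡ mate₁ v ⊎ b ≡ mate₂ v → ⊥
    clash a≢b _ (inj₁ refl) (inj₁ h)    = a≢b (sym h)
    clash a≢b _ (inj₂ refl) (inj₂ h)    = a≢b (sym h)
    clash _ ¬ab (inj₁ refl) (inj₂ refl) = ¬ab (mates-adjacent v)
    clash _ ¬ab (inj₂ refl) (inj₁ refl) = ¬ab (adj-sym (mates-adjacent v))
    go : a ≡ mate₃ v ⊎ a ≡ mate₁ v ⊎ a ≡ mate₂ v → b ≡ mate₃ v ⊎ b ≡ mate₁ v ⊎ b ≡ mate₂ v →
         c ≡ mate₃ v ⊎ c ≡ mate₁ v ⊎ c ≡ mate₂ v → ⊥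
    go (inj₂ h)    (inj₂ k)    _           = clash a≢b ¬ab h k
    go (inj₂ h)    (inj₁ _)    (inj₂ k)    = clash a≢c ¬ac h k
    go (inj₁ _)    (inj₂ h)    (inj₂ k)    = clash b≢c ¬bc h k
    go (inj₁ refl) (inj₁ refl) _           = a≢b refl
    go (inj₁ refl) (inj₂ _)    (inj₁ refl) = a≢c refl
    go (inj₂ _)    (inj₁ refl) (inj₁ refl) = b≢c refl

  opaque
    -- The numbering yields a spanning tree rooted at vertex 0, so connectedness needs no search for
    -- paths.
    parent-adjacent : ∀ v → v ≡ zero ⊎ ∃ λ u → toℕ u ℕ.< toℕ v × Adj G v u
    parent-adjacent = toWitness {a? = all? λ v → (v ≟ zero) ⊎-dec any? λ u → (toℕ u ℕ.<? toℕ v) ×-dec adj? G v u} _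

  connected : Connected G
  connected u v = ascend (descend 12 v (toℕ<n v)) (descend 12 u (toℕ<n u))
    where
    descend : ∀ k v → toℕ v ℕ.< k → Reach G v zero
    descend (suc k) v v<k with parent-adjacent v
    ... | inj₁ refl          = here
    ... | inj₂ (u , u<v , a) = step a (descend k u (≤-trans u<v (ℕ.s≤s⁻¹ v<k)))
    append : ∀ {a b c} → Reach G a b → Reach G b c → Reach G a c
    append here       s = s
    append (step h r) s = step h (append r s)
    reverse : ∀ {a b} → Reach G a b → Reach G b a
    reverse here       = here
    reverse (step h r) = append (reverse r) (step (adj-sym h) here)
    ascend : ∀ {u v} → Reach G v zero → Reach G u zero → Reach G u v
    ascend r s = append s (reverse r)

  matching-covered : MatchingCovered G
  matching-covered = connected , s≤s (s≤s z≤n) , λ e → let k , h = matched-somewhere e in matching k , perfect k , h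

  cornered : Cornered G
  cornered = claw-free⇒cornered simple cubic claw-free

  covered : Covered G
  covered = mc⇒covered matching-covered

  rib-removable : ∀ e → toℕ e ℕ.< 12 → StrictlyRemovable G e
  rib-removable e h = mkSR (λ f f≢e → let k , Mf , Me = rib-avoided e h f f≢e in mkAvoid {M = matching k} (pm⇒PM (perfect k)) Mf Me)
    (simple⇒nonparallel simple)

  -- Each of these six edges is forced by the rib opposite to its source.
  stem-fixed : ∀ e → ¬ toℕ e ℕ.< 12 → ¬ StrictlyRemovable G e
  stem-fixed e h with adj⇒joins G (mates-adjacent (src G e))
  ... | f , j = Forcing.forced₁ {G} (proj₁ simple) (ends-joins G e) j
    (proj₁ (mates-distinct (src G e))) (proj₂ (mates-distinct (src G e)))
    λ { {z} (g , k) → case neighbours (src G e) g z k of λ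
      { (inj₁ eq) → inj₁ (≡-trans eq (stem-opposite e h)) ; (inj₂ eq) → inj₂ eq } }

  weight≡12 : weight G ≡ 12
  weight≡12 = count-cong {q = λ e → ⌊ toℕ e ℕ.<? 12 ⌋} λ e → bool-ext
    (λ h → ⌊⌋-intro (toℕ e ℕ.<? 12) (decidable-stable (toℕ e ℕ.<? 12) λ ¬h → stem-fixed e ¬h (removableᵇ⇒ h)))
    (λ h → ⇒removableᵇ (rib-removable e (⌊⌋-true {d = toℕ e ℕ.<? 12} h)))

  not-minimal : ¬ MinimalMatchingCovered G
  not-minimal (_ , none) = none zero (strictly⇒removable simple cornered covered (rib-removable zero (s≤s z≤n)))

theorem1p3 : ((G : Graph) → Simple G → Cubic G → ClawFree G → MatchingCovered G →
    ¬ MinimalMatchingCovered G →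
    ((L : List Graph) → TCD G L → (ns : List ℕ) → SpecialBricks L ns →
    1 ≤ length ns × REcount G (sum ns))
    × ((k : ℕ) → REcount G k → 12 ≤ k))
    × Σ Graph (λ G → Simple G × Cubic G × ClawFree G × MatchingCovered G ×
    ¬ MinimalMatchingCovered G × REcount G 12)
theorem1p3 =
  (λ G simple cubic cf mc ¬minimal → let open General G simple cubic cf mc ¬minimal in
    (λ L t ns sb → length-positive ns (λ eq → weight≢0 (≡-trans (weight-sum t cg sb) eq)) ,
                   subst (REcount G) (weight-sum t cg sb) (REcount-weight simple cg cov)) ,
    (λ k re → subst (12 ≤_) (sym (REcount-unique simple cg cov re)) (twelve≤weight (n G) G ≤-refl cg cov weight≢0))) ,
  truncatedK4 , simple , cubic , claw-free , matching-covered , not-minimal ,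
  subst (REcount truncatedK4) weight≡12 (REcount-weight simple cornered covered)
  where
  open TruncatedK4
  length-positive : ∀ ns → sum ns ≢ 0 → 1 ≤ length ns
  length-positive []      h = contradiction refl h
  length-positive (_ ∷ _) _ = s≤s z≤n
  module General (G : Graph) (simple : Simple G) (cubic : Cubic G) (cf : ClawFree G) (mc : MatchingCovered G)
                 (¬minimal : ¬ MinimalMatchingCovered G) where
    cg : Cornered G
    cg = claw-free⇒cornered simple cubic cf
    cov : Covered G
    cov = mc⇒covered mc
    weight≢0 : weight G ≢ 0
    weight≢0 eq = ¬minimal (mc , λ e r → none e (⇒removableᵇ (removable⇒strictly simple r)))
      where
      none : ∀ e → removableᵇ G e ≢ true
      none e h = case subst Fin eq (rank (removableᵇ G) e h) of λ ()
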